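{- Consider the ATP problem with identical request distributions $\mathcal D_1=\dots=\mathcal D_T=\mathcal D$ (of finite support) with symmetric prices, i.e. $b=s$ for every tuple $(b,s)$ in the support of $\mathcal D$, and initial inventory $B_0\ge 1$. (a) There is an absolute constant $C>0$ such that for every such instance with capacity $B\ge 2$ there exists an online algorithm whose expected profit is at least $\left(1-C\,\frac{\log B}{\sqrt{B}}\right)$ times the expected profit of the optimal offline algorithm. (b) There are absolute constants $c>0$ and $n_0$ such that for every integer $B\ge n_0$ there is such an instance with capacity $B$, whose optimal offline algorithm has positive expected profit $\mathrm{OPT}$, and on which every online algorithm has expected profit at most $\left(1-\frac{c}{\sqrt{B}}\right)\mathrm{OPT}$.
   Context: ATP (Asymmetric Trading Prophets) problem. A decision maker interacts with $T$ sequentially arriving requests to trade copies of a product. She has capacity $B\ge 1$ (she may hold at most $B$ copies at any time) and starts with an initial inventory of $B_0\in\{0,\dots,B\}$ copies. It is assumed throughout that $T\ge B_0$ and $B\le B_0+T$. At time $t\in\{1,\dots,T\}$ a price tuple $(b_t,s_t)$ of nonnegative prices is revealed, where $b_t$ is the cost of buying a copy and $s_t$ is the revenue from selling a copy; $(b_t,s_t)$ is drawn from a known distribution $\mathcal D_t$, independently across $t$. At time $t$ she takes exactly one action: Buy one copy at price $b_t$ (allowed if she holds at most $B-1$ copies), Sell one copy at price $s_t$ (allowed if she holds at least one copy), or Skip. Profit is total revenue from sales minus total cost of purchases. An online algorithm (possibly randomized) chooses its action at time $t$ knowing only the distributions, the tuples revealed up to and including time $t$, and its past actions. The optimal offline algorithm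 knows all realized tuples in advance and attains the maximum possible profit for each realization; its expected profit is the expectation of this maximum. -}

module Defs where

open import Algebra.Bundles using (CommutativeRing)
open import Algebra.Structures using (IsCommutativeRing)
import Algebra.Definitions.RawMonoid as RawMonoidDefinitions
import Algebra.Properties.Ring as RingProperties
import Algebra.Properties.Semiring.Mult as Mult
open import Data.Fin.Base using (Fin)
open import Data.List.Base using (List; []; _∷_; map; filter; cartesianProductWith)
import Data.List.Extrema as Extrema
open import Data.Nat.Base as ℕ using (ℕ; zero; suc; NonZero)
import Data.Nat.Properties as ℕ
open import Data.Product.Base using (∃; ∃₂; _,_; proj₁; proj₂) renaming (_×_ to _∧_)
open import Data.Sum.Base using (inj₁; inj₂)
open import Data.Unit.Base using (⊤; tt)
open import Data.Vec.Base using (Vec; []; _∷_)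
open import Level using (0ℓ)
open import Relation.Binary.Bundles using (DecTotalOrder)
open import Relation.Binary.Core using (Rel)
open import Relation.Binary.PropositionalEquality.Core using (_≡_; refl)
open import Relation.Binary.Structures using (IsDecTotalOrder)
import Relation.Binary.Construct.NonStrictToStrict as NonStrictToStrict
open import Relation.Nullary.Decidable.Core using (Dec; yes; _×-dec_)
open import Relation.Nullary.Negation.Core using (¬_)

-- The real numbers, given axiomatically: a Dedekind-complete, decidably
-- totally ordered field.  Classically this determines ℝ up to isomorphism.
-- Equality is a setoid equality, so Cauchy sequences of rationals are an
-- instance in the presence of excluded middle.

record CompleteOrderedField : Set₁ where
  infix  4 _≈_ _≤_
  infixl 6 _+_
  infixl 7 _*_
  infix  8 -_
  infix  9 _⁻¹
  field
    Carrier           : Set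
    _≈_ _≤_           : Rel Carrier 0ℓ
    _+_ _*_           : Carrier → Carrier → Carrier
    -_                : Carrier → Carrier
    0# 1#             : Carrier
    -- Total, with 0# ⁻¹ unspecified.
    _⁻¹               : Carrier → Carrier

    isCommutativeRing : IsCommutativeRing _≈_ _+_ _*_ -_ 0# 1#
    1≉0               : ¬ (1# ≈ 0#)
    ⁻¹-inverseʳ       : ∀ x → ¬ (x ≈ 0#) → x * x ⁻¹ ≈ 1#

    isDecTotalOrder   : IsDecTotalOrder _≈_ _≤_
    +-monoʳ-≤         : ∀ x {y z} → y ≤ z → x + y ≤ x + z
    *-nonNeg          : ∀ {x y} → 0# ≤ x → 0# ≤ y → 0# ≤ x * y

  UpperBound : (Carrier → Set) → Carrier → Set
  UpperBound P u = ∀ x → P x → x ≤ u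

  LeastUpperBound : (Carrier → Set) → Carrier → Set
  LeastUpperBound P u = UpperBound P u ∧ (∀ v → UpperBound P v → u ≤ v)

  field
    complete : (P : Carrier → Set) → ∃ P → ∃ (UpperBound P) → ∃ (LeastUpperBound P)

  commutativeRing : CommutativeRing 0ℓ 0ℓ
  commutativeRing = record { isCommutativeRing = isCommutativeRing }

  decTotalOrder : DecTotalOrder 0ℓ 0ℓ 0ℓ
  decTotalOrder = record { isDecTotalOrder = isDecTotalOrder }

  open CommutativeRing commutativeRing public using (_-_)
  open NonStrictToStrict _≈_ _≤_ public using (_<_)

module RealFunctions (ℝ : CompleteOrderedField) where
  open CompleteOrderedField ℝ

  private
    module R = CommutativeRing commutativeRing
    module O = DecTotalOrder decTotalOrder
    open Mult R.semiring using (_×_; ×1-homo-*)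
    open RingProperties R.ring
      using (-‿distribˡ-*; -‿involutive; x[y-z]≈xy-xz; [y-z]x≈yx-zx; xyx⁻¹≈y)

  fromℕ : ℕ → Carrier
  fromℕ n = n × 1#

  private
    ≤-resp₂ : ∀ {x x′ y y′} → x ≈ x′ → y ≈ y′ → x ≤ y → x′ ≤ y′
    ≤-resp₂ p q r = O.≤-respˡ-≈ p (O.≤-respʳ-≈ q r)

    x+[y-x]≈y : ∀ x y → x + (y - x) ≈ y
    x+[y-x]≈y x y = R.trans (R.sym (R.+-assoc x y (- x))) (xyx⁻¹≈y x y)

    x≤y⇒0≤y-x : ∀ {x y} → x ≤ y → 0# ≤ y - x
    x≤y⇒0≤y-x {x} {y} x≤y =
      ≤-resp₂ (R.-‿inverseˡ x) (R.+-comm (- x) y) (+-monoʳ-≤ (- x) x≤y)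

    0≤y-x⇒x≤y : ∀ {x y} → 0# ≤ y - x → x ≤ y
    0≤y-x⇒x≤y {x} {y} h =
      ≤-resp₂ (R.+-identityʳ x) (x+[y-x]≈y x y) (+-monoʳ-≤ x h)

    y-x≤0⇒y≤x : ∀ {x y} → y - x ≤ 0# → y ≤ x
    y-x≤0⇒y≤x {x} {y} h =
      ≤-resp₂ (x+[y-x]≈y x y) (R.+-identityʳ x) (+-monoʳ-≤ x h)

    +-monoˡ-≤ : ∀ z {x y} → x ≤ y → x + z ≤ y + z
    +-monoˡ-≤ z {x} {y} x≤y = ≤-resp₂ (R.+-comm z x) (R.+-comm z y) (+-monoʳ-≤ z x≤y)

    *-monoˡ-≤ : ∀ {z} → 0# ≤ z → ∀ {x y} → x ≤ y → z * x ≤ z * y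
    *-monoˡ-≤ {z} 0≤z {x} {y} x≤y = 0≤y-x⇒x≤y
      (O.≤-respʳ-≈ (x[y-z]≈xy-xz z y x) (*-nonNeg 0≤z (x≤y⇒0≤y-x x≤y)))

    0≤1 : 0# ≤ 1#
    0≤1 with O.total 0# 1#
    ... | inj₁ 0≤1 = 0≤1
    ... | inj₂ 1≤0 = O.≤-respʳ-≈ square (*-nonNeg 0≤-1 0≤-1)
      where
      0≤-1 : 0# ≤ - 1#
      0≤-1 = O.≤-respʳ-≈ (R.+-identityˡ (- 1#)) (x≤y⇒0≤y-x 1≤0)
      square : (- 1#) * (- 1#) ≈ 1#
      square = R.trans (R.sym (-‿distribˡ-* 1# (- 1#)))
        (R.trans (R.-‿cong (R.*-identityˡ (- 1#))) (-‿involutive 1#))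

    x≤1+x : ∀ x → x ≤ 1# + x
    x≤1+x x = ≤-resp₂ (R.+-identityʳ x) (R.+-comm x 1#) (+-monoʳ-≤ x 0≤1)

    0≤fromℕ : ∀ n → 0# ≤ fromℕ n
    0≤fromℕ zero    = O.refl
    0≤fromℕ (suc n) = O.trans (0≤fromℕ n) (x≤1+x (fromℕ n))

    fromℕ-mono : ∀ {m n} → m ℕ.≤ n → fromℕ m ≤ fromℕ n
    fromℕ-mono {n = n} ℕ.z≤n = 0≤fromℕ n
    fromℕ-mono (ℕ.s≤s m≤n)   = +-monoʳ-≤ 1# (fromℕ-mono m≤n)

    fromℕ-1 : fromℕ 1 ≈ 1#
    fromℕ-1 = R.+-identityʳ 1#

  -- The supremum of this set is the nonnegative square root of n.
  SquareAtMost : ℕ → Carrier → Set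
  SquareAtMost n x = x * x ≤ fromℕ n

  private
    squareAtMost-bound : ∀ n → UpperBound (SquareAtMost n) (fromℕ (suc n))
    squareAtMost-bound n x x²≤n with O.total x 1#
    ... | inj₁ x≤1 = O.trans x≤1
      (O.≤-respˡ-≈ fromℕ-1 (fromℕ-mono (ℕ.s≤s (ℕ.z≤n {n}))))
    ... | inj₂ 1≤x = O.trans
      (O.≤-respˡ-≈ (R.*-identityʳ x) (*-monoˡ-≤ (O.trans 0≤1 1≤x) 1≤x))
      (O.trans x²≤n (x≤1+x (fromℕ n)))

    √-lub : ∀ n → ∃ (LeastUpperBound (SquareAtMost n))
    √-lub n = complete (SquareAtMost n)
      (0# , O.≤-respˡ-≈ (R.sym (R.zeroˡ 0#)) (0≤fromℕ n))
      (fromℕ (suc n) , squareAtMost-bound n)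

  √ : ℕ → Carrier
  √ n = proj₁ (√-lub n)

  √-isLub : ∀ n → LeastUpperBound (SquareAtMost n) (√ n)
  √-isLub n = proj₂ (√-lub n)

  -- x = p / q with 2 ^ (p / q) ≤ n, where q > 0.  For n ≥ 1 these are exactly
  -- the nonnegative rationals that are at most the binary logarithm of n.
  Log₂Below : ℕ → Carrier → Set
  Log₂Below n x = ∃₂ λ p q →
    (0 ℕ.< q) ∧ (2 ℕ.^ p ℕ.≤ n ℕ.^ q) ∧ (x * fromℕ q ≈ fromℕ p)

  private
    n<2^n : ∀ n → n ℕ.< 2 ℕ.^ n
    n<2^n zero    = ℕ.≤-refl
    n<2^n (suc n) = ℕ.+-mono-≤ (ℕ.m^n>0 2 n) (ℕ.m≤n⇒m≤n+o 0 (n<2^n n))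

    2^p≤n^q⇒p≤nq : ∀ n p q → 2 ℕ.^ p ℕ.≤ n ℕ.^ q → p ℕ.≤ n ℕ.* q
    2^p≤n^q⇒p≤nq n p q h = ℕ.≮⇒≥ λ nq<p → ℕ.<-irrefl refl
      (ℕ.<-≤-trans (ℕ.^-monoʳ-< 2 ℕ.≤-refl nq<p)
        (ℕ.≤-trans h
          (ℕ.≤-trans (ℕ.^-monoˡ-≤ q (ℕ.<⇒≤ (n<2^n n)))
            (ℕ.≤-reflexive (ℕ.^-*-assoc 2 n q)))))

    log₂Below-bound : ∀ n → UpperBound (Log₂Below n) (fromℕ n)
    log₂Below-bound n x (p , q , 0<q , 2^p≤n^q , xq≈p) with O.total x (fromℕ n)
    ... | inj₁ x≤n = x≤n
    ... | inj₂ n≤x = y-x≤0⇒y≤x (O.trans d≤dq dq≤0)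
      where
      d : Carrier
      d = x - fromℕ n

      d≤dq : d ≤ d * fromℕ q
      d≤dq = O.≤-respˡ-≈ (R.trans (R.*-congˡ fromℕ-1) (R.*-identityʳ d))
        (*-monoˡ-≤ (x≤y⇒0≤y-x n≤x) (fromℕ-mono 0<q))

      xq≤nq : x * fromℕ q ≤ fromℕ n * fromℕ q
      xq≤nq = ≤-resp₂ (R.sym xq≈p) (×1-homo-* n q)
        (fromℕ-mono (2^p≤n^q⇒p≤nq n p q 2^p≤n^q))

      dq≤0 : d * fromℕ q ≤ 0#
      dq≤0 = ≤-resp₂ (R.sym ([y-z]x≈yx-zx (fromℕ q) x (fromℕ n)))
        (R.-‿inverseʳ (fromℕ n * fromℕ q)) (+-monoˡ-≤ (- (fromℕ n * fromℕ q)) xq≤nq)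

    log₂-lub : (n : ℕ) .{{_ : NonZero n}} → ∃ (LeastUpperBound (Log₂Below n))
    log₂-lub n = complete (Log₂Below n)
      (0# , 0 , 1 , ℕ.≤-refl , ℕ.m^n>0 n 1 , R.zeroˡ (fromℕ 1))
      (fromℕ n , log₂Below-bound n)

  log₂ : (n : ℕ) .{{_ : NonZero n}} → Carrier
  log₂ n = proj₁ (log₂-lub n)

  log₂-isLub : (n : ℕ) .{{_ : NonZero n}} → LeastUpperBound (Log₂Below n) (log₂ n)
  log₂-isLub n = proj₂ (log₂-lub n)

data Action : Set where
  buy sell skip : Action

actions : List Action
actions = buy ∷ sell ∷ skip ∷ []

-- Allowed B x a: with capacity B and x copies in stock, a may be taken.
Allowed : ℕ → ℕ → Action → Set
Allowed B x buy  = x ℕ.< B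
Allowed B x sell = 0 ℕ.< x
Allowed B x skip = ⊤

allowed? : ∀ B x a → Dec (Allowed B x a)
allowed? B x buy  = x ℕ.<? B
allowed? B x sell = 0 ℕ.<? x
allowed? B x skip = yes tt

next : ℕ → Action → ℕ
next x buy  = suc x
next x sell = ℕ.pred x
next x skip = x

Feasible : ℕ → ℕ → ∀ {n} → Vec Action n → Set
Feasible B x []       = ⊤
Feasible B x (a ∷ as) = Allowed B x a ∧ Feasible B (next x a) as

feasible? : ∀ B x {n} (as : Vec Action n) → Dec (Feasible B x as)
feasible? B x []       = yes tt
feasible? B x (a ∷ as) = allowed? B x a ×-dec feasible? B (next x a) as

actionSequences : ∀ n → List (Vec Action n)
actionSequences zero    = [] ∷ []
actionSequences (suc n) = cartesianProductWith _∷_ actions (actionSequences n)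

module Trading (ℝ : CompleteOrderedField) where
  open CompleteOrderedField ℝ
  open RawMonoidDefinitions (CommutativeRing.+-rawMonoid commutativeRing) using (sum)
  open Extrema (DecTotalOrder.totalOrder decTotalOrder) using (max)

  -- Fin size enumerates the support without repetition, so an index carries
  -- the same information as the price tuple (b i , s i).
  record Distribution : Set where
    field
      size     : ℕ
      b s      : Fin size → Carrier
      prob     : Fin size → Carrier
      b-nonNeg : ∀ i → 0# ≤ b i
      s-nonNeg : ∀ i → 0# ≤ s i
      distinct : ∀ i j → b i ≈ b j → s i ≈ s j → i ≡ j
      prob-pos : ∀ i → 0# < prob i
      prob-sum : sum prob ≈ 1#

  SymmetricPrices : Distribution → Set
  SymmetricPrices D = ∀ i → b i ≈ s i
    where open Distribution D

  -- The T requests are independent draws from the single distribution D.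
  record Instance (B : ℕ) : Set where
    field
      T B₀   : ℕ
      D      : Distribution
      1≤B    : 1 ℕ.≤ B
      B₀≤B   : B₀ ℕ.≤ B
      B₀≤T   : B₀ ℕ.≤ T
      B≤B₀+T : B ℕ.≤ B₀ ℕ.+ T

  module _ {B : ℕ} (I : Instance B) where
    open Instance I
    open Distribution D

    𝔼 : ∀ n → (Vec (Fin size) n → Carrier) → Carrier
    𝔼 zero    f = f []
    𝔼 (suc n) f = sum λ i → prob i * 𝔼 n (λ ω → f (i ∷ ω))

    gain : Fin size → Action → Carrier
    gain i buy  = - b i
    gain i sell = s i
    gain i skip = 0#

    profit : ∀ {n} → Vec (Fin size) n → Vec Action n → Carrier
    profit []      []       = 0#
    profit (i ∷ ω) (a ∷ as) = gain i a + profit ω as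

    -- The base value 0# is the profit of always skipping, which is feasible.
    offlineProfit : Vec (Fin size) T → Carrier
    offlineProfit ω =
      max 0# (map (profit ω) (filter (feasible? B B₀) (actionSequences T)))

    OPT : Carrier
    OPT = 𝔼 T offlineProfit

    -- Past tuples and the actions taken on them, most recent first.
    History : Set
    History = List (Fin size ∧ Action)

    stock : History → ℕ
    stock []            = B₀
    stock ((_ , a) ∷ h) = next (stock h) a

    Σₐ : (Action → Carrier) → Carrier
    Σₐ f = f buy + f sell + f skip

    -- choose h i a is the probability of taking action a on the tuple i after
    -- the history h; the current time is determined by the length of h.
    record OnlineAlgorithm : Set where
      field
        choose          : History → Fin size → Action → Carrier
        choose-nonNeg   : ∀ h i a → 0# ≤ choose h i a
        choose-sum      : ∀ h i → Σₐ (choose h i) ≈ 1#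
        choose-feasible : ∀ h i a → ¬ Allowed B (stock h) a → choose h i a ≈ 0#

    -- Expectation over the algorithm's randomness of its profit on the
    -- remaining tuples ω after the history h.
    profitFrom : OnlineAlgorithm → ∀ {n} → History → Vec (Fin size) n → Carrier
    profitFrom A h []      = 0#
    profitFrom A h (i ∷ ω) =
      Σₐ λ a → choose h i a * (gain i a + profitFrom A ((i , a) ∷ h) ω)
      where open OnlineAlgorithm A

    expectedProfit : OnlineAlgorithm → Carrier
    expectedProfit A = 𝔼 T (profitFrom A [])

{-# OPTIONS --safe #-}
module Submission where

open import Data.Nat.Base as ℕ using (ℕ; zero; suc; _∸_; NonZero)
import Data.Nat.Properties as ℕ
open import Data.Integer.Base as ℤ using (ℤ; +_; -[1+_]; +0; +[1+_])
import Data.Integer.Properties as ℤ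
open import Data.Fin.Base using (Fin; zero; suc; toℕ)
open import Data.Vec.Base using (Vec; []; _∷_; lookup; replicate)
open import Data.Bool.Base as Bool using (true; false)
open import Data.List.Base using (List; []; _∷_; null; length; map; filter)
open import Data.Unit.Base using (tt; ⊤)
open import Data.Product.Base using (_×_; _,_; proj₁; proj₂; Σ-syntax)
open import Data.Sum.Base using (_⊎_; inj₁; inj₂; swap)
open import Data.Empty using (⊥-elim; ⊥)
open import Algebra.Bundles using (CommutativeRing)
import Algebra.Properties.Semiring.Exp as Exp
import Algebra.Properties.CommutativeSemigroup as CommSemigroupProperties
open import Relation.Binary.PropositionalEquality.Core as ≡ using (_≡_)
open import Relation.Binary.Bundles using (DecTotalOrder)
open import Relation.Nullary.Decidable.Core using (Dec; yes; no; ¬?)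
open import Relation.Nullary.Negation.Core using (¬_)
import Algebra.Properties.Ring as RingProperties
import Algebra.Properties.Semiring.Mult as Mult
open import Data.List.Membership.Propositional using (_∈_)
open import Data.List.Membership.Propositional.Properties using (∈-map⁺; ∈-filter⁺; ∈-filter⁻; ∈-map⁻; ∈-cartesianProductWith⁺)
open import Data.List.Relation.Unary.Any as Any using (here; there)
import Data.List.Relation.Unary.All as All
import Data.List.Extrema as Extrema
open import Function.Base using (_∘_; flip)
import Algebra.Properties.Semiring.Sum as SemiringSum
open import Data.Nat.Tactic.RingSolver using (solve-∀)
open import Data.Fin.Patterns using (0F; 1F; 2F)
import Data.Nat.DivMod as ℕ
import Relation.Binary.PropositionalEquality.Properties as ≡
open import Defs

-- (a) Let ρ = B₀ / T and let λ be the (1 - ρ) / 2-quantile of the price.  For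
-- any feasible actions the profit is at most Σ |pₜ - λ| + λ B₀, whose mean U
-- thus bounds OPT.  Selling above and buying below λ (mixing at λ) makes the
-- stock a random walk that drifts from B₀ to 0; it attains |pₜ - λ| except when
-- blocked at stock 0 or B, and once the stock reaches the number of requests
-- left everything is sold.  A quadratic potential with length scale √ B shows
-- that the mean loss is at most 18 U / √ B, and log₂ B ≥ 1.
--
-- (b) Prices are 0, 1, 2, and price 1 has mass of order 1 / √ T, with
-- T of order B and the masses of 0 and 2 such that the stock needed for all
-- requests at price 2 is B₀ on average.  Knowing whether stock will be scarce or
-- abundant (level 2 or 0), the optimum buys, respectively sells, at all requests
-- of price 1.  Duality with the level as a multiplier shows that every other
-- action there loses against the optimum; but the level depends on the later
-- requests, and given the past both extremes keep probability bounded below, by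
-- a fourth moment argument.  So an online algorithm loses a constant at each of
-- the order of √ T requests of price 1, while OPT ≤ 2 T.

-- The reals are axiomatic, so no limit theorem or concentration bound is at hand. Every
-- probabilistic estimate is therefore a backward induction over the remaining requests, whose step
-- is a polynomial inequality with an exact certificate. This dictates the test functions: squares
-- for the threshold walk, a quartic for the extreme counts, powers of 2 for the hoarding walk.
--
-- In (a) the scale r = `√ B` balances two costs in units of K = M / r: the diffusion of the squares
-- costs a constant per request, while the penalties start at order r². Each blocked trade costs at
-- most M = K r, so the potential must fall by r there.
--
-- In (b) the obstacle is feasibility: the dual value known in hindsight is reached by a plan that
-- may sell from an empty stock. B = B₀ + T is chosen so that only an empty stock can obstruct a
-- plan. Price 2 has mass at least 7/10, so even a walk that buys at all other prices stays bounded
-- in mean by 10. The duality gap is thus at most 20 for every T, negligible against a regret of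
-- order `√ T`.

-- Normal forms of polynomials with integer coefficients.

module Polynomial where
  infixl 6 _:+_ _:-_
  infixl 7 _:*_
  infix  8 :-_

  data Expr (n : ℕ) : Set where
    con       : ℕ → Expr n
    var       : Fin n → Expr n
    :-_       : Expr n → Expr n
    _:+_ _:*_ : Expr n → Expr n → Expr n

  _:-_ : ∀ {n} → Expr n → Expr n → Expr n
  p :- q = p :+ (:- q)

  pattern v0 = var zero
  pattern v1 = var (suc zero)
  pattern v2 = var (suc (suc zero))
  pattern v3 = var (suc (suc (suc zero)))
  pattern v4 = var (suc (suc (suc (suc zero))))
  pattern v5 = var (suc (suc (suc (suc (suc zero)))))
  pattern v6 = var (suc (suc (suc (suc (suc (suc zero))))))
  pattern v7 = var (suc (suc (suc (suc (suc (suc (suc zero)))))))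
  pattern v8 = var (suc (suc (suc (suc (suc (suc (suc (suc zero))))))))
  pattern v9 = var (suc (suc (suc (suc (suc (suc (suc (suc (suc zero)))))))))
  pattern v10 = var (suc (suc (suc (suc (suc (suc (suc (suc (suc (suc zero))))))))))
  pattern v11 = var (suc (suc (suc (suc (suc (suc (suc (suc (suc (suc (suc zero)))))))))))
  pattern v12 = var (suc (suc (suc (suc (suc (suc (suc (suc (suc (suc (suc (suc zero))))))))))))
  pattern v13 = var (suc (suc (suc (suc (suc (suc (suc (suc (suc (suc (suc (suc (suc zero)))))))))))))

  Monomial : ℕ → Set
  Monomial = Vec ℕ

  Terms : ℕ → Set
  Terms n = List (Monomial n × ℤ)

  data Cmp : Set where
    lt eq′ gt : Cmp

  cmp : ∀ {n} → Monomial n → Monomial n → Cmp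
  cmp []      []      = eq′
  cmp (k ∷ m) (l ∷ m′) with k ℕ.≡ᵇ l
  ... | true = cmp m m′
  ... | false with k ℕ.<ᵇ l
  ...   | true  = lt
  ...   | false = gt

  cmp-sound : ∀ {n} (m m′ : Monomial n) → cmp m m′ ≡ eq′ → m ≡ m′
  cmp-sound []      []       _ = ≡.refl
  cmp-sound (k ∷ m) (l ∷ m′) h with k ℕ.≡ᵇ l in e
  ... | true = ≡.cong₂ _∷_ (ℕ.≡ᵇ⇒≡ k l (≡.subst Bool.T (≡.sym e) tt)) (cmp-sound m m′ h)
  cmp-sound (k ∷ m) (l ∷ m′) h | false with k ℕ.<ᵇ l
  cmp-sound (k ∷ m) (l ∷ m′) () | false | true
  cmp-sound (k ∷ m) (l ∷ m′) () | false | false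

  -- Zero coefficients must vanish from the list, because `null` is the test for the zero
  -- polynomial.
  cons : ∀ {n} → Monomial n → ℤ → Terms n → Terms n
  cons m +0 p = p
  cons m c  p = (m , c) ∷ p

  infixl 6 _+ᵗ_
  infixl 7 _*ᵗ_ _*ᵐ_

  choose : ∀ {A : Set} → Cmp → A → A → A → A
  choose lt  x y z = x
  choose eq′ x y z = y
  choose gt  x y z = z

  mutual
    _+ᵗ_ : ∀ {n} → Terms n → Terms n → Terms n
    []            +ᵗ q = q
    ((m , a) ∷ p) +ᵗ q = merge m a p q

    merge : ∀ {n} → Monomial n → ℤ → Terms n → Terms n → Terms n
    merge m a p []             = (m , a) ∷ p
    merge m a p ((m′ , b) ∷ q) = choose (cmp m m′)
      ((m , a) ∷ (p +ᵗ ((m′ , b) ∷ q)))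
      (cons m (a ℤ.+ b) (p +ᵗ q))
      ((m′ , b) ∷ merge m a p q)

  _*ᵐ_ : ∀ {n} → Monomial n → Monomial n → Monomial n
  []      *ᵐ []       = []
  (k ∷ m) *ᵐ (l ∷ m′) = k ℕ.+ l ∷ m *ᵐ m′

  scale : ∀ {n} → Monomial n → ℤ → Terms n → Terms n
  scale m c []             = []
  scale m c ((m′ , b) ∷ p) = (m *ᵐ m′ , c ℤ.* b) ∷ scale m c p

  _*ᵗ_ : ∀ {n} → Terms n → Terms n → Terms n
  []            *ᵗ q = []
  ((m , c) ∷ p) *ᵗ q = scale m c q +ᵗ p *ᵗ q

  varᵐ : ∀ {n} → Fin n → Monomial n
  varᵐ zero    = 1 ∷ replicate _ 0
  varᵐ (suc i) = 0 ∷ varᵐ i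

  normalise : ∀ {n} → Expr n → Terms n
  normalise (con k)  = cons (replicate _ 0) (+ k) []
  normalise (var i)  = cons (varᵐ i) (+ 1) []
  normalise (p :+ q) = normalise p +ᵗ normalise q
  normalise (:- p)   = scale (replicate _ 0) -[1+ 0 ] (normalise p)
  normalise (p :* q) = normalise p *ᵗ normalise q

-- Real arithmetic: identities, certified inequalities, square roots.

module Real (ℝ : CompleteOrderedField) where
  open Polynomial
  open Polynomial public using
    ( Expr; con; var; _:+_; _:-_; _:*_; :-_
    ; v0; v1; v2; v3; v4; v5; v6; v7; v8; v9; v10; v11; v12; v13)
  open CompleteOrderedField ℝ public
  open RealFunctions ℝ public
  module R = CommutativeRing commutativeRing
  module O = DecTotalOrder decTotalOrder
  open Mult R.semiring using (×-homo-+; ×1-homo-*)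
  open RingProperties R.ring using (-‿distribˡ-*; -‿distribʳ-*; -‿involutive; -0#≈0#; -‿+-comm; -1*x≈-x)
  open Exp R.semiring using (_^_; ^-homo-*)
  open import Relation.Binary.Reasoning.Setoid R.setoid

  -- Numerals without a trailing `0#`: `con 1` evaluates to `1#` itself, as it stands in the goals,
  -- whereas `fromℕ 1` is `1# + 0#`.
  num : ℕ → Carrier
  num 0             = 0#
  num 1             = 1#
  num (suc (suc n)) = 1# + num (suc n)

  num≈fromℕ : ∀ n → num n ≈ fromℕ n
  num≈fromℕ 0             = R.refl
  num≈fromℕ 1             = R.sym (R.+-identityʳ 1#)
  num≈fromℕ (suc (suc n)) = R.+-congˡ (num≈fromℕ (suc n))

  fromℕ-+ : ∀ m n → fromℕ (m ℕ.+ n) ≈ fromℕ m + fromℕ n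
  fromℕ-+ = ×-homo-+ 1#

  fromℕ-* : ∀ m n → fromℕ (m ℕ.* n) ≈ fromℕ m * fromℕ n
  fromℕ-* = ×1-homo-*

  private
    fromℤ : ℤ → Carrier
    fromℤ (+ n)    = num n
    fromℤ -[1+ n ] = - num (suc n)

    -- The homomorphism laws are proved for `fromℕ`, where the uniform recursion suits induction,
    -- and then carried over to `num`.
    fromℤ′ : ℤ → Carrier
    fromℤ′ (+ n)    = fromℕ n
    fromℤ′ -[1+ n ] = - fromℕ (suc n)

    fromℤ≈ : ∀ z → fromℤ z ≈ fromℤ′ z
    fromℤ≈ (+ n)    = num≈fromℕ n
    fromℤ≈ -[1+ n ] = R.-‿cong (num≈fromℕ (suc n))

    cancel : ∀ a b → (1# + a) - (1# + b) ≈ a - b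
    cancel a b = begin
      (1# + a) - (1# + b)       ≈⟨ R.+-congˡ (-‿+-comm 1# b) ⟨
      (1# + a) + (- 1# - b)     ≈⟨ R.+-congʳ (R.+-comm 1# a) ⟩
      (a + 1#) + (- 1# - b)     ≈⟨ R.+-assoc a 1# _ ⟩
      a + (1# + (- 1# - b))     ≈⟨ R.+-congˡ (R.+-assoc 1# (- 1#) (- b)) ⟨
      a + ((1# - 1#) - b)       ≈⟨ R.+-congˡ (R.+-congʳ (R.-‿inverseʳ 1#)) ⟩
      a + (0# - b)              ≈⟨ R.+-congˡ (R.+-identityˡ (- b)) ⟩
      a - b                     ∎

    ⊖-homo : ∀ m n → fromℤ′ (m ℤ.⊖ n) ≈ fromℕ m - fromℕ n
    ⊖-homo m zero = R.sym (R.trans (R.+-congˡ -0#≈0#) (R.+-identityʳ _))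
    ⊖-homo zero (suc n) = R.sym (R.+-identityˡ _)
    ⊖-homo (suc m) (suc n) = R.trans
      (R.reflexive (≡.cong fromℤ′ (ℤ.[1+m]⊖[1+n]≡m⊖n m n)))
      (R.trans (⊖-homo m n) (R.sym (cancel (fromℕ m) (fromℕ n))))

    +-homo′ : ∀ x y → fromℤ′ (x ℤ.+ y) ≈ fromℤ′ x + fromℤ′ y
    +-homo′ (+ m)    (+ n)    = fromℕ-+ m n
    +-homo′ (+ m)    -[1+ n ] = ⊖-homo m (suc n)
    +-homo′ -[1+ m ] (+ n)    = R.trans (⊖-homo n (suc m)) (R.+-comm _ _)
    +-homo′ -[1+ m ] -[1+ n ] = R.trans
      (R.-‿cong (R.trans (R.reflexive (≡.cong (λ k → fromℕ (suc k)) (≡.sym (ℕ.+-suc m n))))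
        (fromℕ-+ (suc m) (suc n))))
      (R.sym (-‿+-comm _ _))

    -‿homo′ : ∀ x → fromℤ′ (ℤ.- x) ≈ - fromℤ′ x
    -‿homo′ +0       = R.sym -0#≈0#
    -‿homo′ +[1+ n ] = R.refl
    -‿homo′ -[1+ n ] = R.sym (-‿involutive _)

    *-homo⁺ : ∀ m y → fromℤ′ (+ m ℤ.* y) ≈ fromℕ m * fromℤ′ y
    *-homo⁺ m (+ n) = R.trans (R.reflexive (≡.cong fromℤ′ (≡.sym (ℤ.pos-* m n)))) (fromℕ-* m n)
    *-homo⁺ m -[1+ n ] = begin
      fromℤ′ (+ m ℤ.* -[1+ n ])     ≈⟨ R.reflexive (≡.cong fromℤ′ (≡.sym (ℤ.neg-distribʳ-* (+ m) (+ suc n)))) ⟩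
      fromℤ′ (ℤ.- (+ m ℤ.* + suc n)) ≈⟨ -‿homo′ (+ m ℤ.* + suc n) ⟩
      - fromℤ′ (+ m ℤ.* + suc n)     ≈⟨ R.-‿cong (*-homo⁺ m (+ suc n)) ⟩
      - (fromℕ m * fromℕ (suc n))    ≈⟨ -‿distribʳ-* _ _ ⟩
      fromℕ m * - fromℕ (suc n)      ∎

    *-homo′ : ∀ x y → fromℤ′ (x ℤ.* y) ≈ fromℤ′ x * fromℤ′ y
    *-homo′ (+ m)    y = *-homo⁺ m y
    *-homo′ -[1+ m ] y = begin
      fromℤ′ (-[1+ m ] ℤ.* y)       ≈⟨ R.reflexive (≡.cong fromℤ′ (≡.sym (ℤ.neg-distribˡ-* (+ suc m) y))) ⟩
      fromℤ′ (ℤ.- (+ suc m ℤ.* y)) ≈⟨ -‿homo′ (+ suc m ℤ.* y) ⟩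
      - fromℤ′ (+ suc m ℤ.* y)      ≈⟨ R.-‿cong (*-homo⁺ (suc m) y) ⟩
      - (fromℕ (suc m) * fromℤ′ y)  ≈⟨ -‿distribˡ-* _ _ ⟩
      - fromℕ (suc m) * fromℤ′ y    ∎

    fromℤ-+ : ∀ x y → fromℤ (x ℤ.+ y) ≈ fromℤ x + fromℤ y
    fromℤ-+ x y = R.trans (fromℤ≈ (x ℤ.+ y))
      (R.trans (+-homo′ x y) (R.sym (R.+-cong (fromℤ≈ x) (fromℤ≈ y))))

    fromℤ-* : ∀ x y → fromℤ (x ℤ.* y) ≈ fromℤ x * fromℤ y
    fromℤ-* x y = R.trans (fromℤ≈ (x ℤ.* y))
      (R.trans (*-homo′ x y) (R.sym (R.*-cong (fromℤ≈ x) (fromℤ≈ y))))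

  ⟦_⟧ : ∀ {n} → Expr n → Vec Carrier n → Carrier
  ⟦ con k ⟧  ρ = num k
  ⟦ var i ⟧  ρ = lookup ρ i
  ⟦ p :+ q ⟧ ρ = ⟦ p ⟧ ρ + ⟦ q ⟧ ρ
  ⟦ :- p ⟧   ρ = - ⟦ p ⟧ ρ
  ⟦ p :* q ⟧ ρ = ⟦ p ⟧ ρ * ⟦ q ⟧ ρ

  private
    evalM : ∀ {n} → Monomial n → Vec Carrier n → Carrier
    evalM []      []      = 1#
    evalM (k ∷ m) (x ∷ ρ) = x ^ k * evalM m ρ

    eval : ∀ {n} → Terms n → Vec Carrier n → Carrier
    eval []            ρ = 0#
    eval ((m , c) ∷ p) ρ = fromℤ c * evalM m ρ + eval p ρ

    swap-middle : ∀ a b c d → (a * b) * (c * d) ≈ (a * c) * (b * d)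
    swap-middle = CommSemigroupProperties.interchange R.*-commutativeSemigroup

    evalM-*ᵐ : ∀ {n} (m m′ : Monomial n) ρ → evalM (m *ᵐ m′) ρ ≈ evalM m ρ * evalM m′ ρ
    evalM-*ᵐ []      []       []      = R.sym (R.*-identityˡ 1#)
    evalM-*ᵐ (k ∷ m) (l ∷ m′) (x ∷ ρ) = R.trans
      (R.*-cong (^-homo-* x k l) (evalM-*ᵐ m m′ ρ)) (swap-middle _ _ _ _)

    eval-cons : ∀ {n} (m : Monomial n) c p ρ → eval (cons m c p) ρ ≈ fromℤ c * evalM m ρ + eval p ρ
    eval-cons m +0       p ρ = R.sym (R.trans (R.+-congʳ (R.zeroˡ _)) (R.+-identityˡ _))
    eval-cons m +[1+ n ] p ρ = R.refl
    eval-cons m -[1+ n ] p ρ = R.refl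

    eval-merge : ∀ {n} (m : Monomial n) a p q ρ →
                 eval (merge m a p q) ρ ≈ (fromℤ a * evalM m ρ + eval p ρ) + eval q ρ

    eval-+ᵗ : ∀ {n} (p q : Terms n) ρ → eval (p +ᵗ q) ρ ≈ eval p ρ + eval q ρ
    eval-+ᵗ []            q ρ = R.sym (R.+-identityˡ _)
    eval-+ᵗ ((m , a) ∷ p) q ρ = eval-merge m a p q ρ

    eval-merge m a p [] ρ = R.sym (R.+-identityʳ _)
    eval-merge m a p ((m′ , b) ∷ q) ρ with cmp m m′ in eq
    ... | lt = R.trans (R.+-congˡ (eval-+ᵗ p ((m′ , b) ∷ q) ρ)) (R.sym (R.+-assoc _ _ _))
    ... | gt = begin
      y + eval (merge m a p q) ρ       ≈⟨ R.+-congˡ (eval-merge m a p q ρ) ⟩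
      y + (u + eval q ρ)               ≈⟨ R.+-assoc _ _ _ ⟨
      (y + u) + eval q ρ               ≈⟨ R.+-congʳ (R.+-comm y u) ⟩
      (u + y) + eval q ρ               ≈⟨ R.+-assoc _ _ _ ⟩
      u + (y + eval q ρ)               ∎
      where
      y = fromℤ b * evalM m′ ρ
      u = fromℤ a * evalM m ρ + eval p ρ
    ... | eq′ with ≡.refl ← cmp-sound m m′ eq = begin
      eval (cons m (a ℤ.+ b) (p +ᵗ q)) ρ              ≈⟨ eval-cons m (a ℤ.+ b) (p +ᵗ q) ρ ⟩
      fromℤ (a ℤ.+ b) * e + eval (p +ᵗ q) ρ           ≈⟨ R.+-cong (R.*-congʳ (fromℤ-+ a b)) (eval-+ᵗ p q ρ) ⟩
      (fromℤ a + fromℤ b) * e + (eval p ρ + eval q ρ) ≈⟨ R.+-congʳ (R.distribʳ e _ _) ⟩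
      (fromℤ a * e + fromℤ b * e) + (eval p ρ + eval q ρ)
        ≈⟨ CommSemigroupProperties.interchange R.+-commutativeSemigroup _ _ _ _ ⟩
      (fromℤ a * e + eval p ρ) + (fromℤ b * e + eval q ρ) ∎
      where
      e = evalM m ρ

    eval-scale : ∀ {n} (m : Monomial n) c p ρ → eval (scale m c p) ρ ≈ (fromℤ c * evalM m ρ) * eval p ρ
    eval-scale m c []             ρ = R.sym (R.zeroʳ _)
    eval-scale m c ((m′ , b) ∷ p) ρ = R.trans
      (R.+-cong
        (R.trans (R.*-cong (fromℤ-* c b) (evalM-*ᵐ m m′ ρ)) (swap-middle _ _ _ _))
        (eval-scale m c p ρ))
      (R.sym (R.distribˡ _ _ _))

    eval-*ᵗ : ∀ {n} (p q : Terms n) ρ → eval (p *ᵗ q) ρ ≈ eval p ρ * eval q ρ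
    eval-*ᵗ []            q ρ = R.sym (R.zeroˡ _)
    eval-*ᵗ ((m , c) ∷ p) q ρ = R.trans (eval-+ᵗ (scale m c q) (p *ᵗ q) ρ)
      (R.trans (R.+-cong (eval-scale m c q ρ) (eval-*ᵗ p q ρ)) (R.sym (R.distribʳ _ _ _)))

    evalM-1 : ∀ {n} (ρ : Vec Carrier n) → evalM (replicate _ 0) ρ ≈ 1#
    evalM-1 []      = R.refl
    evalM-1 (x ∷ ρ) = R.trans (R.*-identityˡ _) (evalM-1 ρ)

    evalM-var : ∀ {n} (i : Fin n) ρ → evalM (varᵐ i) ρ ≈ lookup ρ i
    evalM-var zero    (x ∷ ρ) = R.trans (R.*-cong (R.*-identityʳ x) (evalM-1 ρ)) (R.*-identityʳ x)
    evalM-var (suc i) (x ∷ ρ) = R.trans (R.*-identityˡ _) (evalM-var i ρ)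

    eval-single : ∀ {n} (m : Monomial n) c ρ → eval (cons m c []) ρ ≈ fromℤ c * evalM m ρ
    eval-single m c ρ = R.trans (eval-cons m c [] ρ) (R.+-identityʳ _)

    correct : ∀ {n} (p : Expr n) ρ → eval (normalise p) ρ ≈ ⟦ p ⟧ ρ
    correct (con k)  ρ = R.trans (eval-single _ (+ k) ρ)
      (R.trans (R.*-congˡ (evalM-1 ρ)) (R.*-identityʳ _))
    correct (var i)  ρ = R.trans (eval-single (varᵐ i) (+ 1) ρ)
      (R.trans (R.*-identityˡ _) (evalM-var i ρ))
    correct (p :+ q) ρ = R.trans (eval-+ᵗ (normalise p) (normalise q) ρ)
      (R.+-cong (correct p ρ) (correct q ρ))
    correct (p :* q) ρ = R.trans (eval-*ᵗ (normalise p) (normalise q) ρ)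
      (R.*-cong (correct p ρ) (correct q ρ))
    correct (:- p)   ρ = begin
      eval (scale (replicate _ 0) -[1+ 0 ] (normalise p)) ρ
        ≈⟨ eval-scale (replicate _ 0) -[1+ 0 ] (normalise p) ρ ⟩
      (- 1# * evalM (replicate _ 0) ρ) * eval (normalise p) ρ
        ≈⟨ R.*-cong (R.trans (R.*-congˡ (evalM-1 ρ)) (R.*-identityʳ _)) (correct p ρ) ⟩
      - 1# * ⟦ p ⟧ ρ
        ≈⟨ -1*x≈-x _ ⟩
      - ⟦ p ⟧ ρ ∎

    x-y≈0⇒x≈y : ∀ {x y} → x - y ≈ 0# → x ≈ y
    x-y≈0⇒x≈y {x} {y} eq = begin
      x            ≈⟨ R.+-identityʳ x ⟨
      x + 0#       ≈⟨ R.+-congˡ (R.-‿inverseˡ y) ⟨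
      x + (- y + y) ≈⟨ R.+-assoc x (- y) y ⟨
      (x - y) + y  ≈⟨ R.+-congʳ eq ⟩
      0# + y       ≈⟨ R.+-identityˡ y ⟩
      y            ∎

  -- The side condition is about closed syntax and computes, so `refl` proves it at every call.
  ring : ∀ {n} (ρ : Vec Carrier n) (p q : Expr n) → null (normalise (p :- q)) ≡ true → ⟦ p ⟧ ρ ≈ ⟦ q ⟧ ρ
  ring ρ p q ok = x-y≈0⇒x≈y (R.trans (R.sym (correct (p :- q) ρ)) (vanishes (normalise (p :- q)) ok))
    where
    vanishes : ∀ t → null t ≡ true → eval t ρ ≈ 0#
    vanishes [] _ = R.refl

  ≤-by-diff : ∀ {x y d} → x + d ≈ y → 0# ≤ d → x ≤ y
  ≤-by-diff {x} eq 0≤d = O.≤-respʳ-≈ eq (O.≤-respˡ-≈ (R.+-identityʳ x) (+-monoʳ-≤ x 0≤d))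

  x≤y⇒0≤y-x : ∀ {x y} → x ≤ y → 0# ≤ y - x
  x≤y⇒0≤y-x {x} {y} x≤y = O.≤-respˡ-≈ (R.-‿inverseˡ x)
    (O.≤-respʳ-≈ (R.+-comm (- x) y) (+-monoʳ-≤ (- x) x≤y))

  0≤x+y : ∀ {x y} → 0# ≤ x → 0# ≤ y → 0# ≤ x + y
  0≤x+y {x} 0≤x 0≤y = O.trans 0≤x (≤-by-diff R.refl 0≤y)

  0≤x² : ∀ x → 0# ≤ x * x
  0≤x² x with O.total 0# x
  ... | inj₁ 0≤x = *-nonNeg 0≤x 0≤x
  ... | inj₂ x≤0 = O.≤-respʳ-≈ eq (*-nonNeg (x≤y⇒0≤y-x x≤0) (x≤y⇒0≤y-x x≤0))
    where
    ρ : Vec Carrier 1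
    ρ = x ∷ []
    eq : (0# - x) * (0# - x) ≈ x * x
    eq = ring ρ ((con 0 :- var zero) :* (con 0 :- var zero)) (var zero :* var zero) ≡.refl

  0≤1 : 0# ≤ 1#
  0≤1 = O.≤-respʳ-≈ (R.*-identityˡ 1#) (0≤x² 1#)

  0≤num : ∀ n → 0# ≤ num n
  0≤num 0             = O.refl
  0≤num 1             = 0≤1
  0≤num (suc (suc n)) = 0≤x+y 0≤1 (0≤num (suc n))

  -- Certificates: an inequality p ≤ q is proved by exhibiting q - p as a
  -- polynomial combination of nonnegative quantities.
  record NonNeg {n} (ρ : Vec Carrier n) : Set where
    constructor ⟨_,_⟩
    field
      poly  : Expr n
      proof : 0# ≤ ⟦ poly ⟧ ρ

  module _ {n} {ρ : Vec Carrier n} where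
    infixl 6 _⊕_
    infixl 7 _⊗_

    _⊕_ _⊗_ : NonNeg ρ → NonNeg ρ → NonNeg ρ
    ⟨ p , 0≤p ⟩ ⊕ ⟨ q , 0≤q ⟩ = ⟨ p :+ q , 0≤x+y 0≤p 0≤q ⟩
    ⟨ p , 0≤p ⟩ ⊗ ⟨ q , 0≤q ⟩ = ⟨ p :* q , *-nonNeg 0≤p 0≤q ⟩

    sq : Expr n → NonNeg ρ
    sq p = ⟨ p :* p , 0≤x² (⟦ p ⟧ ρ) ⟩

    lit : ℕ → NonNeg ρ
    lit k = ⟨ con k , 0≤num k ⟩

    hyp : (p q : Expr n) → ⟦ p ⟧ ρ ≤ ⟦ q ⟧ ρ → NonNeg ρ
    hyp p q p≤q = ⟨ q :- p , x≤y⇒0≤y-x p≤q ⟩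

    hyp₀ : (p : Expr n) → 0# ≤ ⟦ p ⟧ ρ → NonNeg ρ
    hyp₀ p 0≤p = ⟨ p , 0≤p ⟩

  order : ∀ {n} (ρ : Vec Carrier n) (p q : Expr n) (c : NonNeg ρ) →
          null (normalise ((p :+ NonNeg.poly c) :- q)) ≡ true → ⟦ p ⟧ ρ ≤ ⟦ q ⟧ ρ
  order ρ p q c ok = ≤-by-diff (ring ρ (p :+ NonNeg.poly c) q ok) (NonNeg.proof c)


  0<1 : 0# < 1#
  0<1 = 0≤1 , λ eq → 1≉0 (R.sym eq)

  0<x≤y⇒0<y : ∀ {x y} → 0# < x → x ≤ y → 0# < y
  0<x≤y⇒0<y (0≤x , 0≉x) x≤y = O.trans 0≤x x≤y , λ 0≈y → 0≉x (O.antisym 0≤x (O.≤-respʳ-≈ (R.sym 0≈y) x≤y))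

  1≰0 : ¬ (1# ≤ 0#)
  1≰0 1≤0 = 1≉0 (O.antisym 1≤0 0≤1)

  inverseʳ : ∀ {x} → 0# < x → x * x ⁻¹ ≈ 1#
  inverseʳ 0<x = ⁻¹-inverseʳ _ λ eq → proj₂ 0<x (R.sym eq)

  0≤x⁻¹ : ∀ {x} → 0# < x → 0# ≤ x ⁻¹
  0≤x⁻¹ {x} 0<x with O.total 0# (x ⁻¹)
  ... | inj₁ 0≤i = 0≤i
  ... | inj₂ i≤0 = ⊥-elim (1≰0 (O.≤-respˡ-≈ (inverseʳ 0<x)
    (order (x ∷ x ⁻¹ ∷ []) (v0 :* v1) (con 0) (hyp₀ v0 (proj₁ 0<x) ⊗ hyp v1 (con 0) i≤0) ≡.refl)))

  *-cancelˡ-≤ : ∀ {z x y} → 0# < z → z * x ≤ z * y → x ≤ y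
  *-cancelˡ-≤ {z} {x} {y} 0<z h = O.≤-respˡ-≈ (undo x) (O.≤-respʳ-≈ (undo y)
    (order (z ⁻¹ ∷ z * x ∷ z * y ∷ []) (v0 :* v1) (v0 :* v2) (hyp₀ v0 (0≤x⁻¹ 0<z) ⊗ hyp v1 v2 h) ≡.refl))
    where
    undo : ∀ u → z ⁻¹ * (z * u) ≈ u
    undo u = R.trans (ring (z ∷ z ⁻¹ ∷ u ∷ []) (v1 :* (v0 :* v2)) (v0 :* v1 :* v2) ≡.refl)
      (R.trans (R.*-congʳ (inverseʳ 0<z)) (R.*-identityˡ u))

  *-pos : ∀ {x y} → 0# < x → 0# < y → 0# < x * y
  *-pos {x} {y} 0<x 0<y = *-nonNeg (proj₁ 0<x) (proj₁ 0<y) , λ eq →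
    proj₂ 0<y (O.antisym (proj₁ 0<y)
      (*-cancelˡ-≤ 0<x (O.≤-respʳ-≈ (R.sym (R.zeroʳ x)) (O.reflexive (R.sym eq)))))

  0<x⁻¹ : ∀ {x} → 0# < x → 0# < x ⁻¹
  0<x⁻¹ {x} 0<x = 0≤x⁻¹ 0<x , λ eq →
    1≉0 (R.trans (R.sym (inverseʳ 0<x)) (R.trans (R.*-congˡ (R.sym eq)) (R.zeroʳ x)))

  0<num : ∀ n → 0# < num (suc n)
  0<num zero    = 0<1
  0<num (suc n) = 0<x≤y⇒0<y 0<1 (order (num (suc n) ∷ []) (con 1) (con 1 :+ v0) (hyp₀ v0 (0≤num (suc n))) ≡.refl)

  0≤fromℕ : ∀ n → 0# ≤ fromℕ n
  0≤fromℕ n = O.≤-respʳ-≈ (num≈fromℕ n) (0≤num n)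

  0<fromℕ : ∀ {n} → 0 ℕ.< n → 0# < fromℕ n
  0<fromℕ {suc n} _ = 0<x≤y⇒0<y (0<num n) (O.reflexive (num≈fromℕ (suc n)))

  fromℕ-mono : ∀ {m n} → m ℕ.≤ n → fromℕ m ≤ fromℕ n
  fromℕ-mono {n = n} ℕ.z≤n = 0≤fromℕ n
  fromℕ-mono (ℕ.s≤s m≤n)   = +-monoʳ-≤ 1# (fromℕ-mono m≤n)

  -- Were x nonzero, multiplication by the square of its inverse would give 1 ≤ 0.
  x²≤0⇒x≈0 : ∀ {x} → x * x ≤ 0# → x ≈ 0#
  x²≤0⇒x≈0 {x} h with x O.≟ 0#
  ... | yes x≈0 = x≈0
  ... | no  x≉0 = ⊥-elim (1≰0 (O.≤-respˡ-≈ unit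
    (order (x * x ∷ i ∷ []) (v0 :* (v1 :* v1)) (con 0) (sq v1 ⊗ hyp v0 (con 0) h) ≡.refl)))
    where
    i : Carrier
    i = x ⁻¹
    unit : (x * x) * (i * i) ≈ 1#
    unit = R.trans (swap-middle x x i i)
      (R.trans (R.*-cong (⁻¹-inverseʳ x x≉0) (⁻¹-inverseʳ x x≉0)) (R.*-identityˡ 1#))

  -- If y ≤ x, then (x - y)² = (x² - y²) - 2 y (x - y) ≤ 0, which forces equality.
  square-cancel-≤ : ∀ {x y} → 0# ≤ y → x * x ≤ y * y → x ≤ y
  square-cancel-≤ {x} {y} 0≤y h with O.total x y
  ... | inj₁ x≤y = x≤y
  ... | inj₂ y≤x = O.reflexive (R.trans (ring (x ∷ y ∷ []) v0 (v0 :- v1 :+ v1) ≡.refl)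
      (R.trans (R.+-congʳ (x²≤0⇒x≈0 (order (x ∷ y ∷ []) ((v0 :- v1) :* (v0 :- v1)) (con 0)
        (lit 2 ⊗ hyp₀ v1 0≤y ⊗ hyp v1 v0 y≤x ⊕ hyp (v0 :* v0) (v1 :* v1) h) ≡.refl)))
        (R.+-identityˡ y)))

  ½ : Carrier
  ½ = num 2 ⁻¹

  2*½ : num 2 * ½ ≈ 1#
  2*½ = inverseʳ (0<num 1)

  module _ (n : ℕ) (1≤n : 1 ℕ.≤ n) where
    private
      N = fromℕ n
      s = √ n

      1≤N : 1# ≤ N
      1≤N = O.≤-respˡ-≈ (R.+-identityʳ 1#) (fromℕ-mono 1≤n)

    1≤√ : 1# ≤ √ n
    1≤√ = proj₁ (√-isLub n) 1# (O.≤-respˡ-≈ (R.sym (R.*-identityˡ 1#)) 1≤N)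

    0<√ : 0# < √ n
    0<√ = 0<x≤y⇒0<y 0<1 1≤√

    -- s is compared with the Newton iterate (s + n / s) / 2, an upper bound of
    -- the set, and with its mirror image 2 n s / (n + s²), a member of the set.
    √-square : √ n * √ n ≈ fromℕ n
    √-square = O.antisym s²≤N N≤s²
      where
      i = s ⁻¹
      si≈1 : s * i ≈ 1#
      si≈1 = inverseʳ 0<√

      2v = s + N * i

      N≤v² : num 4 * N ≤ 2v * 2v
      N≤v² = O.≤-respˡ-≈
        (R.trans (ring (N ∷ s * i ∷ []) (con 4 :* v0 :* v1) (con 4 :* v0 :* v1) ≡.refl)
          (R.trans (R.*-congˡ si≈1) (R.*-identityʳ _)))
        (order (N ∷ s ∷ i ∷ []) (con 4 :* v0 :* (v1 :* v2)) ((v1 :+ v0 :* v2) :* (v1 :+ v0 :* v2))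
          (sq (v1 :- v0 :* v2)) ≡.refl)

      0≤2v : 0# ≤ 2v
      0≤2v = 0≤x+y (proj₁ 0<√) (*-nonNeg (0≤fromℕ n) (0≤x⁻¹ 0<√))

      bound : UpperBound (SquareAtMost n) (½ * 2v)
      bound x x²≤N = *-cancelˡ-≤ (0<num 1) (O.≤-respʳ-≈
        (R.sym (R.trans (R.sym (R.*-assoc (num 2) ½ 2v)) (R.trans (R.*-congʳ 2*½) (R.*-identityˡ 2v))))
        (square-cancel-≤ 0≤2v (O.trans
          (order (x ∷ N ∷ []) ((con 2 :* v0) :* (con 2 :* v0)) (con 4 :* v1)
            (lit 4 ⊗ hyp (v0 :* v0) v1 x²≤N) ≡.refl) N≤v²)))

      s²≤N : s * s ≤ N
      s²≤N = O.≤-respʳ-≈ (R.trans (ring (s ∷ i ∷ N ∷ []) (v0 :* (v2 :* v1)) (v0 :* v1 :* v2) ≡.refl)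
          (R.trans (R.*-congʳ si≈1) (R.*-identityˡ N)))
        (order (s ∷ N * i ∷ []) (v0 :* v0) (v0 :* v1) (hyp₀ v0 (proj₁ 0<√) ⊗ hyp v0 v1 s≤Ni) ≡.refl)
        where
        2s≤2v : num 2 * s ≤ 2v
        2s≤2v = O.≤-respʳ-≈ (R.trans (R.sym (R.*-assoc (num 2) ½ 2v)) (R.trans (R.*-congʳ 2*½) (R.*-identityˡ 2v)))
          (order (s ∷ ½ * 2v ∷ []) (con 2 :* v0) (con 2 :* v1)
            (lit 2 ⊗ hyp v0 v1 (proj₂ (√-isLub n) (½ * 2v) bound)) ≡.refl)
        s≤Ni : s ≤ N * i
        s≤Ni = order (s ∷ N * i ∷ []) v0 v1 (hyp (con 2 :* v0) (v0 :+ v1) 2s≤2v) ≡.refl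

      d = N + s * s
      0<d : 0# < d
      0<d = 0<x≤y⇒0<y 0<1 (order (N ∷ s ∷ []) (con 1) (v0 :+ v1 :* v1) (hyp (con 1) v0 1≤N ⊕ sq v1) ≡.refl)
      j = d ⁻¹
      y = num 2 * N * s * j

      unit : (N + s * s) * j ≈ 1#
      unit = inverseʳ 0<d

      y²≤N : y * y ≤ N
      y²≤N = O.≤-respʳ-≈
        (R.trans (R.*-congˡ (R.*-cong unit unit)) (R.trans (R.*-congˡ (R.*-identityˡ 1#)) (R.*-identityʳ N)))
        (order (N ∷ s ∷ j ∷ []) ((con 2 :* v0 :* v1 :* v2) :* (con 2 :* v0 :* v1 :* v2))
          (v0 :* (((v0 :+ v1 :* v1) :* v2) :* ((v0 :+ v1 :* v1) :* v2)))
          (hyp₀ v0 (0≤fromℕ n) ⊗ sq ((v0 :- v1 :* v1) :* v2)) ≡.refl)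

      N≤s² : N ≤ s * s
      N≤s² = *-cancelˡ-≤ 0<√ (order (N ∷ s ∷ []) (v1 :* v0) (v1 :* (v1 :* v1))
          (hyp (con 2 :* v0 :* v1) ((v0 :+ v1 :* v1) :* v1) 2Ns≤ds) ≡.refl)
        where
        2Ns≤ds : num 2 * N * s ≤ d * s
        2Ns≤ds = O.≤-respˡ-≈
          (R.trans (ring (N ∷ s ∷ j ∷ d ∷ []) (v3 :* (con 2 :* v0 :* v1 :* v2)) (v3 :* v2 :* (con 2 :* v0 :* v1)) ≡.refl)
            (R.trans (R.*-congʳ unit) (R.*-identityˡ _)))
          (order (d ∷ y ∷ s ∷ []) (v0 :* v1) (v0 :* v2)
            (hyp₀ v0 (proj₁ 0<d) ⊗ hyp v1 v2 (proj₁ (√-isLub n) y y²≤N)) ≡.refl)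

  √-mono : ∀ {m n} → 1 ℕ.≤ m → m ℕ.≤ n → √ m ≤ √ n
  √-mono {m} {n} 1≤m m≤n = square-cancel-≤ (proj₁ (0<√ n 1≤n))
    (O.≤-respˡ-≈ (R.sym (√-square m 1≤m)) (O.≤-respʳ-≈ (R.sym (√-square n 1≤n)) (fromℕ-mono m≤n)))
    where
    1≤n = ℕ.≤-trans 1≤m m≤n

  1≤log₂ : (n : ℕ) .{{_ : ℕ.NonZero n}} → 2 ℕ.≤ n → 1# ≤ log₂ n
  1≤log₂ n 2≤n = proj₁ (log₂-isLub n) 1#
    (1 , 1 , ℕ.≤-refl , ℕ.≤-trans 2≤n (ℕ.≤-reflexive (≡.sym (ℕ.*-identityʳ n))) , R.*-identityˡ (fromℕ 1))

-- Expectations and backward induction for online algorithms.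

module Expectation (ℝ : CompleteOrderedField) where
  open Real ℝ public
  open Trading ℝ public
  open SemiringSum R.semiring using (sum; sum-cong-≋; ∑-distrib-+; *-distribˡ-sum; *-distribʳ-sum) public

  +-mono-≤ : ∀ {a b c d} → a ≤ b → c ≤ d → a + c ≤ b + d
  +-mono-≤ {a} {b} {c} {d} a≤b c≤d =
    order (a ∷ b ∷ c ∷ d ∷ []) (v0 :+ v2) (v1 :+ v3) (hyp v0 v1 a≤b ⊕ hyp v2 v3 c≤d) ≡.refl

  *-monoˡ-≤ : ∀ {c x y} → 0# ≤ c → x ≤ y → c * x ≤ c * y
  *-monoˡ-≤ {c} {x} {y} 0≤c x≤y =
    order (c ∷ x ∷ y ∷ []) (v0 :* v1) (v0 :* v2) (hyp₀ v0 0≤c ⊗ hyp v1 v2 x≤y) ≡.refl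

  sum-mono-≤ : ∀ {n} {f g : Fin n → Carrier} → (∀ i → f i ≤ g i) → sum f ≤ sum g
  sum-mono-≤ {zero}  f≤g = O.refl
  sum-mono-≤ {suc n} f≤g = +-mono-≤ (f≤g zero) (sum-mono-≤ (f≤g ∘ suc))

  indicator : ∀ {P : Set} → Dec P → Carrier
  indicator (yes _) = 1#
  indicator (no  _) = 0#

  module _ {B : ℕ} (I : Instance B) where
    open Instance I
    open Distribution D

    𝔼₁ : (Fin size → Carrier) → Carrier
    𝔼₁ f = sum λ i → prob i * f i

    𝔼₁-mono : ∀ {f g} → (∀ i → f i ≤ g i) → 𝔼₁ f ≤ 𝔼₁ g
    𝔼₁-mono f≤g = sum-mono-≤ λ i → *-monoˡ-≤ (proj₁ (prob-pos i)) (f≤g i)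

    𝔼₁-cong : ∀ {f g} → (∀ i → f i ≈ g i) → 𝔼₁ f ≈ 𝔼₁ g
    𝔼₁-cong f≈g = sum-cong-≋ λ i → R.*-congˡ (f≈g i)

    𝔼₁-+ : ∀ f g → 𝔼₁ (λ i → f i + g i) ≈ 𝔼₁ f + 𝔼₁ g
    𝔼₁-+ f g = R.trans (sum-cong-≋ λ i → R.distribˡ (prob i) (f i) (g i))
      (∑-distrib-+ (λ i → prob i * f i) (λ i → prob i * g i))

    𝔼₁-* : ∀ c f → 𝔼₁ (λ i → c * f i) ≈ c * 𝔼₁ f
    𝔼₁-* c f = R.trans
      (sum-cong-≋ λ i → ring (prob i ∷ c ∷ f i ∷ []) (v0 :* (v1 :* v2)) (v1 :* (v0 :* v2)) ≡.refl)
      (R.sym (*-distribˡ-sum c (λ i → prob i * f i)))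

    𝔼₁-const : ∀ c → 𝔼₁ (λ _ → c) ≈ c
    𝔼₁-const c = R.trans (R.sym (*-distribʳ-sum c prob))
      (R.trans (R.*-congʳ prob-sum) (R.*-identityˡ c))

    𝔼-mono : ∀ n {f g : Vec (Fin size) n → Carrier} → (∀ ω → f ω ≤ g ω) → 𝔼 I n f ≤ 𝔼 I n g
    𝔼-mono zero    f≤g = f≤g []
    𝔼-mono (suc n) f≤g = 𝔼₁-mono λ i → 𝔼-mono n λ ω → f≤g (i ∷ ω)

    𝔼-cong : ∀ n {f g : Vec (Fin size) n → Carrier} → (∀ ω → f ω ≈ g ω) → 𝔼 I n f ≈ 𝔼 I n g
    𝔼-cong zero    f≈g = f≈g []
    𝔼-cong (suc n) f≈g = 𝔼₁-cong λ i → 𝔼-cong n λ ω → f≈g (i ∷ ω)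

    𝔼-+ : ∀ n (f g : Vec (Fin size) n → Carrier) → 𝔼 I n (λ ω → f ω + g ω) ≈ 𝔼 I n f + 𝔼 I n g
    𝔼-+ zero    f g = R.refl
    𝔼-+ (suc n) f g = R.trans
      (𝔼₁-cong λ i → 𝔼-+ n (λ ω → f (i ∷ ω)) (λ ω → g (i ∷ ω)))
      (𝔼₁-+ (λ i → 𝔼 I n (λ ω → f (i ∷ ω))) (λ i → 𝔼 I n (λ ω → g (i ∷ ω))))

    𝔼-* : ∀ n c (f : Vec (Fin size) n → Carrier) → 𝔼 I n (λ ω → c * f ω) ≈ c * 𝔼 I n f
    𝔼-* zero    c f = R.refl
    𝔼-* (suc n) c f = R.trans (𝔼₁-cong λ i → 𝔼-* n c (λ ω → f (i ∷ ω)))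
      (𝔼₁-* c (λ i → 𝔼 I n (λ ω → f (i ∷ ω))))

    𝔼-const : ∀ n c → 𝔼 I n (λ _ → c) ≈ c
    𝔼-const zero    c = R.refl
    𝔼-const (suc n) c = R.trans (𝔼₁-cong λ i → 𝔼-const n c) (𝔼₁-const c)

    Σₐ-cong : ∀ {f g : Action → Carrier} → (∀ a → f a ≈ g a) → Σₐ I f ≈ Σₐ I g
    Σₐ-cong f≈g = R.+-cong (R.+-cong (f≈g buy) (f≈g sell)) (f≈g skip)

    Σₐ-mono : ∀ {f g : Action → Carrier} → (∀ a → f a ≤ g a) → Σₐ I f ≤ Σₐ I g
    Σₐ-mono f≤g = +-mono-≤ (+-mono-≤ (f≤g buy) (f≤g sell)) (f≤g skip)

    module _ (A : OnlineAlgorithm I) where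
      open OnlineAlgorithm A

      valueFrom : ∀ n → History I → Carrier
      valueFrom n h = 𝔼 I n (profitFrom I A h)

      valueFrom-suc : ∀ n h → valueFrom (suc n) h ≈
        𝔼₁ (λ i → Σₐ I λ a → choose h i a * (gain I i a + valueFrom n ((i , a) ∷ h)))
      valueFrom-suc n h = 𝔼₁-cong λ i →
        let term : Action → Vec (Fin size) n → Carrier
            term a ω = choose h i a * (gain I i a + profitFrom I A ((i , a) ∷ h) ω)
            expect : ∀ a → 𝔼 I n (term a) ≈ choose h i a * (gain I i a + valueFrom n ((i , a) ∷ h))
            expect a = R.trans (𝔼-* n (choose h i a) _) (R.*-congˡ (R.trans
              (𝔼-+ n (λ _ → gain I i a) (profitFrom I A ((i , a) ∷ h))) (R.+-congʳ (𝔼-const n _))))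
        in R.trans
             (R.trans (𝔼-+ n (λ ω → term buy ω + term sell ω) (term skip))
               (R.+-congʳ (𝔼-+ n (term buy) (term sell))))
             (Σₐ-cong expect)

      private
        scaled-mono : ∀ {c x y} → 0# ≤ c → c ≈ 0# ⊎ x ≤ y → c * x ≤ c * y
        scaled-mono 0≤c (inj₂ x≤y) = *-monoˡ-≤ 0≤c x≤y
        scaled-mono 0≤c (inj₁ c≈0) = O.reflexive
          (R.trans (R.*-congʳ c≈0) (R.trans (R.zeroˡ _) (R.sym (R.trans (R.*-congʳ c≈0) (R.zeroˡ _)))))

      -- One step of backward induction. Actions of probability zero are exempt, since the induction
      -- hypothesis says nothing about the state after an infeasible action.
      valueFrom-lower : ∀ n h (l : Fin size → Action → Carrier) →
        (∀ i a → choose h i a ≈ 0# ⊎ l i a ≤ valueFrom n ((i , a) ∷ h)) →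
        𝔼₁ (λ i → Σₐ I λ a → choose h i a * (gain I i a + l i a)) ≤ valueFrom (suc n) h
      valueFrom-lower n h l l≤ = O.≤-respʳ-≈ (R.sym (valueFrom-suc n h))
        (𝔼₁-mono λ i → Σₐ-mono λ a → scaled-mono (choose-nonNeg h i a) (shift i a (l≤ i a)))
        where
        shift : ∀ i a → choose h i a ≈ 0# ⊎ l i a ≤ valueFrom n ((i , a) ∷ h) →
                choose h i a ≈ 0# ⊎ gain I i a + l i a ≤ gain I i a + valueFrom n ((i , a) ∷ h)
        shift i a (inj₁ c≈0) = inj₁ c≈0
        shift i a (inj₂ l≤v) = inj₂ (+-monoʳ-≤ (gain I i a) l≤v)

      valueFrom-upper : ∀ n h (u : Fin size → Carrier) →
        (∀ i a → choose h i a ≈ 0# ⊎ gain I i a + valueFrom n ((i , a) ∷ h) ≤ u i) →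
        valueFrom (suc n) h ≤ 𝔼₁ u
      valueFrom-upper n h u ≤u = O.≤-respˡ-≈ (R.sym (valueFrom-suc n h))
        (𝔼₁-mono λ i → O.≤-respʳ-≈ (total i) (Σₐ-mono λ a → scaled-mono (choose-nonNeg h i a) (≤u i a)))
        where
        total : ∀ i → Σₐ I (λ a → choose h i a * u i) ≈ u i
        total i = R.trans
          (ring (choose h i buy ∷ choose h i sell ∷ choose h i skip ∷ u i ∷ [])
            (v0 :* v3 :+ v1 :* v3 :+ v2 :* v3) ((v0 :+ v1 :+ v2) :* v3) ≡.refl)
          (R.trans (R.*-congʳ (choose-sum h i)) (R.*-identityˡ (u i)))

    private
      module E = Extrema (DecTotalOrder.totalOrder decTotalOrder)

    offlineProfit-upper : ∀ ω {u} → 0# ≤ u → (∀ as → Feasible B B₀ as → profit I ω as ≤ u) →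
                          offlineProfit I ω ≤ u
    offlineProfit-upper ω 0≤u bound = E.max≤v⁺ 0≤u (All.tabulate each)
      where
      each : ∀ {x} → x ∈ map (profit I ω) (filter (feasible? B B₀) (actionSequences T)) → x ≤ _
      each x∈ with ∈-map⁻ (profit I ω) x∈
      ... | as , as∈ , ≡.refl = bound as (proj₂ (∈-filter⁻ (feasible? B B₀) {xs = actionSequences T} as∈))

    private
      ∈-actions : ∀ a → a ∈ actions
      ∈-actions buy  = here ≡.refl
      ∈-actions sell = there (here ≡.refl)
      ∈-actions skip = there (there (here ≡.refl))

      ∈-actionSequences : ∀ {n} (as : Vec Action n) → as ∈ actionSequences n
      ∈-actionSequences []       = here ≡.refl
      ∈-actionSequences (a ∷ as) = ∈-cartesianProductWith⁺ _∷_ (∈-actions a) (∈-actionSequences as)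

    offlineProfit-lower : ∀ ω as → Feasible B B₀ as → profit I ω as ≤ offlineProfit I ω
    offlineProfit-lower ω as feasible = E.v≤max⁺ 0# _ (inj₂ (Any.map (λ { ≡.refl → O.refl })
      (∈-map⁺ (profit I ω) (∈-filter⁺ (feasible? B B₀) (∈-actionSequences as) feasible))))

    0≤offlineProfit : ∀ ω → 0# ≤ offlineProfit I ω
    0≤offlineProfit ω = E.⊥≤max 0# (map (profit I ω) (filter (feasible? B B₀) (actionSequences T)))

    0≤OPT : 0# ≤ OPT I
    0≤OPT = O.≤-respˡ-≈ (𝔼-const T 0#) (𝔼-mono T 0≤offlineProfit)

    -- It serves twice: in (a) when the claimed ratio is not positive, and in (b), where its regret
    -- bounds `OPT` from below.
    idle : OnlineAlgorithm I
    idle = record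
      { choose          = λ _ _ → skipping
      ; choose-nonNeg   = λ _ _ → nonNeg
      ; choose-sum      = λ _ _ → ring [] (con 0 :+ con 0 :+ con 1) (con 1) ≡.refl
      ; choose-feasible = λ _ _ → feasible
      }
      where
      skipping : Action → Carrier
      skipping buy  = 0#
      skipping sell = 0#
      skipping skip = 1#
      nonNeg : ∀ a → 0# ≤ skipping a
      nonNeg buy  = O.refl
      nonNeg sell = O.refl
      nonNeg skip = 0≤1
      feasible : ∀ {x} a → ¬ Allowed B x a → skipping a ≈ 0#
      feasible buy  _  = R.refl
      feasible sell _  = R.refl
      feasible skip ¬⊤ = ⊥-elim (¬⊤ _)

    0≤idle : 0# ≤ expectedProfit I idle
    0≤idle = O.≤-respˡ-≈ (𝔼-const T 0#) (𝔼-mono T (from []))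
      where
      from : ∀ {n} h (ω : Vec (Fin size) n) → 0# ≤ profitFrom I idle h ω
      from h []      = O.refl
      from h (i ∷ ω) = order (b i ∷ s i ∷ profitFrom I idle ((i , buy) ∷ h) ω
        ∷ profitFrom I idle ((i , sell) ∷ h) ω ∷ profitFrom I idle ((i , skip) ∷ h) ω ∷ [])
        (con 0) (con 0 :* (:- v0 :+ v2) :+ con 0 :* (v1 :+ v3) :+ con 1 :* (con 0 :+ v4))
        (hyp₀ v4 (from ((i , skip) ∷ h) ω)) ≡.refl

-- The threshold at a quantile of the price.

module _ {A : Set} (_≼_ : A → A → Set) (total : ∀ x y → x ≼ y ⊎ y ≼ x)
         (≼-trans : ∀ {x y z} → x ≼ y → y ≼ z → x ≼ z) where

  private
    ≼-refl : ∀ x → x ≼ x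
    ≼-refl x with total x x
    ... | inj₁ r = r
    ... | inj₂ r = r

  argmin : ∀ {n} (f : Fin n → A) {P : Fin n → Set} → (∀ i → Dec (P i)) →
           (∀ i → ¬ P i) ⊎ (Σ[ i ∈ Fin n ] P i × (∀ j → P j → f i ≼ f j))
  argmin {zero}  f P? = inj₁ λ ()
  argmin {suc n} f P? with P? zero | argmin (f ∘ suc) (P? ∘ suc)
  ... | no ¬p | inj₁ none = inj₁ λ { zero → ¬p ; (suc i) → none i }
  ... | no ¬p | inj₂ (i , pi , least) = inj₂ (suc i , pi , λ
    { zero p → ⊥-elim (¬p p) ; (suc j) pj → least j pj })
  ... | yes p | inj₁ none = inj₂ (zero , p , λ
    { zero _ → ≼-refl (f zero) ; (suc j) pj → ⊥-elim (none j pj) })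
  ... | yes p | inj₂ (i , pi , least) with total (f zero) (f (suc i))
  ...   | inj₁ f0≼fi = inj₂ (zero , p , λ
    { zero _ → ≼-refl (f zero) ; (suc j) pj → ≼-trans f0≼fi (least j pj) })
  ...   | inj₂ fi≼f0 = inj₂ (suc i , pi , λ { zero _ → fi≼f0 ; (suc j) pj → least j pj })

module Thresholds (ℝ : CompleteOrderedField) where
  open Expectation ℝ public

  fraction : ∀ {d e} → 0# ≤ d → d ≤ e → Σ[ θ ∈ Carrier ] 0# ≤ θ × θ ≤ 1# × θ * e ≈ d
  fraction {d} {e} 0≤d d≤e with e O.≟ 0#
  ... | yes e≈0 = 0# , O.refl , 0≤1 , R.trans (R.zeroˡ e) (O.antisym 0≤d (O.≤-respʳ-≈ e≈0 d≤e))
  ... | no  e≉0 = d * e ⁻¹ , *-nonNeg 0≤d (0≤x⁻¹ 0<e)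
    , O.≤-respʳ-≈ (inverseʳ 0<e) (O.≤-respˡ-≈ (R.*-comm (e ⁻¹) d) (O.≤-respʳ-≈ (R.*-comm (e ⁻¹) e) (*-monoˡ-≤ (0≤x⁻¹ 0<e) d≤e)))
    , R.trans (ring (d ∷ e ∷ e ⁻¹ ∷ []) (v0 :* v2 :* v1) (v0 :* (v1 :* v2)) ≡.refl)
        (R.trans (R.*-congˡ (inverseʳ 0<e)) (R.*-identityʳ d))
    where
    0<e : 0# < e
    0<e = O.trans 0≤d d≤e , λ eq → e≉0 (R.sym eq)

  -- 1 above q, 0 below q, and θ at q.
  mixed : Carrier → Carrier → Carrier → Carrier
  mixed θ p q = (1# - indicator (p O.≤? q)) + θ * (indicator (p O.≤? q) + indicator (q O.≤? p) - 1#)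

  mixed-bounds : ∀ {θ} p q → 0# ≤ θ → θ ≤ 1# →
    0# ≤ mixed θ p q × mixed θ p q ≤ 1# × 0# ≤ mixed θ p q * (p - q) × 0# ≤ (1# - mixed θ p q) * (q - p)
  mixed-bounds {θ} p q 0≤θ θ≤1 with p O.≤? q | q O.≤? p
  ... | yes i≤j | yes j≤i =
      order ρ (con 0) e (hyp₀ v0 0≤θ) ≡.refl
    , order ρ e (con 1) (hyp v0 (con 1) θ≤1) ≡.refl
    , order ρ (con 0) (e :* (v1 :- v2)) (hyp₀ v0 0≤θ ⊗ hyp v2 v1 j≤i) ≡.refl
    , order ρ (con 0) ((con 1 :- e) :* (v2 :- v1)) (hyp v0 (con 1) θ≤1 ⊗ hyp v1 v2 i≤j) ≡.refl
    where
    ρ = θ ∷ p ∷ q ∷ []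
    e : Expr 3
    e = (con 1 :- con 1) :+ v0 :* (con 1 :+ con 1 :- con 1)
  ... | yes i≤j | no _ =
      order ρ (con 0) e (lit 0) ≡.refl
    , order ρ e (con 1) (lit 1) ≡.refl
    , order ρ (con 0) (e :* (v1 :- v2)) (lit 0) ≡.refl
    , order ρ (con 0) ((con 1 :- e) :* (v2 :- v1)) (hyp v1 v2 i≤j) ≡.refl
    where
    ρ = θ ∷ p ∷ q ∷ []
    e : Expr 3
    e = (con 1 :- con 1) :+ v0 :* (con 1 :+ con 0 :- con 1)
  ... | no _ | yes j≤i =
      order ρ (con 0) e (lit 1) ≡.refl
    , order ρ e (con 1) (lit 0) ≡.refl
    , order ρ (con 0) (e :* (v1 :- v2)) (hyp v2 v1 j≤i) ≡.refl
    , order ρ (con 0) ((con 1 :- e) :* (v2 :- v1)) (lit 0) ≡.refl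
    where
    ρ = θ ∷ p ∷ q ∷ []
    e : Expr 3
    e = (con 1 :- con 0) :+ v0 :* (con 0 :+ con 1 :- con 1)
  ... | no ¬i≤j | no ¬j≤i with O.total p q
  ...   | inj₁ i≤j = ⊥-elim (¬i≤j i≤j)
  ...   | inj₂ j≤i = ⊥-elim (¬j≤i j≤i)

  module _ {B : ℕ} (I : Instance B) where
    open Instance I
    open Distribution D

    -- Selling with probability σ i and buying otherwise is optimal against the
    -- shadow price level, and stock decreases by 1 - 2 β per step on average.
    record Threshold (β : Carrier) : Set where
      field
        level      : Carrier
        σ          : Fin size → Carrier
        0≤level    : 0# ≤ level
        0≤σ        : ∀ i → 0# ≤ σ i
        σ≤1        : ∀ i → σ i ≤ 1#
        sell-above : ∀ i → 0# ≤ σ i * (b i - level)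
        buy-below  : ∀ i → 0# ≤ (1# - σ i) * (level - b i)
        𝔼σ         : 𝔼₁ I σ ≈ 1# - β

    module _ {β : Carrier} (0≤β : 0# ≤ β) (β≤1 : β ≤ 1#) where
      private
        -- `F v` and `G v` are the probabilities of a price at most `v` and of a price strictly
        -- below `v`.
        F : Carrier → Carrier
        F v = 𝔼₁ I λ i → indicator (b i O.≤? v)

        G : Carrier → Carrier
        G v = 𝔼₁ I λ i → 1# - indicator (v O.≤? b i)

        highest : Σ[ m ∈ Fin size ] (∀ j → b j ≤ b m)
        highest with argmin (flip _≤_) (λ x y → swap (O.total x y)) (flip O.trans) b {λ _ → ⊤} (λ _ → yes tt)
        ... | inj₂ (m , _ , greatest) = m , λ j → greatest j tt
        ... | inj₁ none = ⊥-elim (1≉0 (R.trans (R.sym prob-sum) (empty size prob (λ i → none i tt))))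
          where
          empty : ∀ n (f : Fin n → Carrier) → (Fin n → ⊥) → sum f ≈ 0#
          empty zero    f _  = R.refl
          empty (suc n) f ¬i = ⊥-elim (¬i zero)

        F-highest : β ≤ F (b (proj₁ highest))
        F-highest = O.trans β≤1 (O.≤-respˡ-≈ (𝔼₁-const I 1#) (𝔼₁-mono I bound))
          where
          bound : ∀ i → 1# ≤ indicator (b i O.≤? b (proj₁ highest))
          bound i with b i O.≤? b (proj₁ highest)
          ... | yes _ = O.refl
          ... | no  h = ⊥-elim (h (proj₂ highest i))

        -- j has the least price with `F` at least β. Let k have the greatest price below it: every
        -- price below `b j` is at most `b k`, and `F (b k)` cannot exceed β by minimality of j, so
        -- `G (b j)` is at most β.
        quantile : Σ[ j ∈ Fin size ] β ≤ F (b j) × G (b j) ≤ β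
        quantile with argmin _≤_ O.total O.trans b (λ i → β O.≤? F (b i))
        ... | inj₁ none = ⊥-elim (none _ F-highest)
        ... | inj₂ (j , β≤F , least)
          with argmin (flip _≤_) (λ x y → swap (O.total x y)) (flip O.trans) b (λ i → ¬? (b j O.≤? b i))
        ...   | inj₁ none = j , β≤F , O.trans (O.≤-respʳ-≈ (𝔼₁-const I 0#) (𝔼₁-mono I bound)) 0≤β
          where
          bound : ∀ i → 1# - indicator (b j O.≤? b i) ≤ 0#
          bound i with b j O.≤? b i
          ... | yes _ = O.reflexive (R.-‿inverseʳ 1#)
          ... | no  h = ⊥-elim (none i h)
        ...   | inj₂ (k , bj≰bk , greatest) = j , β≤F , O.trans (𝔼₁-mono I bound) F≤β
          where
          bound : ∀ i → 1# - indicator (b j O.≤? b i) ≤ indicator (b i O.≤? b k)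
          bound i with b j O.≤? b i | b i O.≤? b k
          ... | yes _ | yes _ = order [] (con 1 :- con 1) (con 1) (lit 1) ≡.refl
          ... | yes _ | no  _ = O.reflexive (R.-‿inverseʳ 1#)
          ... | no  _ | yes _ = order [] (con 1 :- con 0) (con 1) (lit 0) ≡.refl
          ... | no  h | no  g = ⊥-elim (g (greatest i h))
          F≤β : F (b k) ≤ β
          F≤β with O.total (F (b k)) β
          ... | inj₁ F≤β = F≤β
          ... | inj₂ β≤F = ⊥-elim (bj≰bk (least k β≤F))

      threshold : Threshold β
      threshold with quantile
      ... | j , β≤F , G≤β = record
        { level      = b j
        ; σ          = σ
        ; 0≤level    = b-nonNeg j
        ; 0≤σ        = λ i → proj₁ (pointwise i)
        ; σ≤1        = λ i → proj₁ (proj₂ (pointwise i))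
        ; sell-above = λ i → proj₁ (proj₂ (proj₂ (pointwise i)))
        ; buy-below  = λ i → proj₂ (proj₂ (proj₂ (pointwise i)))
        ; 𝔼σ         = mean
        }
        where
        u v : Fin size → Carrier
        u i = indicator (b i O.≤? b j)
        v i = indicator (b j O.≤? b i)

        split = fraction {F (b j) - β} {F (b j) - G (b j)} (x≤y⇒0≤y-x β≤F)
          (order (F (b j) ∷ G (b j) ∷ β ∷ []) (v0 :- v2) (v0 :- v1) (hyp v1 v2 G≤β) ≡.refl)
        θ = proj₁ split
        0≤θ = proj₁ (proj₂ split)
        θ≤1 = proj₁ (proj₂ (proj₂ split))

        σ : Fin size → Carrier
        σ i = mixed θ (b i) (b j)

        pointwise : ∀ i → _
        pointwise i = mixed-bounds (b i) (b j) 0≤θ θ≤1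

        -- The mean is 1 - F + θ (F - G), and θ was chosen with θ (F - G) = F - β.
        mean : 𝔼₁ I σ ≈ 1# - β
        mean = R.trans (𝔼₁-cong I expand) (R.trans linear solved)
          where
          w : Fin size → Carrier
          w i = 1# - v i
          expand : ∀ i → σ i ≈ 1# + ((θ - 1#) * u i + (- θ) * w i)
          expand i = ring (θ ∷ u i ∷ v i ∷ []) ((con 1 :- v1) :+ v0 :* (v1 :+ v2 :- con 1))
            (con 1 :+ ((v0 :- con 1) :* v1 :+ (:- v0) :* (con 1 :- v2))) ≡.refl
          linear : 𝔼₁ I (λ i → 1# + ((θ - 1#) * u i + (- θ) * w i)) ≈ 1# + ((θ - 1#) * F (b j) + (- θ) * G (b j))
          linear = R.trans (𝔼₁-+ I (λ _ → 1#) _) (R.+-cong (𝔼₁-const I 1#)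
            (R.trans (𝔼₁-+ I (λ i → (θ - 1#) * u i) (λ i → (- θ) * w i))
              (R.+-cong (𝔼₁-* I (θ - 1#) u) (𝔼₁-* I (- θ) w))))
          solved : 1# + ((θ - 1#) * F (b j) + (- θ) * G (b j)) ≈ 1# - β
          solved = R.trans
            (ring (θ ∷ F (b j) ∷ G (b j) ∷ []) (con 1 :+ ((v0 :- con 1) :* v1 :+ (:- v0) :* v2))
              (con 1 :- v1 :+ v0 :* (v1 :- v2)) ≡.refl)
            (R.trans (R.+-congˡ (proj₂ (proj₂ (proj₂ split))))
              (ring (F (b j) ∷ β ∷ []) (con 1 :- v0 :+ (v0 :- v1)) (con 1 :- v1) ≡.refl))

-- The quadratic potential for the threshold walk.

module PositivePart (ℝ : CompleteOrderedField) where
  open Thresholds ℝ public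

  pos : Carrier → Carrier
  pos z with O.total z 0#
  ... | inj₁ _ = 0#
  ... | inj₂ _ = z

  0≤pos : ∀ z → 0# ≤ pos z
  0≤pos z with O.total z 0#
  ... | inj₁ _   = O.refl
  ... | inj₂ 0≤z = 0≤z

  z≤pos : ∀ z → z ≤ pos z
  z≤pos z with O.total z 0#
  ... | inj₁ z≤0 = z≤0
  ... | inj₂ _   = O.refl

  -- t may have either sign. Hence the square of a positive part after a step is bounded by the
  -- square of its old value plus the increment, even where that sum is negative.
  pos²≤ : ∀ {z t} → z ≤ t → pos z * pos z ≤ t * t
  pos²≤ {z} {t} z≤t with O.total z 0#
  ... | inj₁ _   = order (t ∷ []) (con 0 :* con 0) (v0 :* v0) (sq v0) ≡.refl
  ... | inj₂ 0≤z = order (z ∷ t ∷ []) (v0 :* v0) (v1 :* v1)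
    (hyp v0 v1 z≤t ⊗ hyp v0 v1 z≤t ⊕ lit 2 ⊗ hyp₀ v0 0≤z ⊗ hyp v0 v1 z≤t) ≡.refl

  -- With n requests left, stock x should be near (1 - 2 β) n.  In units of
  -- K = M / r, where r = √ B and M is the profit per request in the fluid
  -- limit, the bracket in Φ′ bounds what an online policy loses: y and v penalise
  -- a stock above its target or above b - r, and the last term a stock below.
  module Potential (K r b β μ⁺ μ⁻ ℓ : Carrier)
    (0≤K : 0# ≤ K) (1≤r : 1# ≤ r) (r≤b : r ≤ b)
    (0≤β : 0# ≤ β) (2β≤1 : num 2 * β ≤ 1#)
    (0≤μ⁺ : 0# ≤ μ⁺) (0≤μ⁻ : 0# ≤ μ⁻) (0≤ℓ : 0# ≤ ℓ) (μ⁻≤βℓ : μ⁻ ≤ β * ℓ)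
    (Kr≈M : K * r ≈ μ⁺ + μ⁻ + ℓ * (1# - num 2 * β)) where

    excess : Carrier → Carrier → Carrier
    excess n x = x - (1# - num 2 * β) * n

    overflow : Carrier → Carrier
    overflow x = x - b + r

    -- n (μ⁺ + μ⁻) + ℓ x is the dual bound with multiplier ℓ for the state. The positive parts are
    -- separate arguments because the certificates treat them as variables.
    Φ′ : (n x y v : Carrier) → Carrier
    Φ′ n x y v = n * (μ⁺ + μ⁻) + ℓ * x - K *
      (num 2 * (r * r) + num 4 * n + num 2 * (y * y) + num 2 * (v * v) + num 3 * r
        - num 2 * r * (x - (1# - num 2 * β) * n))

    Φ : Carrier → Carrier → Carrier
    Φ n x = Φ′ n x (pos (excess n x)) (pos (overflow x))

    -- The means of σ b and (1 - σ) b, that is, the expected revenue and expense in one step of the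
    -- threshold rule.
    meanSale meanPurchase : Carrier
    meanSale     = μ⁺ + (1# - β) * ℓ
    meanPurchase = β * ℓ - μ⁻

    private
      module Syntax {k} (Kₑ rₑ βₑ μ⁺ₑ μ⁻ₑ ℓₑ : Expr k) where
        ρₑ : Expr k
        ρₑ = con 1 :- con 2 :* βₑ

        Φₑ : (n x y v : Expr k) → Expr k
        Φₑ n x y v = n :* (μ⁺ₑ :+ μ⁻ₑ) :+ ℓₑ :* x :- Kₑ :*
          (con 2 :* (rₑ :* rₑ) :+ con 4 :* n :+ con 2 :* (y :* y) :+ con 2 :* (v :* v) :+ con 3 :* rₑ
            :- con 2 :* rₑ :* (x :- ρₑ :* n))

        saleₑ purchaseₑ : Expr k
        saleₑ     = μ⁺ₑ :+ (con 1 :- βₑ) :* ℓₑ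
        purchaseₑ = βₑ :* ℓₑ :- μ⁻ₑ

      0≤1-β : 0# ≤ 1# - β
      0≤1-β = order (β ∷ []) (con 0) (con 1 :- v0)
        (hyp₀ v0 0≤β ⊕ hyp (con 2 :* v0) (con 1) 2β≤1) ≡.refl

      open Syntax {14} v0 v1 v2 v3 v4 v5

    -- The dual part is preserved and the linear term is a martingale. The excess has mean increment
    -- 0 and variance at most 1, the overflow has mean increment -(1 - 2 β) ≤ 0 and steps of length
    -- 1. So 2 y² and 2 v² together grow by at most 4 on average, which 4 n pays.
    interior-step : ∀ n x → Φ (1# + n) (1# + x) ≤
      (meanSale - meanPurchase) + ((1# - β) * Φ n x + β * Φ n (1# + (1# + x)))
    interior-step n x = order (K ∷ r ∷ β ∷ μ⁺ ∷ μ⁻ ∷ ℓ ∷ n ∷ x ∷ y ∷ v ∷ yₛ ∷ vₛ ∷ y₊ ∷ v₊ ∷ [])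
      (Φₑ (con 1 :+ v6) (con 1 :+ v7) v8 v9)
      ((saleₑ :- purchaseₑ) :+ ((con 1 :- v2) :* Φₑ v6 v7 v10 v11 :+ v2 :* Φₑ v6 (con 1 :+ (con 1 :+ v7)) v12 v13))
      (hyp₀ v0 0≤K ⊗ (
        lit 2 ⊗ hyp₀ (con 1 :- v2) 0≤1-β ⊗
          (hyp (v10 :* v10) ((v8 :- con 1 :+ ρₑ) :* (v8 :- con 1 :+ ρₑ)) yₛ²
            ⊕ hyp (v11 :* v11) ((v9 :- con 1) :* (v9 :- con 1)) vₛ²)
        ⊕ lit 2 ⊗ hyp₀ v2 0≤β ⊗
          (hyp (v12 :* v12) ((v8 :+ con 1 :+ ρₑ) :* (v8 :+ con 1 :+ ρₑ)) y₊²
            ⊕ hyp (v13 :* v13) ((v9 :+ con 1) :* (v9 :+ con 1)) v₊²)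
        ⊕ lit 2 ⊗ sq ρₑ
        ⊕ lit 4 ⊗ hyp (con 2 :* v2) (con 1) 2β≤1 ⊗ hyp₀ v9 (0≤pos _)))
      ≡.refl
      where
      y  = pos (excess (1# + n) (1# + x))
      v  = pos (overflow (1# + x))
      yₛ = pos (excess n x)
      vₛ = pos (overflow x)
      y₊ = pos (excess n (1# + (1# + x)))
      v₊ = pos (overflow (1# + (1# + x)))
      z≤y = z≤pos (excess (1# + n) (1# + x))
      w≤v = z≤pos (overflow (1# + x))

      ρ₁ : Vec Carrier 4
      ρ₁ = y ∷ β ∷ n ∷ x ∷ []
      zₑ : Expr 4
      zₑ = (con 1 :+ v3) :- (con 1 :- con 2 :* v1) :* (con 1 :+ v2)

      yₛ² : yₛ * yₛ ≤ (y - 1# + (1# - num 2 * β)) * (y - 1# + (1# - num 2 * β))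
      yₛ² = pos²≤ (order ρ₁ (v3 :- (con 1 :- con 2 :* v1) :* v2) (v0 :- con 1 :+ (con 1 :- con 2 :* v1))
        (hyp zₑ v0 z≤y) ≡.refl)
      y₊² : y₊ * y₊ ≤ (y + 1# + (1# - num 2 * β)) * (y + 1# + (1# - num 2 * β))
      y₊² = pos²≤ (order ρ₁ (con 1 :+ (con 1 :+ v3) :- (con 1 :- con 2 :* v1) :* v2) (v0 :+ con 1 :+ (con 1 :- con 2 :* v1))
        (hyp zₑ v0 z≤y) ≡.refl)

      ρ₂ : Vec Carrier 4
      ρ₂ = v ∷ b ∷ r ∷ x ∷ []
      vₛ² : vₛ * vₛ ≤ (v - 1#) * (v - 1#)
      vₛ² = pos²≤ (order ρ₂ (v3 :- v1 :+ v2) (v0 :- con 1) (hyp (con 1 :+ v3 :- v1 :+ v2) v0 w≤v) ≡.refl)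
      v₊² : v₊ * v₊ ≤ (v + 1#) * (v + 1#)
      v₊² = pos²≤ (order ρ₂ (con 1 :+ (con 1 :+ v3) :- v1 :+ v2) (v0 :+ con 1) (hyp (con 1 :+ v3 :- v1 :+ v2) v0 w≤v) ≡.refl)

    -- A blocked sale costs μ⁺ ≤ M = K r. Without sales x - (1 - 2 β) n has mean increment 1 - β ≥
    -- 1/2, so the linear term releases at least K r.
    bottom-step : ∀ n → 0# ≤ n → Φ (1# + n) 0# ≤
      (- meanPurchase) + ((1# - β) * Φ n 0# + β * Φ n (1# + 0#))
    bottom-step n 0≤n = order (K ∷ r ∷ β ∷ μ⁺ ∷ μ⁻ ∷ ℓ ∷ n ∷ b ∷ y ∷ v ∷ y₀ ∷ v₀ ∷ y₊ ∷ v₊ ∷ [])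
      (Φₑ (con 1 :+ v6) (con 0) v8 v9)
      ((:- purchaseₑ) :+ ((con 1 :- v2) :* Φₑ v6 (con 0) v10 v11 :+ v2 :* Φₑ v6 (con 1 :+ con 0) v12 v13))
      (hyp₀ v0 0≤K ⊗ (
        lit 2 ⊗ hyp₀ (con 1 :- v2) 0≤1-β ⊗
          (hyp (v10 :* v10) (con 0 :* con 0) y₀² ⊕ hyp (v11 :* v11) (con 0 :* con 0) v₀²)
        ⊕ lit 2 ⊗ hyp₀ v2 0≤β ⊗
          (hyp (v12 :* v12) (con 1 :* con 1) y₊² ⊕ hyp (v13 :* v13) (con 1 :* con 1) v₊²)
        ⊕ lit 2 ⊗ sq v8 ⊕ lit 2 ⊗ sq v9
        ⊕ lit 4 ⊗ hyp₀ (con 1 :- v2) 0≤1-β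
        ⊕ hyp (con 1) v1 1≤r ⊗ hyp (con 2 :* v2) (con 1) 2β≤1
        ⊕ hyp (con 2 :* v2) (con 1) 2β≤1)
        ⊕ hyp (v3 :+ v4 :+ v5 :* (con 1 :- con 2 :* v2)) (v0 :* v1) (O.reflexive (R.sym Kr≈M))
        ⊕ hyp₀ v4 0≤μ⁻ ⊕ hyp₀ v5 0≤ℓ ⊗ hyp (con 2 :* v2) (con 1) 2β≤1)
      ≡.refl
      where
      y  = pos (excess (1# + n) 0#)
      v  = pos (overflow 0#)
      y₀ = pos (excess n 0#)
      v₀ = pos (overflow 0#)
      y₊ = pos (excess n (1# + 0#))
      v₊ = pos (overflow (1# + 0#))

      y₀² : y₀ * y₀ ≤ 0# * 0#
      y₀² = pos²≤ (order (n ∷ β ∷ []) (con 0 :- (con 1 :- con 2 :* v1) :* v0) (con 0)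
        (hyp (con 2 :* v1) (con 1) 2β≤1 ⊗ hyp₀ v0 0≤n) ≡.refl)
      y₊² : y₊ * y₊ ≤ 1# * 1#
      y₊² = pos²≤ (order (n ∷ β ∷ []) (con 1 :+ con 0 :- (con 1 :- con 2 :* v1) :* v0) (con 1)
        (hyp (con 2 :* v1) (con 1) 2β≤1 ⊗ hyp₀ v0 0≤n) ≡.refl)
      v₀² : v₀ * v₀ ≤ 0# * 0#
      v₀² = pos²≤ (order (b ∷ r ∷ []) (con 0 :- v0 :+ v1) (con 0) (hyp v1 v0 r≤b) ≡.refl)
      v₊² : v₊ * v₊ ≤ 1# * 1#
      v₊² = pos²≤ (order (b ∷ r ∷ []) (con 1 :+ con 0 :- v0 :+ v1) (con 1) (hyp v1 v0 r≤b) ≡.refl)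

    -- A blocked purchase costs μ⁻ ≤ M = K r. Since v ≥ r here, 2 v² releases 4 r (1 - β) up to a
    -- bounded term, while the linear term takes 2 r β; the difference 4 r - 6 r β is at least r.
    top-step : ∀ n x → b ≤ 1# + x → Φ (1# + n) (1# + x) ≤
      meanSale + ((1# - β) * Φ n x + β * Φ n (1# + x))
    top-step n x b≤1+x = order (K ∷ r ∷ β ∷ μ⁺ ∷ μ⁻ ∷ ℓ ∷ n ∷ x ∷ y ∷ v ∷ yₛ ∷ vₛ ∷ y₀ ∷ v₀ ∷ [])
      (Φₑ (con 1 :+ v6) (con 1 :+ v7) v8 v9)
      (saleₑ :+ ((con 1 :- v2) :* Φₑ v6 v7 v10 v11 :+ v2 :* Φₑ v6 (con 1 :+ v7) v12 v13))
      (hyp₀ v0 0≤K ⊗ (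
        lit 2 ⊗ hyp₀ (con 1 :- v2) 0≤1-β ⊗
          (hyp (v10 :* v10) ((v8 :- con 1 :+ ρₑ) :* (v8 :- con 1 :+ ρₑ)) yₛ²
            ⊕ hyp (v11 :* v11) ((v9 :- con 1) :* (v9 :- con 1)) vₛ²)
        ⊕ lit 2 ⊗ hyp₀ v2 0≤β ⊗
          (hyp (v12 :* v12) ((v8 :+ ρₑ) :* (v8 :+ ρₑ)) y₀²
            ⊕ hyp (v13 :* v13) (v9 :* v9) v₀²)
        ⊕ lit 2
        ⊕ lit 4 ⊗ hyp₀ v2 0≤β ⊗ hyp₀ v8 (0≤pos _)
        ⊕ lit 4 ⊗ hyp₀ (con 1 :- v2) 0≤1-β ⊗ hyp v1 v9 r≤v
        ⊕ lit 3 ⊗ hyp₀ v1 0≤r ⊗ hyp (con 2 :* v2) (con 1) 2β≤1)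
        ⊕ hyp (v3 :+ v4 :+ v5 :* (con 1 :- con 2 :* v2)) (v0 :* v1) (O.reflexive (R.sym Kr≈M))
        ⊕ hyp₀ v3 0≤μ⁺ ⊕ hyp₀ v5 0≤ℓ ⊗ hyp (con 2 :* v2) (con 1) 2β≤1)
      ≡.refl
      where
      0≤r = O.trans 0≤1 1≤r
      y  = pos (excess (1# + n) (1# + x))
      v  = pos (overflow (1# + x))
      yₛ = pos (excess n x)
      vₛ = pos (overflow x)
      y₀ = pos (excess n (1# + x))
      v₀ = pos (overflow (1# + x))
      z≤y = z≤pos (excess (1# + n) (1# + x))
      w≤v = z≤pos (overflow (1# + x))

      ρ₁ : Vec Carrier 4
      ρ₁ = y ∷ β ∷ n ∷ x ∷ []
      zₑ : Expr 4
      zₑ = (con 1 :+ v3) :- (con 1 :- con 2 :* v1) :* (con 1 :+ v2)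
      ρ₂ : Vec Carrier 4
      ρ₂ = v ∷ b ∷ r ∷ x ∷ []

      r≤v : r ≤ v
      r≤v = O.trans (order (r ∷ b ∷ x ∷ []) v0 (con 1 :+ v2 :- v1 :+ v0) (hyp v1 (con 1 :+ v2) b≤1+x) ≡.refl) w≤v
      yₛ² : yₛ * yₛ ≤ (y - 1# + (1# - num 2 * β)) * (y - 1# + (1# - num 2 * β))
      yₛ² = pos²≤ (order ρ₁ (v3 :- (con 1 :- con 2 :* v1) :* v2) (v0 :- con 1 :+ (con 1 :- con 2 :* v1))
        (hyp zₑ v0 z≤y) ≡.refl)
      y₀² : y₀ * y₀ ≤ (y + (1# - num 2 * β)) * (y + (1# - num 2 * β))
      y₀² = pos²≤ (order ρ₁ (con 1 :+ v3 :- (con 1 :- con 2 :* v1) :* v2) (v0 :+ (con 1 :- con 2 :* v1))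
        (hyp zₑ v0 z≤y) ≡.refl)
      vₛ² : vₛ * vₛ ≤ (v - 1#) * (v - 1#)
      vₛ² = pos²≤ (order ρ₂ (v3 :- v1 :+ v2) (v0 :- con 1) (hyp (con 1 :+ v3 :- v1 :+ v2) v0 w≤v) ≡.refl)
      v₀² : v₀ * v₀ ≤ v * v
      v₀² = pos²≤ w≤v

    -- The value of selling everything dominates, by 4 r y ≤ 2 r² + 2 y².
    sell-out : ∀ n x → 0# ≤ x → x ≤ n → n ≤ 1# + x → Φ n x ≤ x * (μ⁺ - μ⁻ + ℓ)
    sell-out n x 0≤x x≤n n≤1+x = order (K ∷ r ∷ β ∷ μ⁺ ∷ μ⁻ ∷ ℓ ∷ n ∷ x ∷ y ∷ v ∷ 0# ∷ 0# ∷ 0# ∷ 0# ∷ [])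
      (Φₑ v6 v7 v8 v9) (v7 :* (v3 :- v4 :+ v5))
      (hyp₀ v0 0≤K ⊗ (
          lit 2 ⊗ sq (v1 :- v8) ⊕ lit 2 ⊗ sq v9 ⊕ lit 4 ⊗ hyp₀ v6 0≤n
          ⊕ lit 4 ⊗ hyp₀ v1 0≤r ⊗ hyp (v7 :- ρₑ :* v6) v8 (z≤pos _))
        ⊕ hyp (v3 :+ v4 :+ v5 :* ρₑ) (v0 :* v1) (O.reflexive (R.sym Kr≈M)) ⊗
          (lit 2 ⊗ hyp v6 (con 1 :+ v7) n≤1+x ⊕ lit 1 ⊕ lit 4 ⊗ hyp₀ v2 0≤β ⊗ hyp₀ v6 0≤n)
        ⊕ hyp₀ (v3 :+ v4 :+ v5 :* ρₑ) 0≤M ⊗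
          (lit 3 ⊗ hyp v6 (con 1 :+ v7) n≤1+x)
        ⊕ hyp₀ v6 0≤n ⊗ lit 2 ⊗
          (lit 2 ⊗ hyp₀ v2 0≤β ⊗ hyp₀ v3 0≤μ⁺
            ⊕ lit 2 ⊗ hyp (con 2 :* v2) (con 1) 2β≤1 ⊗ hyp v4 (v2 :* v5) μ⁻≤βℓ
            ⊕ hyp (con 2 :* v2) (con 1) 2β≤1 ⊗ hyp₀ v4 0≤μ⁻)
        ⊕ lit 2 ⊗ hyp₀ v4 0≤μ⁻ ⊗ hyp v7 v6 x≤n
        ⊕ hyp₀ (v5 :* ρₑ) (*-nonNeg 0≤ℓ (x≤y⇒0≤y-x 2β≤1)) ⊗ hyp v7 v6 x≤n)
      ≡.refl
      where
      0≤r = O.trans 0≤1 1≤r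
      0≤n = O.trans 0≤x x≤n
      y  = pos (excess n x)
      v  = pos (overflow x)
      0≤M : 0# ≤ μ⁺ + μ⁻ + ℓ * (1# - num 2 * β)
      0≤M = 0≤x+y (0≤x+y 0≤μ⁺ 0≤μ⁻) (*-nonNeg 0≤ℓ (x≤y⇒0≤y-x 2β≤1))

    -- The origin of 18: with y = 0 and v ≤ r, the bracket is at most 4 t + 4 r² + 3 r ≤ 4 t + 7 b ≤
    -- 18 t.
    start : ∀ t x → x ≈ (1# - num 2 * β) * t → x ≤ b → r * r ≈ b → b ≤ num 2 * t →
            t * (K * r) - num 18 * (K * t) ≤ Φ t x
    start t x x≈ρt x≤b r²≈b b≤2t = order (K ∷ r ∷ β ∷ μ⁺ ∷ μ⁻ ∷ ℓ ∷ t ∷ x ∷ y ∷ v ∷ b ∷ 0# ∷ 0# ∷ 0# ∷ [])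
      (v6 :* (v0 :* v1) :- con 18 :* (v0 :* v6)) (Φₑ v6 v7 v8 v9)
      (hyp₀ v0 0≤K ⊗ (
          lit 2 ⊗ hyp (v8 :* v8) (con 0 :* con 0) y²
          ⊕ lit 2 ⊗ hyp (v9 :* v9) (v1 :* v1) v²
          ⊕ lit 7 ⊗ hyp (v1 :* v1) v10 (O.reflexive r²≈b)
          ⊕ lit 7 ⊗ hyp v10 (con 2 :* v6) b≤2t
          ⊕ lit 3 ⊗ hyp (con 1) v1 1≤r ⊗ hyp₀ v1 0≤r
          ⊕ lit 2 ⊗ hyp₀ v1 0≤r ⊗ hyp (ρₑ :* v6) v7 (O.reflexive (R.sym x≈ρt)))
        ⊕ hyp₀ v6 0≤t ⊗ hyp (v0 :* v1) (v3 :+ v4 :+ v5 :* ρₑ) (O.reflexive Kr≈M)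
        ⊕ hyp₀ v5 0≤ℓ ⊗ hyp (ρₑ :* v6) v7 (O.reflexive (R.sym x≈ρt)))
      ≡.refl
      where
      0≤r = O.trans 0≤1 1≤r
      y  = pos (excess t x)
      v  = pos (overflow x)
      0≤t : 0# ≤ t
      0≤t = *-cancelˡ-≤ (0<num 1) (order (b ∷ t ∷ r ∷ []) (con 2 :* con 0) (con 2 :* v1)
        (hyp v2 v0 r≤b ⊕ hyp₀ v2 0≤r ⊕ hyp v0 (con 2 :* v1) b≤2t) ≡.refl)
      y² : y * y ≤ 0# * 0#
      y² = pos²≤ (order (x ∷ β ∷ t ∷ []) (v0 :- (con 1 :- con 2 :* v1) :* v2) (con 0)
        (hyp v0 ((con 1 :- con 2 :* v1) :* v2) (O.reflexive x≈ρt)) ≡.refl)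
      v² : v * v ≤ r * r
      v² = pos²≤ (order (x ∷ b ∷ r ∷ []) (v0 :- v1 :+ v2) v2 (hyp v0 v1 x≤b) ≡.refl)

-- The threshold algorithm and its competitive ratio.

module LowerBound (ℝ : CompleteOrderedField) {B : ℕ} where
  open PositivePart ℝ

  module Algorithm (I : Instance B) (sym : SymmetricPrices (Instance.D I))
    (β : Carrier) (0≤β : 0# ≤ β) (2β≤1 : num 2 * β ≤ 1#) (th : Threshold I β) where
    open Instance I
    open Distribution D
    open Threshold th

    -- The sell-off starts already at n = x + 1: a purchase there would leave x + 1 copies for x
    -- requests, and the induction needs the stock never to exceed the number of requests left.
    data Phase (n x : ℕ) : Set where
      selling  : 0 ℕ.< x → n ℕ.≤ suc x → Phase n x
      finished : x ≡ 0 → n ℕ.≤ 1 → Phase n x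
      bottom   : x ≡ 0 → suc x ℕ.< n → Phase n x
      top      : 0 ℕ.< x → B ℕ.≤ x → suc x ℕ.< n → Phase n x
      interior : 0 ℕ.< x → x ℕ.< B → suc x ℕ.< n → Phase n x

    phase : ∀ n x → Phase n x
    phase n x with n ℕ.≤? suc x
    phase n zero    | yes n≤1 = finished ≡.refl n≤1
    phase n (suc x) | yes n≤  = selling (ℕ.s≤s ℕ.z≤n) n≤
    phase n zero    | no n≰1 = bottom ≡.refl (ℕ.≰⇒> n≰1)
    phase n (suc x) | no n≰ with suc x ℕ.<? B
    ... | yes x<B = interior (ℕ.s≤s ℕ.z≤n) x<B (ℕ.≰⇒> n≰)
    ... | no  x≮B = top (ℕ.s≤s ℕ.z≤n) (ℕ.≮⇒≥ x≮B) (ℕ.≰⇒> n≰)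

    weight : ∀ {n x} → Phase n x → Fin size → Action → Carrier
    weight (selling _ _)  i buy  = 0#
    weight (selling _ _)  i sell = 1#
    weight (selling _ _)  i skip = 0#
    weight (finished _ _) i buy  = 0#
    weight (finished _ _) i sell = 0#
    weight (finished _ _) i skip = 1#
    weight (bottom _ _)     i buy  = 1# - σ i
    weight (bottom _ _)     i sell = 0#
    weight (bottom _ _)     i skip = σ i
    weight (top _ _ _)      i buy  = 0#
    weight (top _ _ _)      i sell = σ i
    weight (top _ _ _)      i skip = 1# - σ i
    weight (interior _ _ _) i buy  = 1# - σ i
    weight (interior _ _ _) i sell = σ i
    weight (interior _ _ _) i skip = 0#

    weight-nonNeg : ∀ {n x} (p : Phase n x) i a → 0# ≤ weight p i a
    weight-nonNeg (selling _ _)  i buy  = O.refl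
    weight-nonNeg (selling _ _)  i sell = 0≤1
    weight-nonNeg (selling _ _)  i skip = O.refl
    weight-nonNeg (finished _ _) i buy  = O.refl
    weight-nonNeg (finished _ _) i sell = O.refl
    weight-nonNeg (finished _ _) i skip = 0≤1
    weight-nonNeg (bottom _ _)     i buy  = x≤y⇒0≤y-x (σ≤1 i)
    weight-nonNeg (bottom _ _)     i sell = O.refl
    weight-nonNeg (bottom _ _)     i skip = 0≤σ i
    weight-nonNeg (top _ _ _)      i buy  = O.refl
    weight-nonNeg (top _ _ _)      i sell = 0≤σ i
    weight-nonNeg (top _ _ _)      i skip = x≤y⇒0≤y-x (σ≤1 i)
    weight-nonNeg (interior _ _ _) i buy  = x≤y⇒0≤y-x (σ≤1 i)
    weight-nonNeg (interior _ _ _) i sell = 0≤σ i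
    weight-nonNeg (interior _ _ _) i skip = O.refl

    weight-sum : ∀ {n x} (p : Phase n x) i → Σₐ I (weight p i) ≈ 1#
    weight-sum (selling _ _)  i = ring [] (con 0 :+ con 1 :+ con 0) (con 1) ≡.refl
    weight-sum (finished _ _) i = ring [] (con 0 :+ con 0 :+ con 1) (con 1) ≡.refl
    weight-sum (bottom _ _)     i = ring (σ i ∷ []) (con 1 :- v0 :+ con 0 :+ v0) (con 1) ≡.refl
    weight-sum (top _ _ _)      i = ring (σ i ∷ []) (con 0 :+ v0 :+ (con 1 :- v0)) (con 1) ≡.refl
    weight-sum (interior _ _ _) i = ring (σ i ∷ []) (con 1 :- v0 :+ v0 :+ con 0) (con 1) ≡.refl

    weight-feasible : ∀ {n x} (p : Phase n x) i a → ¬ Allowed B x a → weight p i a ≈ 0#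
    weight-feasible p i skip ¬⊤ = ⊥-elim (¬⊤ tt)
    weight-feasible (selling _ _)     i buy  _  = R.refl
    weight-feasible (selling 0<x _)   i sell ¬a = ⊥-elim (¬a 0<x)
    weight-feasible (finished _ _)    i buy  _  = R.refl
    weight-feasible (finished _ _)    i sell _  = R.refl
    weight-feasible (bottom ≡.refl _)   i buy  ¬a = ⊥-elim (¬a 1≤B)
    weight-feasible (bottom _ _)        i sell _  = R.refl
    weight-feasible (top _ _ _)         i buy  _  = R.refl
    weight-feasible (top 0<x _ _)       i sell ¬a = ⊥-elim (¬a 0<x)
    weight-feasible (interior _ x<B _)  i buy  ¬a = ⊥-elim (¬a x<B)
    weight-feasible (interior 0<x _ _)  i sell ¬a = ⊥-elim (¬a 0<x)

    current : (h : History I) → Phase (T ∸ length h) (stock I h)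
    current h = phase (T ∸ length h) (stock I h)

    alg : OnlineAlgorithm I
    alg = record
      { choose          = λ h → weight (current h)
      ; choose-nonNeg   = λ h → weight-nonNeg (current h)
      ; choose-sum      = λ h → weight-sum (current h)
      ; choose-feasible = λ h → weight-feasible (current h)
      }

    μ⁺ μ⁻ μ : Carrier
    μ⁺ = 𝔼₁ I λ i → σ i * (b i - level)
    μ⁻ = 𝔼₁ I λ i → (1# - σ i) * (level - b i)
    μ  = μ⁺ + μ⁻

    0≤𝔼₁ : ∀ {f} → (∀ i → 0# ≤ f i) → 0# ≤ 𝔼₁ I f
    0≤𝔼₁ 0≤f = O.≤-respˡ-≈ (𝔼₁-const I 0#) (𝔼₁-mono I 0≤f)

    0≤μ⁺ : 0# ≤ μ⁺
    0≤μ⁺ = 0≤𝔼₁ sell-above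

    0≤μ⁻ : 0# ≤ μ⁻
    0≤μ⁻ = 0≤𝔼₁ buy-below

    𝔼₁-linear : ∀ {f g} c d → 𝔼₁ I (λ i → c * f i + d * g i) ≈ c * 𝔼₁ I f + d * 𝔼₁ I g
    𝔼₁-linear {f} {g} c d = R.trans (𝔼₁-+ I (λ i → c * f i) (λ i → d * g i)) (R.+-cong (𝔼₁-* I c f) (𝔼₁-* I d g))

    𝔼[1-σ] : 𝔼₁ I (λ i → 1# - σ i) ≈ β
    𝔼[1-σ] = R.trans
      (𝔼₁-cong I λ i → ring (σ i ∷ []) (con 1 :- v0) (con 1 :* con 1 :+ (:- con 1) :* v0) ≡.refl)
      (R.trans (𝔼₁-linear 1# (- 1#))
        (R.trans (R.+-cong (R.*-congˡ (𝔼₁-const I 1#)) (R.*-congˡ 𝔼σ))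
          (ring (β ∷ []) (con 1 :* con 1 :+ (:- con 1) :* (con 1 :- v0)) v0 ≡.refl)))

    -- c and d switch the sell and the buy part of the threshold rule on or off.
    𝔼₁-payoff : ∀ c d lₛ lₜ →
      𝔼₁ I (λ i → (σ i * (c * b i + lₛ)) + (1# - σ i) * (d * b i + lₜ)) ≈
      (c * (μ⁺ + (1# - β) * level) + d * (β * level - μ⁻)) + ((1# - β) * lₛ + β * lₜ)
    𝔼₁-payoff c d lₛ lₜ = R.trans (𝔼₁-cong I λ i →
        ring (c ∷ d ∷ lₛ ∷ lₜ ∷ σ i ∷ b i ∷ level ∷ [])
          (v4 :* (v0 :* v5 :+ v2) :+ (con 1 :- v4) :* (v1 :* v5 :+ v3))
          ((v0 :* (v4 :* (v5 :- v6)) :+ (:- v1) :* ((con 1 :- v4) :* (v6 :- v5)))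
            :+ ((v0 :* v6 :+ v2) :* v4 :+ (v1 :* v6 :+ v3) :* (con 1 :- v4))) ≡.refl)
      (R.trans (𝔼₁-+ I _ _) (R.trans (R.+-cong (𝔼₁-linear c (- d)) (𝔼₁-linear (c * level + lₛ) (d * level + lₜ)))
        (R.trans (R.+-congˡ (R.+-cong (R.*-congˡ 𝔼σ) (R.*-congˡ 𝔼[1-σ])))
          (ring (c ∷ d ∷ lₛ ∷ lₜ ∷ μ⁺ ∷ μ⁻ ∷ level ∷ β ∷ [])
            ((v0 :* v4 :+ (:- v1) :* v5) :+ ((v0 :* v6 :+ v2) :* (con 1 :- v7) :+ (v1 :* v6 :+ v3) :* v7))
            ((v0 :* (v4 :+ (con 1 :- v7) :* v6) :+ v1 :* (v7 :* v6 :- v5)) :+ ((con 1 :- v7) :* v2 :+ v7 :* v3)) ≡.refl))))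

    -- Prices are nonnegative, so a purchase below `level` saves at most `level`.
    μ⁻≤βℓ : μ⁻ ≤ β * level
    μ⁻≤βℓ = O.≤-respʳ-≈ (R.trans (R.*-congˡ 𝔼[1-σ]) (R.*-comm level β))
      (O.≤-respʳ-≈ (𝔼₁-* I level (λ i → 1# - σ i)) (𝔼₁-mono I λ i →
        order (σ i ∷ level ∷ b i ∷ []) ((con 1 :- v0) :* (v1 :- v2)) (v1 :* (con 1 :- v0))
          (hyp v0 (con 1) (σ≤1 i) ⊗ hyp₀ v2 (b-nonNeg i)) ≡.refl))

    r B̂ M K : Carrier
    r = √ B
    B̂ = fromℕ B
    M = μ⁺ + μ⁻ + level * (1# - num 2 * β)
    K = M * r ⁻¹

    Kr≈M : K * r ≈ M
    Kr≈M = R.trans (ring (M ∷ r ⁻¹ ∷ r ∷ []) (v0 :* v1 :* v2) (v0 :* (v2 :* v1)) ≡.refl)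
      (R.trans (R.*-congˡ (inverseʳ (0<√ B 1≤B))) (R.*-identityʳ M))

    0≤K : 0# ≤ K
    0≤K = *-nonNeg (0≤x+y (0≤x+y 0≤μ⁺ 0≤μ⁻) (*-nonNeg 0≤level (x≤y⇒0≤y-x 2β≤1)))
      (0≤x⁻¹ (0<√ B 1≤B))

    1≤r : 1# ≤ r
    1≤r = 1≤√ B 1≤B

    r≤B̂ : r ≤ B̂
    r≤B̂ = O.≤-respʳ-≈ (√-square B 1≤B)
      (order (r ∷ []) v0 (v0 :* v0) (hyp₀ v0 (O.trans 0≤1 1≤r) ⊗ hyp (con 1) v0 1≤r) ≡.refl)

    open Potential K r B̂ β μ⁺ μ⁻ level 0≤K 1≤r r≤B̂ 0≤β 2β≤1 0≤μ⁺ 0≤μ⁻ 0≤level μ⁻≤βℓ Kr≈M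

    value : ∀ n → History I → Carrier
    value = valueFrom I alg

    continue : (lₛ lₜ lₖ : Carrier) → Action → Carrier
    continue lₛ lₜ lₖ sell = lₛ
    continue lₛ lₜ lₖ buy  = lₜ
    continue lₛ lₜ lₖ skip = lₖ

    step : ∀ {n x} (p : Phase n x) (lₛ lₜ lₖ : Carrier) → Carrier
    step p lₛ lₜ lₖ = 𝔼₁ I λ i → Σₐ I λ a → weight p i a * (gain I i a + continue lₛ lₜ lₖ a)

    -- The phases differ only in c and d. Above the level, c = 1 sells and c = 0 skips; below it, d
    -- = -1 buys, d = 0 skips and d = 1 sells as well.
    step-eq : ∀ {n x} (p : Phase n x) c d {lₛ lₜ lₖ} mₛ mₜ →
      (∀ i → weight p i buy * (- b i + lₜ) + weight p i sell * (b i + lₛ) + weight p i skip * (0# + lₖ) ≈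
             σ i * (c * b i + mₛ) + (1# - σ i) * (d * b i + mₜ)) →
      step p lₛ lₜ lₖ ≈ (c * meanSale + d * meanPurchase) + ((1# - β) * mₛ + β * mₜ)
    step-eq p c d mₛ mₜ eq = R.trans
      (𝔼₁-cong I λ i → R.trans (R.+-congʳ (R.+-congˡ (R.*-congˡ (R.+-congʳ (R.sym (sym i)))))) (eq i))
      (𝔼₁-payoff c d mₛ mₜ)

    -- The phase `p` is tied to `current h` only through its weights, so that callers can match on
    -- it while the algorithm keeps computing its own phase.
    value-step : ∀ n h {m x} (p : Phase m x) (lₛ lₜ lₖ : Carrier) →
      (∀ i a → weight (current h) i a ≡ weight p i a) →
      (∀ i a → weight p i a ≈ 0# ⊎ continue lₛ lₜ lₖ a ≤ value n ((i , a) ∷ h)) →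
      step p lₛ lₜ lₖ ≤ value (suc n) h
    value-step n h p lₛ lₜ lₖ w≡ l≤ = O.≤-respˡ-≈
      (𝔼₁-cong I λ i → Σₐ-cong I λ a → R.*-congʳ {gain I i a + continue lₛ lₜ lₖ a} (R.reflexive (w≡ i a)))
      (valueFrom-lower I alg n h (λ _ → continue lₛ lₜ lₖ) λ i a → transport i a (l≤ i a))
      where
      transport : ∀ i a → weight p i a ≈ 0# ⊎ continue lₛ lₜ lₖ a ≤ value n ((i , a) ∷ h) →
                  weight (current h) i a ≈ 0# ⊎ continue lₛ lₜ lₖ a ≤ value n ((i , a) ∷ h)
      transport i a (inj₁ w≈0) = inj₁ (R.trans (R.reflexive (w≡ i a)) w≈0)
      transport i a (inj₂ l≤v) = inj₂ l≤v

    -- The mean price, `meanSale` + `meanPurchase`.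
    mean : Carrier
    mean = μ⁺ - μ⁻ + level

    next-time : ∀ {n} {m : ℕ} → suc n ℕ.+ m ≡ T → n ℕ.+ suc m ≡ T
    next-time {n} {m} eq = ≡.trans (ℕ.+-suc n m) eq

    remaining : ∀ {n m} → n ℕ.+ m ≡ T → T ∸ m ≡ n
    remaining {n} {m} eq = ≡.trans (≡.cong (_∸ m) (≡.sym eq)) (ℕ.m+n∸n≡m n m)

    mutual
      sell-out-value : ∀ n h → n ℕ.+ length h ≡ T → stock I h ℕ.≤ n → n ℕ.≤ suc (stock I h) →
                       fromℕ (stock I h) * mean ≤ value n h
      sell-out-value zero h t x≤n _ = O.reflexive
        (R.trans (R.*-congʳ (R.reflexive (≡.cong fromℕ (ℕ.n≤0⇒n≡0 x≤n)))) (R.zeroˡ mean))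
      sell-out-value (suc n) h t x≤n n≤ =
        sell-out-step n h (current h) t (remaining t) ≡.refl x≤n n≤ (λ _ _ → ≡.refl)

      sell-out-step : ∀ n h {m x} (p : Phase m x) → suc n ℕ.+ length h ≡ T → m ≡ suc n → stock I h ≡ x →
        x ℕ.≤ suc n → suc n ℕ.≤ suc x → (∀ i a → weight (current h) i a ≡ weight p i a) →
        fromℕ x * mean ≤ value (suc n) h
      sell-out-step n h {x = suc x} p@(selling _ _) t ≡.refl eq x≤n n≤ w≡ = O.≤-respˡ-≈
        (R.trans (step-eq p 1# 1# l l λ i →
            ring (b i ∷ σ i ∷ l ∷ [])
              (con 0 :* (:- v0 :+ con 0) :+ con 1 :* (v0 :+ v2) :+ con 0 :* (con 0 :+ con 0))
              (v1 :* (con 1 :* v0 :+ v2) :+ (con 1 :- v1) :* (con 1 :* v0 :+ v2)) ≡.refl)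
          (ring (μ⁺ ∷ μ⁻ ∷ level ∷ β ∷ fromℕ x ∷ [])
            ((con 1 :* (v0 :+ (con 1 :- v3) :* v2) :+ con 1 :* (v3 :* v2 :- v1))
              :+ ((con 1 :- v3) :* (v4 :* (v0 :- v1 :+ v2)) :+ v3 :* (v4 :* (v0 :- v1 :+ v2))))
            ((con 1 :+ v4) :* (v0 :- v1 :+ v2)) ≡.refl))
        (value-step n h p l 0# 0# w≡ λ
          { i buy  → inj₁ R.refl
          ; i sell → inj₂ (≡.subst (λ y → fromℕ y * mean ≤ value n ((i , sell) ∷ h)) (≡.cong ℕ.pred eq)
              (sell-out-value n ((i , sell) ∷ h) (next-time t)
                (≡.subst (ℕ._≤ n) (≡.sym (≡.cong ℕ.pred eq)) (ℕ.≤-pred x≤n))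
                (≡.subst (λ y → n ℕ.≤ suc y) (≡.sym (≡.cong ℕ.pred eq)) (ℕ.≤-pred n≤))))
          ; i skip → inj₁ R.refl })
        where
        l : Carrier
        l = fromℕ x * mean
      sell-out-step n h p@(finished ≡.refl n≤1) t ≡.refl eq x≤n n≤ w≡ = O.≤-respˡ-≈
        (R.trans (step-eq p 0# 0# l l λ i →
            ring (b i ∷ σ i ∷ l ∷ [])
              (con 0 :* (:- v0 :+ con 0) :+ con 0 :* (v0 :+ con 0) :+ con 1 :* (con 0 :+ v2))
              (v1 :* (con 0 :* v0 :+ v2) :+ (con 1 :- v1) :* (con 0 :* v0 :+ v2)) ≡.refl)
          (ring (meanSale ∷ meanPurchase ∷ β ∷ mean ∷ [])
            ((con 0 :* v0 :+ con 0 :* v1) :+ ((con 1 :- v2) :* (con 0 :* v3) :+ v2 :* (con 0 :* v3)))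
            (con 0 :* v3) ≡.refl))
        (value-step n h p 0# 0# l w≡ λ
          { i buy  → inj₁ R.refl
          ; i sell → inj₁ R.refl
          ; i skip → inj₂ (≡.subst (λ y → fromℕ y * mean ≤ value n ((i , skip) ∷ h)) eq
              (sell-out-value n ((i , skip) ∷ h) (next-time t)
                (≡.subst (ℕ._≤ n) (≡.sym eq) ℕ.z≤n)
                (≡.subst (λ y → n ℕ.≤ suc y) (≡.sym eq) (ℕ.≤-trans (ℕ.≤-pred n≤1) ℕ.z≤n)))) })
        where
        l : Carrier
        l = 0# * mean
      sell-out-step n h (bottom _ lt)     t ≡.refl eq x≤n n≤ w≡ = ⊥-elim (ℕ.<⇒≱ lt n≤)
      sell-out-step n h (top _ _ lt)      t ≡.refl eq x≤n n≤ w≡ = ⊥-elim (ℕ.<⇒≱ lt n≤)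
      sell-out-step n h (interior _ _ lt) t ≡.refl eq x≤n n≤ w≡ = ⊥-elim (ℕ.<⇒≱ lt n≤)

    mutual
      value-lower : ∀ n h → n ℕ.+ length h ≡ T → stock I h ℕ.≤ n → stock I h ℕ.≤ B →
                    Φ (fromℕ n) (fromℕ (stock I h)) ≤ value n h
      value-lower n h t x≤n x≤B with n ℕ.≤? suc (stock I h)
      ... | yes n≤ = O.trans
        (sell-out (fromℕ n) (fromℕ (stock I h)) (0≤fromℕ (stock I h)) (fromℕ-mono x≤n) (fromℕ-mono n≤))
        (sell-out-value n h t x≤n n≤)
      value-lower zero    h t x≤n x≤B | no n≰ = ⊥-elim (n≰ ℕ.z≤n)
      value-lower (suc n) h t x≤n x≤B | no n≰ =
        lower-step n h (current h) t (remaining t) ≡.refl (ℕ.≰⇒> n≰) x≤B (λ _ _ → ≡.refl)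

      continue-lower : ∀ n h i a {y} → suc n ℕ.+ length h ≡ T → next (stock I h) a ≡ y →
        y ℕ.≤ n → y ℕ.≤ B → Φ (fromℕ n) (fromℕ y) ≤ value n ((i , a) ∷ h)
      continue-lower n h i a t ≡.refl y≤n y≤B = value-lower n ((i , a) ∷ h) (next-time t) y≤n y≤B

      lower-step : ∀ n h {m x} (p : Phase m x) → suc n ℕ.+ length h ≡ T → m ≡ suc n → stock I h ≡ x →
        suc x ℕ.< suc n → x ℕ.≤ B → (∀ i a → weight (current h) i a ≡ weight p i a) →
        Φ (fromℕ (suc n)) (fromℕ x) ≤ value (suc n) h
      lower-step n h (selling _ n≤)  t ≡.refl eq lt x≤B w≡ = ⊥-elim (ℕ.<⇒≱ lt n≤)
      lower-step n h (finished ≡.refl n≤) t ≡.refl eq lt x≤B w≡ = ⊥-elim (ℕ.<⇒≱ lt n≤)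
      lower-step n h p@(bottom ≡.refl _) t ≡.refl eq lt x≤B w≡ = O.trans
        (bottom-step (fromℕ n) (0≤fromℕ n))
        (O.≤-respˡ-≈ (R.trans (step-eq p 0# (- 1#) lₖ lₜ λ i →
            ring (b i ∷ σ i ∷ lₜ ∷ lₖ ∷ [])
              ((con 1 :- v1) :* (:- v0 :+ v2) :+ con 0 :* (v0 :+ con 0) :+ v1 :* (con 0 :+ v3))
              (v1 :* (con 0 :* v0 :+ v3) :+ (con 1 :- v1) :* (:- con 1 :* v0 :+ v2)) ≡.refl)
          (ring (meanSale ∷ meanPurchase ∷ β ∷ lₖ ∷ lₜ ∷ [])
            ((con 0 :* v0 :+ (:- con 1) :* v1) :+ ((con 1 :- v2) :* v3 :+ v2 :* v4))
            ((:- v1) :+ ((con 1 :- v2) :* v3 :+ v2 :* v4)) ≡.refl))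
          (value-step n h p 0# lₜ lₖ w≡ λ
            { i buy  → inj₂ (continue-lower n h i buy t (≡.cong suc eq) (ℕ.≤-pred lt) 1≤B)
            ; i sell → inj₁ R.refl
            ; i skip → inj₂ (continue-lower n h i skip t eq ℕ.z≤n ℕ.z≤n) }))
        where
        lₜ lₖ : Carrier
        lₜ = Φ (fromℕ n) (1# + 0#)
        lₖ = Φ (fromℕ n) 0#
      lower-step n h {x = suc x} p@(top _ B≤x _) t ≡.refl eq lt x≤B w≡ = O.trans
        (top-step (fromℕ n) (fromℕ x) (fromℕ-mono B≤x))
        (O.≤-respˡ-≈ (R.trans (step-eq p 1# 0# lₛ lₖ λ i →
            ring (b i ∷ σ i ∷ lₛ ∷ lₖ ∷ [])
              (con 0 :* (:- v0 :+ con 0) :+ v1 :* (v0 :+ v2) :+ (con 1 :- v1) :* (con 0 :+ v3))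
              (v1 :* (con 1 :* v0 :+ v2) :+ (con 1 :- v1) :* (con 0 :* v0 :+ v3)) ≡.refl)
          (ring (meanSale ∷ meanPurchase ∷ β ∷ lₛ ∷ lₖ ∷ [])
            ((con 1 :* v0 :+ con 0 :* v1) :+ ((con 1 :- v2) :* v3 :+ v2 :* v4))
            (v0 :+ ((con 1 :- v2) :* v3 :+ v2 :* v4)) ≡.refl))
          (value-step n h p lₛ 0# lₖ w≡ λ
            { i buy  → inj₁ R.refl
            ; i sell → inj₂ (continue-lower n h i sell t (≡.cong ℕ.pred eq)
                (ℕ.≤-trans (ℕ.n≤1+n x) (ℕ.<⇒≤ (ℕ.≤-pred lt))) (ℕ.<⇒≤ x≤B))
            ; i skip → inj₂ (continue-lower n h i skip t eq (ℕ.<⇒≤ (ℕ.≤-pred lt)) x≤B) }))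
        where
        lₛ lₖ : Carrier
        lₛ = Φ (fromℕ n) (fromℕ x)
        lₖ = Φ (fromℕ n) (1# + fromℕ x)
      lower-step n h {x = suc x} p@(interior _ x<B _) t ≡.refl eq lt x≤B w≡ = O.trans
        (interior-step (fromℕ n) (fromℕ x))
        (O.≤-respˡ-≈ (R.trans (step-eq p 1# (- 1#) lₛ lₜ λ i →
            ring (b i ∷ σ i ∷ lₛ ∷ lₜ ∷ [])
              ((con 1 :- v1) :* (:- v0 :+ v3) :+ v1 :* (v0 :+ v2) :+ con 0 :* (con 0 :+ con 0))
              (v1 :* (con 1 :* v0 :+ v2) :+ (con 1 :- v1) :* (:- con 1 :* v0 :+ v3)) ≡.refl)
          (ring (meanSale ∷ meanPurchase ∷ β ∷ lₛ ∷ lₜ ∷ [])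
            ((con 1 :* v0 :+ (:- con 1) :* v1) :+ ((con 1 :- v2) :* v3 :+ v2 :* v4))
            ((v0 :- v1) :+ ((con 1 :- v2) :* v3 :+ v2 :* v4)) ≡.refl))
          (value-step n h p lₛ lₜ 0# w≡ λ
            { i buy  → inj₂ (continue-lower n h i buy t (≡.cong suc eq) (ℕ.≤-pred lt) x<B)
            ; i sell → inj₂ (continue-lower n h i sell t (≡.cong ℕ.pred eq)
                (ℕ.≤-trans (ℕ.n≤1+n x) (ℕ.<⇒≤ (ℕ.≤-pred lt))) (ℕ.<⇒≤ x≤B))
            ; i skip → inj₁ R.refl }))
        where
        lₛ lₜ : Carrier
        lₛ = Φ (fromℕ n) (fromℕ x)
        lₜ = Φ (fromℕ n) (1# + (1# + fromℕ x))

    -- By `sell-above` and `buy-below` each summand is |b i - level|; in this form its mean is μ⁺ +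
    -- μ⁻ by linearity.
    spread : ∀ {n} → Vec (Fin size) n → Carrier
    spread []      = 0#
    spread (i ∷ ω) = (σ i * (b i - level) + (1# - σ i) * (level - b i)) + spread ω

    𝔼-spread : ∀ n → 𝔼 I n spread ≈ fromℕ n * μ
    𝔼-spread zero    = R.sym (R.zeroˡ μ)
    𝔼-spread (suc n) = R.trans (𝔼₁-cong I λ i → R.trans (𝔼-+ I n (λ _ → t i) spread)
        (R.+-cong (𝔼-const I n (t i)) (𝔼-spread n)))
      (R.trans (𝔼₁-+ I t (λ _ → fromℕ n * μ))
        (R.trans (R.+-cong (𝔼₁-+ I (λ i → σ i * (b i - level)) (λ i → (1# - σ i) * (level - b i))) (𝔼₁-const I _))
          (ring (μ⁺ ∷ μ⁻ ∷ fromℕ n ∷ []) ((v0 :+ v1) :+ v2 :* (v0 :+ v1)) ((con 1 :+ v2) :* (v0 :+ v1)) ≡.refl)))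
      where
      t : Fin size → Carrier
      t i = σ i * (b i - level) + (1# - σ i) * (level - b i)

    profit-upper : ∀ {n} x (ω : Vec (Fin size) n) as → Feasible B x as →
                   profit I ω as ≤ spread ω + level * fromℕ x
    profit-upper x [] [] _ = order (level ∷ fromℕ x ∷ []) (con 0) (con 0 :+ v0 :* v1)
      (hyp₀ v0 0≤level ⊗ hyp₀ v1 (0≤fromℕ x)) ≡.refl
    profit-upper x (i ∷ ω) (buy ∷ as) (_ , f) = order
      (b i ∷ σ i ∷ level ∷ fromℕ x ∷ profit I ω as ∷ spread ω ∷ [])
      (:- v0 :+ v4) ((v1 :* (v0 :- v2) :+ (con 1 :- v1) :* (v2 :- v0)) :+ v5 :+ v2 :* v3)
      (hyp v4 (v5 :+ v2 :* (con 1 :+ v3)) (profit-upper (suc x) ω as f)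
        ⊕ lit 2 ⊗ hyp₀ (v1 :* (v0 :- v2)) (sell-above i)) ≡.refl
    profit-upper (suc x) (i ∷ ω) (sell ∷ as) (_ , f) = order
      (b i ∷ σ i ∷ level ∷ fromℕ x ∷ profit I ω as ∷ spread ω ∷ s i ∷ [])
      (v6 :+ v4) ((v1 :* (v0 :- v2) :+ (con 1 :- v1) :* (v2 :- v0)) :+ v5 :+ v2 :* (con 1 :+ v3))
      (hyp v4 (v5 :+ v2 :* v3) (profit-upper x ω as f)
        ⊕ hyp v6 v0 (O.reflexive (R.sym (sym i)))
        ⊕ lit 2 ⊗ hyp₀ ((con 1 :- v1) :* (v2 :- v0)) (buy-below i)) ≡.refl
    profit-upper x (i ∷ ω) (skip ∷ as) (_ , f) = order
      (b i ∷ σ i ∷ level ∷ fromℕ x ∷ profit I ω as ∷ spread ω ∷ [])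
      (con 0 :+ v4) ((v1 :* (v0 :- v2) :+ (con 1 :- v1) :* (v2 :- v0)) :+ v5 :+ v2 :* v3)
      (hyp v4 (v5 :+ v2 :* v3) (profit-upper x ω as f)
        ⊕ hyp₀ (v1 :* (v0 :- v2)) (sell-above i)
        ⊕ hyp₀ ((con 1 :- v1) :* (v2 :- v0)) (buy-below i)) ≡.refl

    0≤spread : ∀ {n} (ω : Vec (Fin size) n) → 0# ≤ spread ω
    0≤spread []      = O.refl
    0≤spread (i ∷ ω) = 0≤x+y (0≤x+y (sell-above i) (buy-below i)) (0≤spread ω)

    OPT-upper : OPT I ≤ fromℕ T * μ + level * fromℕ B₀
    OPT-upper = O.≤-respʳ-≈
      (R.trans (𝔼-+ I T spread (λ _ → level * fromℕ B₀)) (R.+-cong (𝔼-spread T) (𝔼-const I T _)))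
      (𝔼-mono I T λ ω → offlineProfit-upper I ω
        (0≤x+y (0≤spread ω) (*-nonNeg 0≤level (0≤fromℕ B₀)))
        (λ as → profit-upper B₀ ω as))

    module _ (ρT≈B₀ : (1# - num 2 * β) * fromℕ T ≈ fromℕ B₀) where
      private
        t = fromℕ T
        U = t * M

        B̂≤2t : B̂ ≤ num 2 * t
        B̂≤2t = O.trans (fromℕ-mono (ℕ.≤-trans B≤B₀+T (ℕ.+-monoˡ-≤ T B₀≤T)))
          (O.reflexive (R.trans (fromℕ-+ T T) (ring (t ∷ []) (v0 :+ v0) (con 2 :* v0) ≡.refl)))

        OPT≤U : OPT I ≤ U
        OPT≤U = O.≤-respʳ-≈
          (R.trans (R.+-congˡ (R.*-congˡ (R.sym ρT≈B₀)))
            (ring (t ∷ μ⁺ ∷ μ⁻ ∷ level ∷ β ∷ []) (v0 :* (v1 :+ v2) :+ v3 :* ((con 1 :- con 2 :* v4) :* v0))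
              (v0 :* (v1 :+ v2 :+ v3 :* (con 1 :- con 2 :* v4))) ≡.refl))
          OPT-upper

      competitive : ∀ c → 0# ≤ c → num 18 * r ⁻¹ ≤ 1# - c → c * OPT I ≤ expectedProfit I alg
      competitive c 0≤c 18/r≤1-c = O.trans
        (order (c ∷ OPT I ∷ t ∷ M ∷ r ⁻¹ ∷ [])
          (v0 :* v1) (v2 :* v3 :- con 18 :* ((v3 :* v4) :* v2))
          (hyp₀ v0 0≤c ⊗ hyp v1 (v2 :* v3) OPT≤U
            ⊕ hyp (con 18 :* v4) (con 1 :- v0) 18/r≤1-c ⊗ hyp₀ v2 (0≤fromℕ T) ⊗ hyp₀ v3 0≤M) ≡.refl)
        (O.trans
          (O.≤-respˡ-≈ (R.+-congʳ (R.*-congˡ Kr≈M))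
            (start t (fromℕ B₀) (R.sym ρT≈B₀) (fromℕ-mono B₀≤B) (√-square B 1≤B) B̂≤2t))
          (value-lower T [] (ℕ.+-identityʳ T) B₀≤T B₀≤B))
        where
        0≤M : 0# ≤ M
        0≤M = 0≤x+y (0≤x+y 0≤μ⁺ 0≤μ⁻) (*-nonNeg 0≤level (x≤y⇒0≤y-x 2β≤1))

  module Drift (I : Instance B) (1≤B₀ : 1 ℕ.≤ Instance.B₀ I) where
    open Instance I

    T̂ B̂₀ ρ β : Carrier
    T̂  = fromℕ T
    B̂₀ = fromℕ B₀
    ρ  = B̂₀ * T̂ ⁻¹
    β  = ½ * (1# - ρ)

    0<T̂ : 0# < T̂
    0<T̂ = 0<fromℕ (ℕ.≤-trans 1≤B₀ B₀≤T)

    2β≈1-ρ : num 2 * β ≈ 1# - ρ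
    2β≈1-ρ = R.trans (R.sym (R.*-assoc _ _ _)) (R.trans (R.*-congʳ 2*½) (R.*-identityˡ _))

    ρT≈B₀ : ρ * T̂ ≈ B̂₀
    ρT≈B₀ = R.trans (ring (B̂₀ ∷ T̂ ∷ T̂ ⁻¹ ∷ []) (v0 :* v2 :* v1) (v0 :* (v1 :* v2)) ≡.refl)
      (R.trans (R.*-congˡ (inverseʳ 0<T̂)) (R.*-identityʳ B̂₀))

    0≤ρ : 0# ≤ ρ
    0≤ρ = *-nonNeg (0≤fromℕ B₀) (0≤x⁻¹ 0<T̂)

    ρ≤1 : ρ ≤ 1#
    ρ≤1 = *-cancelˡ-≤ 0<T̂ (O.≤-respˡ-≈ (R.trans (R.sym ρT≈B₀) (R.*-comm ρ T̂))
      (O.≤-respʳ-≈ (R.sym (R.*-identityʳ T̂)) (fromℕ-mono B₀≤T)))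

    0≤β : 0# ≤ β
    0≤β = *-nonNeg (0≤x⁻¹ (0<num 1)) (x≤y⇒0≤y-x ρ≤1)

    2β≤1 : num 2 * β ≤ 1#
    2β≤1 = O.≤-respˡ-≈ (R.sym 2β≈1-ρ) (order (ρ ∷ []) (con 1 :- v0) (con 1) (hyp₀ v0 0≤ρ) ≡.refl)

    β≤1 : β ≤ 1#
    β≤1 = order (β ∷ []) v0 (con 1) (hyp (con 2 :* v0) (con 1) 2β≤1 ⊕ hyp₀ v0 0≤β) ≡.refl

    driftT≈B₀ : (1# - num 2 * β) * T̂ ≈ B̂₀
    driftT≈B₀ = R.trans (R.*-congʳ (R.trans (R.+-congˡ (R.-‿cong 2β≈1-ρ))
      (ring (ρ ∷ []) (con 1 :- (con 1 :- v0)) v0 ≡.refl))) ρT≈B₀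

  competitive-algorithm : .{{_ : ℕ.NonZero B}} → 2 ℕ.≤ B → (I : Instance B) →
    SymmetricPrices (Instance.D I) → 1 ℕ.≤ Instance.B₀ I →
    Σ[ A ∈ OnlineAlgorithm I ] (1# - num 18 * (log₂ B * (√ B) ⁻¹)) * OPT I ≤ expectedProfit I A
  competitive-algorithm 2≤B I sym 1≤B₀ with O.total (1# - num 18 * (log₂ B * (√ B) ⁻¹)) 0#
  -- `competitive` multiplies the bound on `OPT I` by the factor and so needs it nonnegative; for a
  -- nonpositive factor, doing nothing is enough.
  ... | inj₁ c≤0 = idle I , O.trans
    (order (1# - num 18 * (log₂ B * (√ B) ⁻¹) ∷ OPT I ∷ []) (v0 :* v1) (con 0)
      (hyp v0 (con 0) c≤0 ⊗ hyp₀ v1 (0≤OPT I)) ≡.refl) (0≤idle I)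
  ... | inj₂ 0≤c = alg , competitive driftT≈B₀ (1# - num 18 * (log₂ B * (√ B) ⁻¹)) 0≤c
    (order (log₂ B ∷ (√ B) ⁻¹ ∷ []) (con 18 :* v1) (con 1 :- (con 1 :- con 18 :* (v0 :* v1)))
      (lit 18 ⊗ hyp (con 1) v0 (1≤log₂ B 2≤B) ⊗ hyp₀ v1 (0≤x⁻¹ (0<√ B (Instance.1≤B I)))) ≡.refl)
    where
    open Drift I 1≤B₀
    open Algorithm I sym β 0≤β 2β≤1 (threshold I 0≤β β≤1)

-- Request counts, plans and the reflected stock.

-- Requests are named by their price 0, 1 or 2.
bump : Fin 3 → Fin 3 → ℕ → ℕ
bump 0F 0F k = suc k
bump 1F 1F k = suc k
bump 2F 2F k = suc k
bump _  _  k = k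

-- The accumulator carries the count of the past, so that conditioning on the next request just
-- replaces k by its bumped value.
count : ∀ {n} → Fin 3 → ℕ → Vec (Fin 3) n → ℕ
count c k []      = k
count c k (i ∷ ω) = count c (bump c i k) ω

bump-+ : ∀ c i k l → bump c i (k ℕ.+ l) ≡ k ℕ.+ bump c i l
bump-+ 0F 0F k l = ≡.sym (ℕ.+-suc k l)
bump-+ 1F 1F k l = ≡.sym (ℕ.+-suc k l)
bump-+ 2F 2F k l = ≡.sym (ℕ.+-suc k l)
bump-+ 0F 1F k l = ≡.refl
bump-+ 0F 2F k l = ≡.refl
bump-+ 1F 0F k l = ≡.refl
bump-+ 1F 2F k l = ≡.refl
bump-+ 2F 0F k l = ≡.refl
bump-+ 2F 1F k l = ≡.refl

count-+ : ∀ {n} c k l (ω : Vec (Fin 3) n) → count c (k ℕ.+ l) ω ≡ k ℕ.+ count c l ω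
count-+ c k l []      = ≡.refl
count-+ c k l (i ∷ ω) = ≡.trans (≡.cong (λ m → count c m ω) (bump-+ c i k l)) (count-+ c k (bump c i l) ω)

count-total : ∀ {n} k₀ k₁ k₂ (ω : Vec (Fin 3) n) →
  count 0F k₀ ω ℕ.+ count 1F k₁ ω ℕ.+ count 2F k₂ ω ≡ k₀ ℕ.+ k₁ ℕ.+ k₂ ℕ.+ n
count-total k₀ k₁ k₂ []       = ≡.sym (ℕ.+-identityʳ _)
count-total {suc n} k₀ k₁ k₂ (0F ∷ ω) = ≡.trans (count-total (suc k₀) k₁ k₂ ω)
  (≡.sym (ℕ.+-suc (k₀ ℕ.+ k₁ ℕ.+ k₂) n))
count-total {suc n} k₀ k₁ k₂ (1F ∷ ω) = ≡.trans (count-total k₀ (suc k₁) k₂ ω)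
  (≡.trans (≡.cong (λ m → m ℕ.+ k₂ ℕ.+ n) (ℕ.+-suc k₀ k₁)) (≡.sym (ℕ.+-suc (k₀ ℕ.+ k₁ ℕ.+ k₂) n)))
count-total {suc n} k₀ k₁ k₂ (2F ∷ ω) = ≡.trans (count-total k₀ k₁ (suc k₂) ω)
  (≡.trans (≡.cong (ℕ._+ n) (ℕ.+-suc (k₀ ℕ.+ k₁) k₂)) (≡.sym (ℕ.+-suc (k₀ ℕ.+ k₁ ℕ.+ k₂) n)))

finalStock : ∀ {n} → ℕ → Vec Action n → ℕ
finalStock x []       = x
finalStock x (a ∷ as) = finalStock (next x a) as

-- Plans ignore the stock, which makes their profit a function of the counts alone. Execution
-- repairs them by skipping sales from an empty stock, and `blocked` measures the damage.
execute : ∀ {n} → ℕ → Vec Action n → Vec Action n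
execute x       []          = []
execute x       (buy  ∷ as) = buy ∷ execute (suc x) as
execute zero    (sell ∷ as) = skip ∷ execute zero as
execute (suc x) (sell ∷ as) = sell ∷ execute x as
execute x       (skip ∷ as) = skip ∷ execute x as

blocked : ∀ {n} → ℕ → Vec Action n → ℕ
blocked x       []          = 0
blocked x       (buy  ∷ as) = blocked (suc x) as
blocked zero    (sell ∷ as) = suc (blocked zero as)
blocked (suc x) (sell ∷ as) = blocked x as
blocked x       (skip ∷ as) = blocked x as

purchases sales : ∀ {n} → Vec Action n → ℕ
purchases []          = 0
purchases (buy  ∷ as) = suc (purchases as)
purchases (sell ∷ as) = purchases as
purchases (skip ∷ as) = purchases as
sales []          = 0
sales (buy  ∷ as) = sales as
sales (sell ∷ as) = suc (sales as)
sales (skip ∷ as) = sales as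

execute-feasible : ∀ {B} x {n} (as : Vec Action n) → x ℕ.+ n ℕ.≤ B → Feasible B x (execute x as)
execute-feasible x [] _ = tt
execute-feasible x {suc n} (buy ∷ as) le =
  ℕ.≤-trans (ℕ.≤-trans (ℕ.s≤s (ℕ.m≤m+n x n)) (ℕ.≤-reflexive (≡.sym (ℕ.+-suc x n)))) le ,
  execute-feasible (suc x) as (ℕ.≤-trans (ℕ.≤-reflexive (≡.sym (ℕ.+-suc x n))) le)
execute-feasible zero    (sell ∷ as) le = tt , execute-feasible zero as (ℕ.<⇒≤ le)
execute-feasible (suc x) {suc n} (sell ∷ as) le = ℕ.s≤s ℕ.z≤n ,
  execute-feasible x as (ℕ.≤-trans (ℕ.+-mono-≤ (ℕ.n≤1+n x) (ℕ.n≤1+n n)) le)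
execute-feasible x {suc n} (skip ∷ as) le = tt ,
  execute-feasible x as (ℕ.≤-trans (ℕ.+-monoʳ-≤ x (ℕ.n≤1+n n)) le)

stock-balance : ∀ x {n} (as : Vec Action n) →
  finalStock x as ℕ.+ sales as ≡ x ℕ.+ purchases as ℕ.+ blocked x as
stock-balance x [] = ≡.sym (ℕ.+-identityʳ _)
stock-balance x (buy ∷ as) = ≡.trans (stock-balance (suc x) as)
  (≡.cong (ℕ._+ blocked (suc x) as) (≡.sym (ℕ.+-suc x (purchases as))))
stock-balance zero (sell ∷ as) = ≡.trans (ℕ.+-suc (finalStock zero as) (sales as))
  (≡.trans (≡.cong suc (stock-balance zero as)) (≡.sym (ℕ.+-suc (purchases as) (blocked zero as))))
stock-balance (suc x) (sell ∷ as) = ≡.trans (ℕ.+-suc (finalStock x as) (sales as))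
  (≡.cong suc (stock-balance x as))
stock-balance x (skip ∷ as) = stock-balance x as

next-mono : ∀ {x y} a → x ℕ.≤ y → next x a ℕ.≤ next y a
next-mono buy  x≤y = ℕ.s≤s x≤y
next-mono sell x≤y = ℕ.pred-mono-≤ x≤y
next-mono skip x≤y = x≤y

finalStock-mono : ∀ {x y n} (as : Vec Action n) → x ℕ.≤ y → finalStock x as ℕ.≤ finalStock y as
finalStock-mono []       x≤y = x≤y
finalStock-mono (a ∷ as) x≤y = finalStock-mono as (next-mono a x≤y)

-- Reflection: a path that has been blocked has merged with the one from 0.
finalStock-reflect : ∀ x {n} (as : Vec Action n) →
  finalStock x as ℕ.≤ (x ℕ.+ purchases as ∸ sales as) ℕ.⊔ finalStock 0 as
finalStock-reflect x [] = ℕ.≤-trans (ℕ.≤-reflexive (≡.sym (ℕ.+-identityʳ x))) (ℕ.m≤m⊔n _ 0)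
finalStock-reflect x (buy ∷ as) = ℕ.≤-trans (finalStock-reflect (suc x) as)
  (ℕ.⊔-mono-≤ (ℕ.≤-reflexive (≡.cong (_∸ sales as) (≡.sym (ℕ.+-suc x (purchases as)))))
    (finalStock-mono as ℕ.z≤n))
finalStock-reflect zero    (sell ∷ as) = ℕ.m≤n⊔m _ _
finalStock-reflect (suc x) (sell ∷ as) = finalStock-reflect x as
finalStock-reflect x       (skip ∷ as) = finalStock-reflect x as

finalStock-scarce : ∀ x {n} (as : Vec Action n) → x ℕ.+ purchases as ℕ.≤ sales as →
                    finalStock x as ℕ.≤ finalStock 0 as
finalStock-scarce x as le = ℕ.≤-trans (finalStock-reflect x as)
  (ℕ.≤-reflexive (≡.cong (ℕ._⊔ finalStock 0 as) (ℕ.m≤n⇒m∸n≡0 le)))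

-- By `stock-balance` the blocked sales are the final stock minus the surplus d = x + purchases -
-- sales. By reflection the final stock is at most the maximum of d and the final stock from 0,
-- hence at most their sum.
blocked-abundant : ∀ x {n} (as : Vec Action n) → sales as ℕ.≤ x ℕ.+ purchases as →
                   blocked x as ℕ.≤ finalStock 0 as
blocked-abundant x as le = ℕ.+-cancelˡ-≤ (x ℕ.+ purchases as) _ _ (begin
  x ℕ.+ purchases as ℕ.+ blocked x as    ≡⟨ stock-balance x as ⟨
  finalStock x as ℕ.+ sales as           ≤⟨ ℕ.+-monoˡ-≤ (sales as) (finalStock-reflect x as) ⟩
  (d ℕ.⊔ finalStock 0 as) ℕ.+ sales as   ≤⟨ ℕ.+-monoˡ-≤ (sales as) (ℕ.m⊔n≤m+n d (finalStock 0 as)) ⟩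
  (d ℕ.+ finalStock 0 as) ℕ.+ sales as   ≡⟨ ℕ.+-assoc d (finalStock 0 as) (sales as) ⟩
  d ℕ.+ (finalStock 0 as ℕ.+ sales as)   ≡⟨ ≡.cong (d ℕ.+_) (ℕ.+-comm (finalStock 0 as) (sales as)) ⟩
  d ℕ.+ (sales as ℕ.+ finalStock 0 as)   ≡⟨ ℕ.+-assoc d (sales as) (finalStock 0 as) ⟨
  (d ℕ.+ sales as) ℕ.+ finalStock 0 as   ≡⟨ ≡.cong (ℕ._+ finalStock 0 as) (ℕ.m∸n+n≡m le) ⟩
  x ℕ.+ purchases as ℕ.+ finalStock 0 as ∎)
  where
  open ℕ.≤-Reasoning
  d = x ℕ.+ purchases as ∸ sales as

-- The hindsight optimum up to blocked sales. All requests of price 1 count alike, so the number j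
-- of them to trade describes it.
plan : ∀ {n} → Action → ℕ → Vec (Fin 3) n → Vec Action n
plan a j       []       = []
plan a j       (0F ∷ ω) = buy ∷ plan a j ω
plan a j       (2F ∷ ω) = sell ∷ plan a j ω
plan a zero    (1F ∷ ω) = skip ∷ plan a zero ω
plan a (suc j) (1F ∷ ω) = a ∷ plan a j ω

-- The j of the optimal plan depends on all of ω, so the stock of that plan is no Markov chain. This
-- walk is one, and it dominates the stock of every plan.
hoard : ∀ {n} → ℕ → Vec (Fin 3) n → ℕ
hoard x []       = x
hoard x (0F ∷ ω) = hoard (suc x) ω
hoard x (1F ∷ ω) = hoard (suc x) ω
hoard x (2F ∷ ω) = hoard (ℕ.pred x) ω

next≤suc : ∀ {x y} a → x ℕ.≤ y → next x a ℕ.≤ suc y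
next≤suc buy  x≤y = ℕ.s≤s x≤y
next≤suc sell x≤y = ℕ.≤-trans (ℕ.pred[n]≤n) (ℕ.m≤n⇒m≤1+n x≤y)
next≤suc skip x≤y = ℕ.m≤n⇒m≤1+n x≤y

plan≤hoard : ∀ {n x y} a j (ω : Vec (Fin 3) n) → x ℕ.≤ y → finalStock x (plan a j ω) ℕ.≤ hoard y ω
plan≤hoard a j       []       x≤y = x≤y
plan≤hoard a j       (0F ∷ ω) x≤y = plan≤hoard a j ω (ℕ.s≤s x≤y)
plan≤hoard a zero    (1F ∷ ω) x≤y = plan≤hoard a zero ω (ℕ.m≤n⇒m≤1+n x≤y)
plan≤hoard a (suc j) (1F ∷ ω) x≤y = plan≤hoard a j ω (next≤suc a x≤y)
plan≤hoard a j       (2F ∷ ω) x≤y = plan≤hoard a j ω (ℕ.pred-mono-≤ x≤y)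

module _ {n : ℕ} where
  N₀ N₁ N₂ : Vec (Fin 3) n → ℕ
  N₀ = count 0F 0
  N₁ = count 1F 0
  N₂ = count 2F 0

plan-buy-purchases : ∀ {n} j (ω : Vec (Fin 3) n) → j ℕ.≤ N₁ ω → purchases (plan buy j ω) ≡ N₀ ω ℕ.+ j
plan-buy-purchases zero [] _ = ≡.refl
plan-buy-purchases j (0F ∷ ω) j≤ = ≡.trans (≡.cong suc (plan-buy-purchases j ω j≤))
  (≡.cong (ℕ._+ j) (≡.sym (count-+ 0F 1 0 ω)))
plan-buy-purchases zero (1F ∷ ω) _ = plan-buy-purchases zero ω ℕ.z≤n
plan-buy-purchases (suc j) (1F ∷ ω) j≤ = ≡.trans
  (≡.cong suc (plan-buy-purchases j ω (ℕ.≤-pred (ℕ.≤-trans j≤ (ℕ.≤-reflexive (count-+ 1F 1 0 ω))))))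
  (≡.sym (ℕ.+-suc (N₀ ω) j))
plan-buy-purchases j (2F ∷ ω) j≤ = plan-buy-purchases j ω j≤

plan-buy-sales : ∀ {n} j (ω : Vec (Fin 3) n) → sales (plan buy j ω) ≡ N₂ ω
plan-buy-sales j       []       = ≡.refl
plan-buy-sales j       (0F ∷ ω) = plan-buy-sales j ω
plan-buy-sales zero    (1F ∷ ω) = plan-buy-sales zero ω
plan-buy-sales (suc j) (1F ∷ ω) = plan-buy-sales j ω
plan-buy-sales j       (2F ∷ ω) = ≡.trans (≡.cong suc (plan-buy-sales j ω)) (≡.sym (count-+ 2F 1 0 ω))

plan-sell-purchases : ∀ {n} j (ω : Vec (Fin 3) n) → purchases (plan sell j ω) ≡ N₀ ω
plan-sell-purchases j       []       = ≡.refl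
plan-sell-purchases j       (0F ∷ ω) = ≡.trans (≡.cong suc (plan-sell-purchases j ω)) (≡.sym (count-+ 0F 1 0 ω))
plan-sell-purchases zero    (1F ∷ ω) = plan-sell-purchases zero ω
plan-sell-purchases (suc j) (1F ∷ ω) = plan-sell-purchases j ω
plan-sell-purchases j       (2F ∷ ω) = plan-sell-purchases j ω

plan-sell-sales : ∀ {n} j (ω : Vec (Fin 3) n) → j ℕ.≤ N₁ ω → sales (plan sell j ω) ≡ N₂ ω ℕ.+ j
plan-sell-sales zero [] _ = ≡.refl
plan-sell-sales j (0F ∷ ω) j≤ = plan-sell-sales j ω j≤
plan-sell-sales zero (1F ∷ ω) _ = plan-sell-sales zero ω ℕ.z≤n
plan-sell-sales (suc j) (1F ∷ ω) j≤ = ≡.trans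
  (≡.cong suc (plan-sell-sales j ω (ℕ.≤-pred (ℕ.≤-trans j≤ (ℕ.≤-reflexive (count-+ 1F 1 0 ω))))))
  (≡.sym (ℕ.+-suc (N₂ ω) j))
plan-sell-sales j (2F ∷ ω) j≤ = ≡.trans (≡.cong suc (plan-sell-sales j ω j≤))
  (≡.cong (ℕ._+ j) (≡.sym (count-+ 2F 1 0 ω)))

distance : Fin 3 → Fin 3 → ℕ
distance l i = ℕ.∣ toℕ l - toℕ i ∣

-- The market with three prices and its duality gap.

module Market (ℝ : CompleteOrderedField) where
  open Expectation ℝ public

  price : Fin 3 → Carrier
  price i = num (toℕ i)

  module ThreePrices (p p′ : Carrier) (0<p : 0# < p) (0<p′ : 0# < p′) (0<ε : 0# < 1# - p - p′) where
    weight : Fin 3 → Carrier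
    weight 0F = p′
    weight 1F = 1# - p - p′
    weight 2F = p

    private
      0≉1 : ¬ (0# ≈ 1#)
      0≉1 eq = 1≉0 (R.sym eq)

      1≉2 : ¬ (1# ≈ num 2)
      1≉2 eq = 0≉1 (R.trans (R.sym (R.-‿inverseʳ 1#))
        (R.trans (R.+-congʳ eq) (ring [] (con 2 :- con 1) (con 1) ≡.refl)))

      price-injective : ∀ i j → price i ≈ price j → i ≡ j
      price-injective 0F 0F _  = ≡.refl
      price-injective 1F 1F _  = ≡.refl
      price-injective 2F 2F _  = ≡.refl
      price-injective 0F 1F eq = ⊥-elim (0≉1 eq)
      price-injective 1F 0F eq = ⊥-elim (1≉0 eq)
      price-injective 0F 2F eq = ⊥-elim (proj₂ (0<num 1) eq)
      price-injective 2F 0F eq = ⊥-elim (proj₂ (0<num 1) (R.sym eq))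
      price-injective 1F 2F eq = ⊥-elim (1≉2 eq)
      price-injective 2F 1F eq = ⊥-elim (1≉2 (R.sym eq))

    distribution : Distribution
    distribution = record
      { size     = 3
      ; b        = price
      ; s        = price
      ; prob     = weight
      ; b-nonNeg = λ i → 0≤num (toℕ i)
      ; s-nonNeg = λ i → 0≤num (toℕ i)
      ; distinct = λ i j eq _ → price-injective i j eq
      ; prob-pos = λ { 0F → 0<p′ ; 1F → 0<ε ; 2F → 0<p }
      ; prob-sum = ring (p ∷ p′ ∷ []) (v1 :+ (con 1 :- v0 :- v1 :+ (v0 :+ con 0))) (con 1) ≡.refl
      }

    module Setting {B T B₀ : ℕ} (1≤B : 1 ℕ.≤ B) (B₀≤B : B₀ ℕ.≤ B) (B₀≤T : B₀ ℕ.≤ T) (B≡B₀+T : B ≡ B₀ ℕ.+ T) where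
      market : Instance B
      market = record
        { T      = T
        ; B₀     = B₀
        ; D      = distribution
        ; 1≤B    = 1≤B
        ; B₀≤B   = B₀≤B
        ; B₀≤T   = B₀≤T
        ; B≤B₀+T = ℕ.≤-reflexive B≡B₀+T
        }

      Requests : ℕ → Set
      Requests = Vec (Fin 3)

      execute-profit : ∀ {n} x (ω : Requests n) as →
        profit market ω as ≤ profit market ω (execute x as) + num 2 * fromℕ (blocked x as)
      execute-profit x [] [] = order [] (con 0) (con 0 :+ con 2 :* con 0) (lit 0) ≡.refl
      execute-profit x (i ∷ ω) (buy ∷ as) = order
        (price i ∷ profit market ω as ∷ profit market ω (execute (suc x) as) ∷ fromℕ (blocked (suc x) as) ∷ [])
        (:- v0 :+ v1) ((:- v0 :+ v2) :+ con 2 :* v3)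
        (hyp v1 (v2 :+ con 2 :* v3) (execute-profit (suc x) ω as)) ≡.refl
      execute-profit zero (i ∷ ω) (sell ∷ as) = order
        (price i ∷ profit market ω as ∷ profit market ω (execute zero as) ∷ fromℕ (blocked zero as) ∷ [])
        (v0 :+ v1) ((con 0 :+ v2) :+ con 2 :* (con 1 :+ v3))
        (hyp v1 (v2 :+ con 2 :* v3) (execute-profit zero ω as) ⊕ hyp v0 (con 2) (price≤2 i)) ≡.refl
        where
        price≤2 : ∀ i → price i ≤ num 2
        price≤2 0F = 0≤num 2
        price≤2 1F = order [] (con 1) (con 2) (lit 1) ≡.refl
        price≤2 2F = O.refl
      execute-profit (suc x) (i ∷ ω) (sell ∷ as) = order
        (price i ∷ profit market ω as ∷ profit market ω (execute x as) ∷ fromℕ (blocked x as) ∷ [])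
        (v0 :+ v1) ((v0 :+ v2) :+ con 2 :* v3)
        (hyp v1 (v2 :+ con 2 :* v3) (execute-profit x ω as)) ≡.refl
      execute-profit x (i ∷ ω) (skip ∷ as) = order
        (price i ∷ profit market ω as ∷ profit market ω (execute x as) ∷ fromℕ (blocked x as) ∷ [])
        (con 0 :+ v1) ((con 0 :+ v2) :+ con 2 :* v3)
        (hyp v1 (v2 :+ con 2 :* v3) (execute-profit x ω as)) ≡.refl

      fromℕ-count-suc : ∀ {n} c (ω : Requests n) → fromℕ (count c 1 ω) ≈ 1# + fromℕ (count c 0 ω)
      fromℕ-count-suc c ω = R.reflexive (≡.cong fromℕ (count-+ c 1 0 ω))

      plan-buy-profit : ∀ {n} j (ω : Requests n) → j ℕ.≤ N₁ ω →
        profit market ω (plan buy j ω) ≈ num 2 * fromℕ (N₂ ω) - fromℕ j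
      plan-buy-profit zero [] _ = ring [] (con 0) (con 2 :* con 0 :- con 0) ≡.refl
      plan-buy-profit j (0F ∷ ω) j≤ = R.trans
        (ring (profit market ω (plan buy j ω) ∷ []) (:- con 0 :+ v0) v0 ≡.refl) (plan-buy-profit j ω j≤)
      plan-buy-profit zero (1F ∷ ω) _ = R.trans (R.+-identityˡ _) (plan-buy-profit zero ω ℕ.z≤n)
      plan-buy-profit (suc j) (1F ∷ ω) j≤ = R.trans
        (R.+-congˡ (plan-buy-profit j ω (ℕ.≤-pred (ℕ.≤-trans j≤ (ℕ.≤-reflexive (count-+ 1F 1 0 ω))))))
        (ring (fromℕ (N₂ ω) ∷ fromℕ j ∷ []) (:- con 1 :+ (con 2 :* v0 :- v1)) (con 2 :* v0 :- (con 1 :+ v1)) ≡.refl)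
      plan-buy-profit j (2F ∷ ω) j≤ = R.trans (R.+-congˡ (plan-buy-profit j ω j≤)) (R.trans
        (ring (fromℕ (N₂ ω) ∷ fromℕ j ∷ []) (con 2 :+ (con 2 :* v0 :- v1)) (con 2 :* (con 1 :+ v0) :- v1) ≡.refl)
        (R.+-congʳ (R.*-congˡ (R.sym (fromℕ-count-suc 2F ω)))))

      plan-sell-profit : ∀ {n} j (ω : Requests n) → j ℕ.≤ N₁ ω →
        profit market ω (plan sell j ω) ≈ num 2 * fromℕ (N₂ ω) + fromℕ j
      plan-sell-profit zero [] _ = ring [] (con 0) (con 2 :* con 0 :+ con 0) ≡.refl
      plan-sell-profit j (0F ∷ ω) j≤ = R.trans
        (ring (profit market ω (plan sell j ω) ∷ []) (:- con 0 :+ v0) v0 ≡.refl) (plan-sell-profit j ω j≤)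
      plan-sell-profit zero (1F ∷ ω) _ = R.trans (R.+-identityˡ _) (plan-sell-profit zero ω ℕ.z≤n)
      plan-sell-profit (suc j) (1F ∷ ω) j≤ = R.trans
        (R.+-congˡ (plan-sell-profit j ω (ℕ.≤-pred (ℕ.≤-trans j≤ (ℕ.≤-reflexive (count-+ 1F 1 0 ω))))))
        (ring (fromℕ (N₂ ω) ∷ fromℕ j ∷ []) (con 1 :+ (con 2 :* v0 :+ v1)) (con 2 :* v0 :+ (con 1 :+ v1)) ≡.refl)
      plan-sell-profit j (2F ∷ ω) j≤ = R.trans (R.+-congˡ (plan-sell-profit j ω j≤)) (R.trans
        (ring (fromℕ (N₂ ω) ∷ fromℕ j ∷ []) (con 2 :+ (con 2 :* v0 :+ v1)) (con 2 :* (con 1 :+ v0) :+ v1) ≡.refl)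
        (R.+-congʳ (R.*-congˡ (R.sym (fromℕ-count-suc 2F ω)))))

      -- For a constant multiplier l, dual l x ω bounds the profit from stock x.
      deviation : ∀ {n} → Fin 3 → Requests n → Carrier
      deviation l []      = 0#
      deviation l (i ∷ ω) = num (distance l i) + deviation l ω

      dual : ∀ {n} → Fin 3 → ℕ → Requests n → Carrier
      dual l x ω = deviation l ω + num (toℕ l) * fromℕ x

      deviation-0 : ∀ {n} (ω : Requests n) → deviation 0F ω ≈ fromℕ (N₁ ω) + num 2 * fromℕ (N₂ ω)
      deviation-0 [] = ring [] (con 0) (con 0 :+ con 2 :* con 0) ≡.refl
      deviation-0 (0F ∷ ω) = R.trans (R.+-identityˡ _) (deviation-0 ω)
      deviation-0 (1F ∷ ω) = R.trans (R.+-congˡ (deviation-0 ω)) (R.trans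
        (R.sym (R.+-assoc _ _ _)) (R.+-congʳ (R.sym (fromℕ-count-suc 1F ω))))
      deviation-0 (2F ∷ ω) = R.trans (R.+-congˡ (deviation-0 ω)) (R.trans
        (ring (fromℕ (N₁ ω) ∷ fromℕ (N₂ ω) ∷ []) (con 2 :+ (v0 :+ con 2 :* v1)) (v0 :+ con 2 :* (con 1 :+ v1)) ≡.refl)
        (R.+-congˡ (R.*-congˡ (R.sym (fromℕ-count-suc 2F ω)))))

      deviation-1 : ∀ {n} (ω : Requests n) → deviation 1F ω ≈ fromℕ (N₀ ω) + fromℕ (N₂ ω)
      deviation-1 [] = R.sym (R.+-identityˡ 0#)
      deviation-1 (0F ∷ ω) = R.trans (R.+-congˡ (deviation-1 ω)) (R.trans
        (R.sym (R.+-assoc _ _ _)) (R.+-congʳ (R.sym (fromℕ-count-suc 0F ω))))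
      deviation-1 (1F ∷ ω) = R.trans (R.+-identityˡ _) (deviation-1 ω)
      deviation-1 (2F ∷ ω) = R.trans (R.+-congˡ (deviation-1 ω)) (R.trans
        (ring (fromℕ (N₀ ω) ∷ fromℕ (N₂ ω) ∷ []) (con 1 :+ (v0 :+ v1)) (v0 :+ (con 1 :+ v1)) ≡.refl)
        (R.+-congˡ (R.sym (fromℕ-count-suc 2F ω))))

      deviation-2 : ∀ {n} (ω : Requests n) → deviation 2F ω ≈ fromℕ (N₁ ω) + num 2 * fromℕ (N₀ ω)
      deviation-2 [] = ring [] (con 0) (con 0 :+ con 2 :* con 0) ≡.refl
      deviation-2 (0F ∷ ω) = R.trans (R.+-congˡ (deviation-2 ω)) (R.trans
        (ring (fromℕ (N₁ ω) ∷ fromℕ (N₀ ω) ∷ []) (con 2 :+ (v0 :+ con 2 :* v1)) (v0 :+ con 2 :* (con 1 :+ v1)) ≡.refl)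
        (R.+-congˡ (R.*-congˡ (R.sym (fromℕ-count-suc 0F ω)))))
      deviation-2 (1F ∷ ω) = R.trans (R.+-congˡ (deviation-2 ω)) (R.trans
        (R.sym (R.+-assoc _ _ _)) (R.+-congʳ (R.sym (fromℕ-count-suc 1F ω))))
      deviation-2 (2F ∷ ω) = R.trans (R.+-identityˡ _) (deviation-2 ω)

      -- Complementary slackness between the price level l and a plan.
      data Balanced {n} (x : ℕ) (ω : Requests n) : Fin 3 → Set where
        abundant : N₂ ω ℕ.+ N₁ ω ℕ.≤ x ℕ.+ N₀ ω → Balanced x ω 0F
        balanced : N₂ ω ℕ.≤ x ℕ.+ N₀ ω ℕ.+ N₁ ω → x ℕ.+ N₀ ω ℕ.≤ N₂ ω ℕ.+ N₁ ω → Balanced x ω 1F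
        scarce   : x ℕ.+ N₀ ω ℕ.+ N₁ ω ℕ.≤ N₂ ω → Balanced x ω 2F

      private
        hoarded : ∀ {n} → Requests n → Carrier
        hoarded ω = fromℕ (hoard 0 ω)

        blocked≤ : ∀ {n} a j x (ω : Requests n) → sales (plan a j ω) ℕ.≤ x ℕ.+ purchases (plan a j ω) →
                   fromℕ (blocked x (plan a j ω)) ≤ hoarded ω
        blocked≤ a j x ω le = fromℕ-mono (ℕ.≤-trans (blocked-abundant x (plan a j ω) le) (plan≤hoard a j ω ℕ.z≤n))

      -- The plan sells at all requests of price 1 at level 0, buys at all of them at level 2, and
      -- at level 1 trades just enough for the initial stock and purchases to equal the sales. The
      -- gap consists of blocked sales or, at level 2, of unsold copies, each worth at most 2;
      -- either number is at most the hoarded stock.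
      dual-attained : ∀ {n} x (ω : Requests n) {l} → Balanced x ω l →
        Σ[ as ∈ Vec Action n ] dual l x ω ≤ profit market ω (execute x as) + num 2 * fromℕ (hoard 0 ω)
      dual-attained x ω (abundant le) = as , O.≤-respˡ-≈
          (R.trans (R.sym (deviation-0 ω)) (ring (deviation 0F ω ∷ fromℕ x ∷ []) v0 (v0 :+ con 0 :* v1) ≡.refl))
          (order (fromℕ (N₁ ω) ∷ fromℕ (N₂ ω) ∷ profit market ω as ∷ profit market ω (execute x as)
              ∷ fromℕ (blocked x as) ∷ hoarded ω ∷ [])
            (v0 :+ con 2 :* v1) (v3 :+ con 2 :* v5)
            (hyp (con 2 :* v1 :+ v0) v2 (O.reflexive (R.sym (plan-sell-profit (N₁ ω) ω ℕ.≤-refl)))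
              ⊕ hyp v2 (v3 :+ con 2 :* v4) (execute-profit x ω as)
              ⊕ lit 2 ⊗ hyp v4 v5 (blocked≤ sell (N₁ ω) x ω le′)) ≡.refl)
        where
        as = plan sell (N₁ ω) ω
        le′ : sales as ℕ.≤ x ℕ.+ purchases as
        le′ = ≡.subst₂ ℕ._≤_ (≡.sym (plan-sell-sales (N₁ ω) ω ℕ.≤-refl))
          (≡.cong (x ℕ.+_) (≡.sym (plan-sell-purchases (N₁ ω) ω))) le
      dual-attained x ω (scarce le) = as , O.≤-respˡ-≈ (R.+-congʳ (R.sym (deviation-2 ω)))
          (order (fromℕ (N₀ ω) ∷ fromℕ (N₁ ω) ∷ fromℕ (N₂ ω) ∷ profit market ω as ∷ profit market ω (execute x as)
              ∷ fromℕ (blocked x as) ∷ hoarded ω ∷ fromℕ x ∷ fromℕ (finalStock x as) ∷ [])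
            (v1 :+ con 2 :* v0 :+ con 2 :* v7) (v4 :+ con 2 :* v6)
            (hyp (con 2 :* v2 :- v1) v3 (O.reflexive (R.sym (plan-buy-profit (N₁ ω) ω ℕ.≤-refl)))
              ⊕ hyp v3 (v4 :+ con 2 :* v5) (execute-profit x ω as)
              ⊕ lit 2 ⊗ hyp (v7 :+ (v0 :+ v1) :+ v5) (v8 :+ v2) (O.reflexive (R.sym balance))
              ⊕ lit 2 ⊗ hyp v8 v6 (fromℕ-mono (ℕ.≤-trans (finalStock-scarce x as le′) (plan≤hoard buy (N₁ ω) ω ℕ.z≤n)))) ≡.refl)
        where
        as = plan buy (N₁ ω) ω
        le′ : x ℕ.+ purchases as ℕ.≤ sales as
        le′ = ≡.subst₂ ℕ._≤_
          (≡.trans (ℕ.+-assoc x (N₀ ω) (N₁ ω)) (≡.cong (x ℕ.+_) (≡.sym (plan-buy-purchases (N₁ ω) ω ℕ.≤-refl))))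
          (≡.sym (plan-buy-sales (N₁ ω) ω)) le
        balance : fromℕ (finalStock x as) + fromℕ (N₂ ω) ≈ fromℕ x + (fromℕ (N₀ ω) + fromℕ (N₁ ω)) + fromℕ (blocked x as)
        balance = R.trans (R.sym (fromℕ-+ (finalStock x as) (N₂ ω))) (R.trans
          (R.reflexive (≡.cong fromℕ (≡.subst₂ (λ u v → finalStock x as ℕ.+ u ≡ x ℕ.+ v ℕ.+ blocked x as)
            (plan-buy-sales (N₁ ω) ω) (plan-buy-purchases (N₁ ω) ω ℕ.≤-refl) (stock-balance x as))))
          (R.trans (fromℕ-+ (x ℕ.+ (N₀ ω ℕ.+ N₁ ω)) (blocked x as)) (R.+-congʳ
            (R.trans (fromℕ-+ x _) (R.+-congˡ (fromℕ-+ (N₀ ω) (N₁ ω)))))))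
      dual-attained x ω (balanced le ge) with ℕ.≤-total (x ℕ.+ N₀ ω) (N₂ ω)
      ... | inj₁ short = as , O.≤-respˡ-≈ (R.+-congʳ (R.sym (deviation-1 ω)))
          (order (fromℕ (N₀ ω) ∷ fromℕ j ∷ fromℕ (N₂ ω) ∷ profit market ω as ∷ profit market ω (execute x as)
              ∷ fromℕ (blocked x as) ∷ hoarded ω ∷ fromℕ x ∷ [])
            (v0 :+ v2 :+ con 1 :* v7) (v4 :+ con 2 :* v6)
            (hyp (con 2 :* v2 :- v1) v3 (O.reflexive (R.sym (plan-buy-profit j ω j≤)))
              ⊕ hyp v3 (v4 :+ con 2 :* v5) (execute-profit x ω as)
              ⊕ hyp (v1 :+ (v7 :+ v0)) v2 (O.reflexive j+x+N₀)
              ⊕ lit 2 ⊗ hyp v5 v6 (blocked≤ buy j x ω le′)) ≡.refl)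
        where
        j = N₂ ω ∸ (x ℕ.+ N₀ ω)
        as = plan buy j ω
        j≤ : j ℕ.≤ N₁ ω
        j≤ = ℕ.m≤n+o⇒m∸n≤o (N₂ ω) (x ℕ.+ N₀ ω) le
        exact : x ℕ.+ (N₀ ω ℕ.+ j) ≡ N₂ ω
        exact = ≡.trans (≡.sym (ℕ.+-assoc x (N₀ ω) j)) (ℕ.m+[n∸m]≡n short)
        le′ : sales as ℕ.≤ x ℕ.+ purchases as
        le′ = ℕ.≤-reflexive (≡.trans (plan-buy-sales j ω)
          (≡.trans (≡.sym exact) (≡.cong (x ℕ.+_) (≡.sym (plan-buy-purchases j ω j≤)))))
        j+x+N₀ : fromℕ j + (fromℕ x + fromℕ (N₀ ω)) ≈ fromℕ (N₂ ω)
        j+x+N₀ = R.trans (R.+-congˡ (R.sym (fromℕ-+ x (N₀ ω)))) (R.trans (R.sym (fromℕ-+ j _))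
          (R.reflexive (≡.cong fromℕ (ℕ.m∸n+n≡m short))))
      ... | inj₂ long = as , O.≤-respˡ-≈ (R.+-congʳ (R.sym (deviation-1 ω)))
          (order (fromℕ (N₀ ω) ∷ fromℕ j ∷ fromℕ (N₂ ω) ∷ profit market ω as ∷ profit market ω (execute x as)
              ∷ fromℕ (blocked x as) ∷ hoarded ω ∷ fromℕ x ∷ [])
            (v0 :+ v2 :+ con 1 :* v7) (v4 :+ con 2 :* v6)
            (hyp (con 2 :* v2 :+ v1) v3 (O.reflexive (R.sym (plan-sell-profit j ω j≤)))
              ⊕ hyp v3 (v4 :+ con 2 :* v5) (execute-profit x ω as)
              ⊕ hyp (v7 :+ v0) (v1 :+ v2) (O.reflexive (R.sym j+N₂))
              ⊕ lit 2 ⊗ hyp v5 v6 (blocked≤ sell j x ω le′)) ≡.refl)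
        where
        j = x ℕ.+ N₀ ω ∸ N₂ ω
        as = plan sell j ω
        j≤ : j ℕ.≤ N₁ ω
        j≤ = ℕ.m≤n+o⇒m∸n≤o (x ℕ.+ N₀ ω) (N₂ ω) ge
        le′ : sales as ℕ.≤ x ℕ.+ purchases as
        le′ = ℕ.≤-reflexive (≡.trans (plan-sell-sales j ω j≤)
          (≡.trans (ℕ.m+[n∸m]≡n long) (≡.cong (x ℕ.+_) (≡.sym (plan-sell-purchases j ω)))))
        j+N₂ : fromℕ j + fromℕ (N₂ ω) ≈ fromℕ x + fromℕ (N₀ ω)
        j+N₂ = R.trans (R.sym (fromℕ-+ j (N₂ ω))) (R.trans (R.reflexive (≡.cong fromℕ (ℕ.m∸n+n≡m long)))
          (fromℕ-+ x (N₀ ω)))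

      dual≤offline : (ω : Requests T) {l : Fin 3} → Balanced B₀ ω l →
        dual l B₀ ω ≤ offlineProfit market ω + num 2 * fromℕ (hoard 0 ω)
      dual≤offline ω bal = O.trans (proj₂ attained) (+-mono-≤
        (offlineProfit-lower market ω (execute B₀ (proj₁ attained))
          (execute-feasible B₀ (proj₁ attained) (ℕ.≤-reflexive (≡.sym B≡B₀+T))))
        O.refl)
        where
        attained = dual-attained B₀ ω bal

-- The hoarding walk and the probability of extreme counts.

module Fluctuations (ℝ : CompleteOrderedField) where
  open Market ℝ public

  module Walk (p p′ : Carrier) (0<p : 0# < p) (0<p′ : 0# < p′) (0<ε : 0# < 1# - p - p′)
    {B T B₀ : ℕ} (1≤B : 1 ℕ.≤ B) (B₀≤B : B₀ ℕ.≤ B) (B₀≤T : B₀ ℕ.≤ T) (B≡B₀+T : B ≡ B₀ ℕ.+ T) where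
    open ThreePrices p p′ 0<p 0<p′ 0<ε public
    open Setting 1≤B B₀≤B B₀≤T B≡B₀+T public

    private
      0≤p  = proj₁ 0<p
      0≤p′ = proj₁ 0<p′
      0≤ε  = proj₁ 0<ε

    module _ (7/10≤p : num 7 ≤ num 10 * p) where
      private
        2^ : ℕ → Carrier
        2^ zero    = 1#
        2^ (suc x) = num 2 * 2^ x

        1≤2^ : ∀ x → 1# ≤ 2^ x
        1≤2^ zero    = O.refl
        1≤2^ (suc x) = order (2^ x ∷ []) (con 1) (con 2 :* v0) (lit 2 ⊗ hyp (con 1) v0 (1≤2^ x) ⊕ lit 1) ≡.refl

        fromℕ≤2^ : ∀ x → fromℕ x ≤ 2^ x
        fromℕ≤2^ zero    = 0≤1
        fromℕ≤2^ (suc x) = order (fromℕ x ∷ 2^ x ∷ []) (con 1 :+ v0) (con 2 :* v1)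
          (hyp v0 v1 (fromℕ≤2^ x) ⊕ hyp (con 1) v1 (1≤2^ x)) ≡.refl

        -- As p ≥ 7/10, a step from a positive stock multiplies the mean of 2^stock by 2 - 3 p / 2 ≤
        -- 19/20 = 1 - h.
        h : Carrier
        h = num 20 ⁻¹

        0≤h : 0# ≤ h
        0≤h = 0≤x⁻¹ (0<num 19)

        20h≈1 : num 20 * h ≈ 1#
        20h≈1 = inverseʳ (0<num 19)

        14h≤p : num 14 * h ≤ p
        14h≤p = *-cancelˡ-≤ (0<num 9) (order (h ∷ p ∷ []) (con 10 :* (con 14 :* v0)) (con 10 :* v1)
          (hyp (con 7) (con 10 :* v1) 7/10≤p ⊕ lit 7 ⊗ hyp (con 20 :* v0) (con 1) (O.reflexive 20h≈1)) ≡.refl)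

        c : ℕ → Carrier
        c zero    = 1#
        c (suc n) = c n * (1# - h)

        0≤1-h : 0# ≤ 1# - h
        0≤1-h = order (h ∷ []) (con 0) (con 1 :- v0)
          (hyp (con 20 :* v0) (con 1) (O.reflexive 20h≈1) ⊕ lit 19 ⊗ hyp₀ v0 0≤h) ≡.refl

        0≤c : ∀ n → 0# ≤ c n
        0≤c zero    = 0≤1
        0≤c (suc n) = *-nonNeg (0≤c n) 0≤1-h

        -- The n-th iterate of y ↦ (1 - h) y + 10 h. Its fixed point 10 leaves room for reflection:
        -- from stock 0 the mean is 2 - p ≤ 13/10, while the map sends 1 to 29/20.
        ceiling : ℕ → Carrier → Carrier
        ceiling n y = num 10 + c n * (y - num 10)

        -- The hoarding walk drifts down, so the mean of 2^stock contracts
        -- geometrically to a bounded value.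
        contraction : ∀ n x → 𝔼 market n (λ ω → 2^ (hoard x ω)) ≤ ceiling n (2^ x)
        contraction zero    x = order (2^ x ∷ []) v0 (con 10 :+ con 1 :* (v0 :- con 10)) (lit 0) ≡.refl
        contraction (suc n) zero = O.trans
          (𝔼₁-mono market {f = λ i → 𝔼 market n (λ ω → 2^ (hoard 0 (i ∷ ω)))} {g = bound} λ { 0F → contraction n 1 ; 1F → contraction n 1 ; 2F → contraction n 0 })
          (order (p ∷ p′ ∷ c n ∷ h ∷ [])
            (v1 :* up :+ ((con 1 :- v0 :- v1) :* up :+ (v0 :* stay :+ con 0)))
            (con 10 :+ (v2 :* (con 1 :- v3)) :* (con 1 :- con 10))
            (hyp₀ v2 (0≤c n) ⊗ (hyp (con 14 :* v3) v0 14h≤p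
              ⊕ hyp (con 1) (con 20 :* v3) (O.reflexive (R.sym 20h≈1)) ⊕ lit 3 ⊗ hyp₀ v3 0≤h)) ≡.refl)
          where
          bound : Fin 3 → Carrier
          bound 0F = ceiling n (num 2 * 1#)
          bound 1F = ceiling n (num 2 * 1#)
          bound 2F = ceiling n 1#
          up stay : Expr 4
          up   = con 10 :+ v2 :* (con 2 :* con 1 :- con 10)
          stay = con 10 :+ v2 :* (con 1 :- con 10)
        contraction (suc n) (suc x) = O.trans
          (𝔼₁-mono market {f = λ i → 𝔼 market n (λ ω → 2^ (hoard (suc x) (i ∷ ω)))} {g = bound} λ
            { 0F → contraction n (suc (suc x)) ; 1F → contraction n (suc (suc x)) ; 2F → contraction n x })
          (order (p ∷ p′ ∷ c n ∷ h ∷ 2^ x ∷ [])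
            (v1 :* up :+ ((con 1 :- v0 :- v1) :* up :+ (v0 :* down :+ con 0)))
            (con 10 :+ (v2 :* (con 1 :- v3)) :* (con 2 :* v4 :- con 10))
            (hyp₀ v2 (0≤c n) ⊗ (
              hyp₀ v4 (O.trans 0≤1 (1≤2^ x)) ⊗ (lit 3 ⊗ hyp (con 14 :* v3) v0 14h≤p
                ⊕ lit 2 ⊗ hyp (con 1) (con 20 :* v3) (O.reflexive (R.sym 20h≈1)))
              ⊕ lit 10 ⊗ hyp₀ v3 0≤h)) ≡.refl)
          where
          bound : Fin 3 → Carrier
          bound 0F = ceiling n (num 2 * (num 2 * 2^ x))
          bound 1F = ceiling n (num 2 * (num 2 * 2^ x))
          bound 2F = ceiling n (2^ x)
          up down : Expr 5
          up   = con 10 :+ v2 :* (con 2 :* (con 2 :* v4) :- con 10)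
          down = con 10 :+ v2 :* (v4 :- con 10)

      𝔼-hoard : ∀ n → 𝔼 market n (λ ω → fromℕ (hoard 0 ω)) ≤ num 10
      𝔼-hoard n = O.trans (𝔼-mono market n λ ω → fromℕ≤2^ (hoard 0 ω)) (O.trans (contraction n 0)
        (order (c n ∷ []) (con 10 :+ v0 :* (con 1 :- con 10)) (con 10) (lit 9 ⊗ hyp₀ v0 (0≤c n)) ≡.refl))

    0≤weight : ∀ i → 0# ≤ weight i
    0≤weight 0F = 0≤p′
    0≤weight 1F = 0≤ε
    0≤weight 2F = 0≤p

    weight≤1 : ∀ i → weight i ≤ 1#
    weight≤1 0F = order (p ∷ p′ ∷ []) v1 (con 1) (hyp₀ v0 0≤p ⊕ hyp₀ (con 1 :- v0 :- v1) 0≤ε) ≡.refl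
    weight≤1 1F = order (p ∷ p′ ∷ []) (con 1 :- v0 :- v1) (con 1) (hyp₀ v0 0≤p ⊕ hyp₀ v1 0≤p′) ≡.refl
    weight≤1 2F = order (p ∷ p′ ∷ []) v0 (con 1) (hyp₀ v1 0≤p′ ⊕ hyp₀ (con 1 :- v0 :- v1) 0≤ε) ≡.refl

    𝔼₁-bump : ∀ c k (f : ℕ → Carrier) →
      𝔼₁ market (λ i → f (bump c i k)) ≈ weight c * f (suc k) + (1# - weight c) * f k
    𝔼₁-bump 0F k f = ring (p ∷ p′ ∷ f (suc k) ∷ f k ∷ [])
      (v1 :* v2 :+ ((con 1 :- v0 :- v1) :* v3 :+ (v0 :* v3 :+ con 0))) (v1 :* v2 :+ (con 1 :- v1) :* v3) ≡.refl
    𝔼₁-bump 1F k f = ring (p ∷ p′ ∷ f (suc k) ∷ f k ∷ [])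
      (v1 :* v3 :+ ((con 1 :- v0 :- v1) :* v2 :+ (v0 :* v3 :+ con 0)))
      ((con 1 :- v0 :- v1) :* v2 :+ (con 1 :- (con 1 :- v0 :- v1)) :* v3) ≡.refl
    𝔼₁-bump 2F k f = ring (p ∷ p′ ∷ f (suc k) ∷ f k ∷ [])
      (v1 :* v3 :+ ((con 1 :- v0 :- v1) :* v3 :+ (v0 :* v2 :+ con 0))) (v0 :* v2 :+ (con 1 :- v0) :* v3) ≡.refl

    -- Its mean bounds the probability of a positive fluctuation from below.
    quartic : Carrier → Carrier → Carrier
    quartic s z = num 2 * (s * s * s) * z + num 2 * (s * s) * (z * z) - (z * z) * (z * z)

    -- In u = z / s this says 2 u + 2 u² - u⁴ ≤ 4. Together with `quartic≤0` it bounds `quartic s z`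
    -- by 4 s⁴ times the indicator of z > 0; the linear term is there to make the quartic
    -- nonpositive for small negative z.
    quartic≤4s⁴ : ∀ s z → quartic s z ≤ num 4 * ((s * s) * (s * s)) * 1#
    quartic≤4s⁴ s z = *-cancelˡ-≤ (0<num 3) (order (s ∷ z ∷ [])
      (con 4 :* (con 2 :* (v0 :* v0 :* v0) :* v1 :+ con 2 :* (v0 :* v0) :* (v1 :* v1) :- (v1 :* v1) :* (v1 :* v1)))
      (con 4 :* (con 4 :* ((v0 :* v0) :* (v0 :* v0)) :* con 1))
      (sq (con 2 :* (v1 :* v1) :- con 3 :* (v0 :* v0)) ⊕ lit 4 ⊗ (sq (v0 :* (v1 :- v0))) ⊕ lit 3 ⊗ sq (v0 :* v0)) ≡.refl)

    quartic≤0 : ∀ {s z} → 0# ≤ s → z ≤ 0# → quartic s z ≤ num 4 * ((s * s) * (s * s)) * 0#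
    quartic≤0 {s} {z} 0≤s z≤0 = order (s ∷ z ∷ [])
      (con 2 :* (v0 :* v0 :* v0) :* v1 :+ con 2 :* (v0 :* v0) :* (v1 :* v1) :- (v1 :* v1) :* (v1 :* v1))
      (con 4 :* ((v0 :* v0) :* (v0 :* v0)) :* con 0)
      (hyp v1 (con 0) z≤0 ⊗ (sq (con 0 :- v1 :- v0) ⊗ (hyp v1 (con 0) z≤0 ⊕ lit 2 ⊗ hyp₀ v0 0≤s)
        ⊕ sq v0 ⊗ hyp v1 (con 0) z≤0)) ≡.refl

    module Tail (c : Fin 3) (s θ : Carrier) (0≤s : 0# ≤ s) (f : ℕ → Carrier)
      (quartic≤f : ∀ k → quartic s (fromℕ k - θ) ≤ num 4 * ((s * s) * (s * s)) * f k) where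
      private
        q v : Carrier
        q = weight c
        v = q * (1# - q)

      centred : ℕ → ℕ → Carrier
      centred n k = fromℕ k + q * fromℕ n - θ

      private
        -- The mean of the quartic after n more requests, with the first two moments exact and an
        -- upper bound for the fourth. There 6 v n z² becomes 8 v n z², because the cross term with
        -- the third moment is absorbed by 4 z (1 - 2 q) ≤ 2 z² + 2.
        L : Carrier → Carrier → Carrier
        L n z = num 2 * (s * s * s) * z + num 2 * (s * s) * (z * z + n * v)
          - ((z * z) * (z * z) + num 8 * v * n * (z * z) + num 4 * (v * v) * (n * n) + num 3 * v * n)

        Lₑ : ∀ {m} → (s v n z : Expr m) → Expr m
        Lₑ s v n z = con 2 :* (s :* s :* s) :* z :+ con 2 :* (s :* s) :* (z :* z :+ n :* v)
          :- ((z :* z) :* (z :* z) :+ con 8 :* v :* n :* (z :* z) :+ con 4 :* (v :* v) :* (n :* n) :+ con 3 :* v :* n)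

      mean-quartic : ∀ n k → L (fromℕ n) (centred n k) ≤
        num 4 * ((s * s) * (s * s)) * 𝔼 market n (λ ω → f (count c k ω))
      mean-quartic zero k = O.trans
        (order (s ∷ q ∷ fromℕ k ∷ θ ∷ [])
          (Lₑ v0 (v1 :* (con 1 :- v1)) (con 0) (v2 :+ v1 :* con 0 :- v3))
          (con 2 :* (v0 :* v0 :* v0) :* (v2 :- v3) :+ con 2 :* (v0 :* v0) :* ((v2 :- v3) :* (v2 :- v3))
            :- ((v2 :- v3) :* (v2 :- v3)) :* ((v2 :- v3) :* (v2 :- v3))) (lit 0) ≡.refl)
        (quartic≤f k)
      mean-quartic (suc n) k = O.trans
        (order (s ∷ q ∷ fromℕ k ∷ θ ∷ fromℕ n ∷ [])
          (Lₑ v0 vₑ (con 1 :+ v4) (v2 :+ v1 :* (con 1 :+ v4) :- v3))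
          (v1 :* Lₑ v0 vₑ v4 (con 1 :+ v2 :+ v1 :* v4 :- v3)
            :+ (con 1 :- v1) :* Lₑ v0 vₑ v4 (v2 :+ v1 :* v4 :- v3))
          (lit 2 ⊗ hyp₀ v1 (0≤weight c) ⊗ hyp v1 (con 1) (weight≤1 c)
            ⊗ sq (v2 :+ v1 :* (con 1 :+ v4) :- v3 :- (con 1 :- con 2 :* v1))
            ⊕ lit 15 ⊗ sq vₑ) ≡.refl)
        (O.trans (O.reflexive (R.sym (𝔼₁-bump c k (λ j → L (fromℕ n) (centred n j)))))
          (O.≤-respʳ-≈ (𝔼₁-* market _ (λ i → 𝔼 market n (λ ω → f (count c (bump c i k) ω))))
            (𝔼₁-mono market λ i → mean-quartic n (bump c i k))))
        where
        vₑ : Expr 5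
        vₑ = v1 :* (con 1 :- v1)

      -- Take 64 times `mean-quartic`. Since 4 v ≤ 1 and n ≤ s², half of 2 s² n v beats 4 v² n²; the
      -- other half gives 4 s⁴. One s⁴ pays for 3 v n, by 48 ≤ s². Two more complete the square 2 s²
      -- (s + 32 z)² with the linear term, at the price of 64 · 32 s² z². The remaining terms in z
      -- cost 64 s² z² when z² ≤ s², whence 33.
      likely : num 48 ≤ s * s → 1# ≤ num 8 * (weight c * (1# - weight c)) → (∀ k → 0# ≤ f k) →
        ∀ n k → fromℕ n ≤ s * s → s * s ≤ num 2 * fromℕ n →
        s * s - num 64 * num 33 * (centred n k * centred n k) ≤
        num 64 * num 4 * (s * s) * 𝔼 market n (λ ω → f (count c k ω))
      likely 48≤s² 1≤8v 0≤f n k n≤s² s²≤2n with O.total (s * s) (centred n k * centred n k)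
      ... | inj₁ s²≤z² = order (s * s ∷ centred n k * centred n k ∷ 𝔼 market n (λ ω → f (count c k ω)) ∷ [])
        (v0 :- con 64 :* con 33 :* v1) (con 64 :* con 4 :* v0 :* v2)
        (lit 64 ⊗ lit 33 ⊗ hyp v0 v1 s²≤z² ⊕ (lit 63 ⊗ lit 33 ⊕ lit 32) ⊗ hyp₀ v0 (0≤x² s)
          ⊕ lit 64 ⊗ lit 4 ⊗ hyp₀ v0 (0≤x² s) ⊗ hyp₀ v2 0≤E) ≡.refl
        where
        0≤E : 0# ≤ 𝔼 market n (λ ω → f (count c k ω))
        0≤E = O.≤-respˡ-≈ (𝔼-const market n 0#) (𝔼-mono market n λ ω → 0≤f (count c k ω))
      ... | inj₂ z²≤s² = *-cancelˡ-≤ 0<s² (order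
        (s ∷ centred n k ∷ 𝔼 market n (λ ω → f (count c k ω)) ∷ v ∷ fromℕ n ∷ [])
        ((v0 :* v0) :* (v0 :* v0 :- con 64 :* con 33 :* (v1 :* v1)))
        ((v0 :* v0) :* (con 64 :* con 4 :* (v0 :* v0) :* v2))
        (lit 64 ⊗ hyp (Lₑ v0 v3 v4 v1) (con 4 :* ((v0 :* v0) :* (v0 :* v0)) :* v2) (mean-quartic n k)
          ⊕ lit 2 ⊗ sq (v0 :* (v0 :+ con 32 :* v1))
          ⊕ lit 64 ⊗ hyp₀ v4 (0≤fromℕ n) ⊗ hyp₀ v3 0≤v ⊗ hyp v4 (v0 :* v0) n≤s²
          ⊕ lit 64 ⊗ sq v4 ⊗ hyp₀ v3 0≤v ⊗ hyp (con 4 :* v3) (con 1) 4v≤1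
          ⊕ lit 32 ⊗ hyp₀ v3 0≤v ⊗ sq v0 ⊗ hyp (v0 :* v0) (con 2 :* v4) s²≤2n
          ⊕ lit 4 ⊗ sq (v0 :* v0) ⊗ hyp (con 1) (con 8 :* v3) 1≤8v
          ⊕ sq v0 ⊗ hyp (con 48) (v0 :* v0) 48≤s²
          ⊕ lit 48 ⊗ hyp₀ v4 (0≤fromℕ n) ⊗ hyp (con 4 :* v3) (con 1) 4v≤1
          ⊕ lit 48 ⊗ hyp v4 (v0 :* v0) n≤s²
          ⊕ lit 64 ⊗ sq v1 ⊗ hyp (v1 :* v1) (v0 :* v0) z²≤s²
          ⊕ lit 128 ⊗ hyp₀ v4 (0≤fromℕ n) ⊗ sq v1 ⊗ hyp (con 4 :* v3) (con 1) 4v≤1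
          ⊕ lit 128 ⊗ sq v1 ⊗ hyp v4 (v0 :* v0) n≤s²) ≡.refl)
        where
        0<s² : 0# < s * s
        0<s² = 0<x≤y⇒0<y (0<num 47) 48≤s²
        0≤v : 0# ≤ v
        0≤v = *-nonNeg (0≤weight c) (x≤y⇒0≤y-x (weight≤1 c))
        4v≤1 : num 4 * v ≤ 1#
        4v≤1 = order (q ∷ []) (con 4 :* (v0 :* (con 1 :- v0))) (con 1) (sq (con 1 :- con 2 :* v0)) ≡.refl

-- Regret of online algorithms against the level known in hindsight.

-- At price 1 the action a forgoes slack l 1F a relative to the best action for
-- the price level l.
slack : Fin 3 → Fin 3 → Action → ℕ
slack 0F 1F buy  = 2
slack 0F 1F skip = 1
slack 2F 1F sell = 2
slack 2F 1F skip = 1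
slack _  _  _    = 0

module UpperBound (ℝ : CompleteOrderedField) where
  open Fluctuations ℝ public

  module Online (p p′ : Carrier) (0<p : 0# < p) (0<p′ : 0# < p′) (0<ε : 0# < 1# - p - p′)
    {B T B₀ : ℕ} (1≤B : 1 ℕ.≤ B) (B₀≤B : B₀ ℕ.≤ B) (B₀≤T : B₀ ℕ.≤ T) (B≡B₀+T : B ≡ B₀ ℕ.+ T) where
    open Walk p p′ 0<p 0<p′ 0<ε 1≤B B₀≤B B₀≤T B≡B₀+T public

    -- The optimal multiplier, read off the final counts k₀ and k₂.
    level : ℕ → ℕ → Fin 3
    level k₀ k₂ with T ℕ.+ B₀ ℕ.<? k₂ ℕ.+ k₂ | T ℕ.<? k₀ ℕ.+ k₀ ℕ.+ B₀
    ... | yes _ | _     = 2F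
    ... | no _  | yes _ = 0F
    ... | no _  | no _  = 1F

    -- The three counts add up to T, so eliminating the count of price 1 turns abundance and
    -- scarcity (taken strictly) into events about a single count each, and a one-dimensional tail
    -- bound is enough.
    many₀ many₂ : ℕ → Carrier
    many₀ k = indicator (T ℕ.<? k ℕ.+ k ℕ.+ B₀)
    many₂ k = indicator (T ℕ.+ B₀ ℕ.<? k ℕ.+ k)

    levelFrom : ∀ {n} → ℕ → ℕ → Requests n → Fin 3
    levelFrom k₀ k₂ ω = level (count 0F k₀ ω) (count 2F k₂ ω)

    private
      exclusive : ∀ k₀ k₂ → k₀ ℕ.+ k₂ ℕ.≤ T → T ℕ.+ B₀ ℕ.< k₂ ℕ.+ k₂ → ¬ (T ℕ.< k₀ ℕ.+ k₀ ℕ.+ B₀)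
      exclusive k₀ k₂ le lt₂ lt₀ = ℕ.<-irrefl ≡.refl (ℕ.<-≤-trans
        (ℕ.+-mono-< lt₂ lt₀)
        (ℕ.≤-trans (ℕ.≤-reflexive (regroup k₀ k₂ B₀))
          (ℕ.≤-trans (ℕ.+-monoˡ-≤ B₀ (ℕ.+-mono-≤ le le)) (ℕ.≤-reflexive (regroup′ T B₀)))))
        where
        regroup : ∀ k₀ k₂ b → (k₂ ℕ.+ k₂) ℕ.+ (k₀ ℕ.+ k₀ ℕ.+ b) ≡ ((k₀ ℕ.+ k₂) ℕ.+ (k₀ ℕ.+ k₂)) ℕ.+ b
        regroup = solve-∀
        regroup′ : ∀ t b → (t ℕ.+ t) ℕ.+ b ≡ (t ℕ.+ b) ℕ.+ t
        regroup′ = solve-∀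

    balance : ∀ (ω : Requests T) → Balanced B₀ ω (levelFrom 0 0 ω)
    balance ω with T ℕ.+ B₀ ℕ.<? N₂ ω ℕ.+ N₂ ω | T ℕ.<? N₀ ω ℕ.+ N₀ ω ℕ.+ B₀
    ... | yes lt | _ = scarce (ℕ.+-cancelʳ-≤ (N₂ ω) _ _ (ℕ.≤-trans (ℕ.≤-reflexive
        (≡.trans (regroup (N₀ ω) (N₁ ω) (N₂ ω) B₀) (≡.cong (ℕ._+ B₀) (count-total 0 0 0 ω)))) (ℕ.<⇒≤ lt)))
      where
      regroup : ∀ a b c x → x ℕ.+ a ℕ.+ b ℕ.+ c ≡ a ℕ.+ b ℕ.+ c ℕ.+ x
      regroup = solve-∀
    ... | no _ | yes lt = abundant (ℕ.+-cancelˡ-≤ (N₀ ω) _ _ (ℕ.≤-trans (ℕ.≤-reflexive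
        (≡.trans (regroup (N₀ ω) (N₁ ω) (N₂ ω)) (count-total 0 0 0 ω)))
        (ℕ.≤-trans (ℕ.<⇒≤ lt) (ℕ.≤-reflexive (regroup′ (N₀ ω) B₀)))))
      where
      regroup : ∀ a b c → a ℕ.+ (c ℕ.+ b) ≡ a ℕ.+ b ℕ.+ c
      regroup = solve-∀
      regroup′ : ∀ a x → a ℕ.+ a ℕ.+ x ≡ a ℕ.+ (x ℕ.+ a)
      regroup′ = solve-∀
    ... | no ≮₂ | no ≮₀ = balanced
        (ℕ.+-cancelˡ-≤ (N₂ ω) _ _ (ℕ.≤-trans (ℕ.≮⇒≥ ≮₂) (ℕ.≤-reflexive
          (≡.trans (≡.cong (ℕ._+ B₀) (≡.sym (count-total 0 0 0 ω))) (regroup (N₀ ω) (N₁ ω) (N₂ ω) B₀)))))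
        (ℕ.+-cancelˡ-≤ (N₀ ω) _ _ (ℕ.≤-trans (ℕ.≤-reflexive (regroup′ (N₀ ω) B₀))
          (ℕ.≤-trans (ℕ.≮⇒≥ ≮₀) (ℕ.≤-reflexive
            (≡.trans (≡.sym (count-total 0 0 0 ω)) (regroup″ (N₀ ω) (N₁ ω) (N₂ ω)))))))
      where
      regroup : ∀ a b c x → a ℕ.+ b ℕ.+ c ℕ.+ x ≡ c ℕ.+ (x ℕ.+ a ℕ.+ b)
      regroup = solve-∀
      regroup′ : ∀ a x → a ℕ.+ (x ℕ.+ a) ≡ a ℕ.+ a ℕ.+ x
      regroup′ = solve-∀
      regroup″ : ∀ a b c → a ℕ.+ b ℕ.+ c ≡ a ℕ.+ (c ℕ.+ b)
      regroup″ = solve-∀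

    slack-indicator : ∀ k₀ k₂ a → k₀ ℕ.+ k₂ ℕ.≤ T →
      num (slack 0F 1F a) * many₀ k₀ + num (slack 2F 1F a) * many₂ k₂ ≤ num (slack (level k₀ k₂) 1F a)
    slack-indicator k₀ k₂ a le with T ℕ.+ B₀ ℕ.<? k₂ ℕ.+ k₂ | T ℕ.<? k₀ ℕ.+ k₀ ℕ.+ B₀
    ... | yes lt₂ | yes lt₀ = ⊥-elim (exclusive k₀ k₂ le lt₂ lt₀)
    ... | yes _ | no _  = order (num (slack 0F 1F a) ∷ num (slack 2F 1F a) ∷ []) (v0 :* con 0 :+ v1 :* con 1) v1 (lit 0) ≡.refl
    ... | no _  | yes _ = order (num (slack 0F 1F a) ∷ num (slack 2F 1F a) ∷ []) (v0 :* con 1 :+ v1 :* con 0) v0 (lit 0) ≡.refl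
    ... | no _  | no _  = O.trans
      (order (num (slack 0F 1F a) ∷ num (slack 2F 1F a) ∷ []) (v0 :* con 0 :+ v1 :* con 0) (con 0) (lit 0) ≡.refl)
      (0≤num (slack 1F 1F a))

    num-mono : ∀ {m n} → m ℕ.≤ n → num m ≤ num n
    num-mono {m} {n} m≤n = O.≤-respˡ-≈ (R.sym (num≈fromℕ m)) (O.≤-respʳ-≈ (R.sym (num≈fromℕ n)) (fromℕ-mono m≤n))

    num-+ : ∀ m n → num (m ℕ.+ n) ≈ num m + num n
    num-+ m n = R.trans (num≈fromℕ (m ℕ.+ n)) (R.trans (fromℕ-+ m n) (R.sym (R.+-cong (num≈fromℕ m) (num≈fromℕ n))))

    private
      le-by : ∀ {m n} d → m ℕ.+ d ≡ n → m ℕ.≤ n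
      le-by {m} d ≡.refl = ℕ.m≤m+n m d

      slack-buy : ∀ l i → toℕ l ℕ.+ slack l i buy ℕ.≤ distance l i ℕ.+ toℕ i
      slack-buy 0F 0F = le-by 0 ≡.refl
      slack-buy 0F 1F = le-by 0 ≡.refl
      slack-buy 0F 2F = le-by 4 ≡.refl
      slack-buy 1F 0F = le-by 0 ≡.refl
      slack-buy 1F 1F = le-by 0 ≡.refl
      slack-buy 1F 2F = le-by 2 ≡.refl
      slack-buy 2F 0F = le-by 0 ≡.refl
      slack-buy 2F 1F = le-by 0 ≡.refl
      slack-buy 2F 2F = le-by 0 ≡.refl

      slack-sell : ∀ l i → toℕ i ℕ.+ slack l i sell ℕ.≤ distance l i ℕ.+ toℕ l
      slack-sell 0F 0F = le-by 0 ≡.refl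
      slack-sell 0F 1F = le-by 0 ≡.refl
      slack-sell 0F 2F = le-by 0 ≡.refl
      slack-sell 1F 0F = le-by 2 ≡.refl
      slack-sell 1F 1F = le-by 0 ≡.refl
      slack-sell 1F 2F = le-by 0 ≡.refl
      slack-sell 2F 0F = le-by 4 ≡.refl
      slack-sell 2F 1F = le-by 0 ≡.refl
      slack-sell 2F 2F = le-by 0 ≡.refl

      slack-skip : ∀ l i → slack l i skip ℕ.≤ distance l i
      slack-skip 0F 0F = le-by 0 ≡.refl
      slack-skip 0F 1F = le-by 0 ≡.refl
      slack-skip 0F 2F = le-by 2 ≡.refl
      slack-skip 1F 0F = le-by 1 ≡.refl
      slack-skip 1F 1F = le-by 0 ≡.refl
      slack-skip 1F 2F = le-by 1 ≡.refl
      slack-skip 2F 0F = le-by 2 ≡.refl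
      slack-skip 2F 1F = le-by 0 ≡.refl
      slack-skip 2F 2F = le-by 0 ≡.refl

      num-≤ : ∀ m n m′ n′ → m ℕ.+ n ℕ.≤ m′ ℕ.+ n′ → num m + num n ≤ num m′ + num n′
      num-≤ m n m′ n′ le = O.≤-respˡ-≈ (num-+ m n) (O.≤-respʳ-≈ (num-+ m′ n′) (num-mono le))

    -- One step of weak duality. It holds for each fixed l, hence also for a level that depends on
    -- later requests; `slack` keeps the part of the gap that arises at price 1.
    gain≤dual : ∀ l i a {x n} (ω : Requests n) → Allowed B x a →
      (gain market i a + dual l (next x a) ω) + num (slack l i a) ≤ dual l x (i ∷ ω)
    gain≤dual l i buy {x} ω _ = order
      (price i ∷ num (toℕ l) ∷ num (slack l i buy) ∷ num (distance l i) ∷ deviation l ω ∷ fromℕ x ∷ [])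
      ((:- v0 :+ (v4 :+ v1 :* (con 1 :+ v5))) :+ v2) ((v3 :+ v4) :+ v1 :* v5)
      (hyp (v1 :+ v2) (v3 :+ v0) (num-≤ (toℕ l) (slack l i buy) (distance l i) (toℕ i) (slack-buy l i))) ≡.refl
    gain≤dual l i sell {suc x} ω _ = order
      (price i ∷ num (toℕ l) ∷ num (slack l i sell) ∷ num (distance l i) ∷ deviation l ω ∷ fromℕ x ∷ [])
      ((v0 :+ (v4 :+ v1 :* v5)) :+ v2) ((v3 :+ v4) :+ v1 :* (con 1 :+ v5))
      (hyp (v0 :+ v2) (v3 :+ v1) (num-≤ (toℕ i) (slack l i sell) (distance l i) (toℕ l) (slack-sell l i))) ≡.refl
    gain≤dual l i skip {x} ω _ = order
      (price i ∷ num (toℕ l) ∷ num (slack l i skip) ∷ num (distance l i) ∷ deviation l ω ∷ fromℕ x ∷ [])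
      ((con 0 :+ (v4 :+ v1 :* v5)) :+ v2) ((v3 :+ v4) :+ v1 :* v5)
      (hyp v2 v3 (num-mono (slack-skip l i))) ≡.refl

    dualFrom : ∀ n → ℕ → ℕ → ℕ → Carrier
    dualFrom n k₀ k₂ x = 𝔼 market n (λ ω → dual (levelFrom k₀ k₂ ω) x ω)

    0≤slack : ∀ n k₀ k₂ i a → 0# ≤ 𝔼 market n (λ ω → num (slack (levelFrom k₀ k₂ ω) i a))
    0≤slack n k₀ k₂ i a = O.≤-respˡ-≈ (𝔼-const market n 0#)
      (𝔼-mono market n λ ω → 0≤num (slack (levelFrom k₀ k₂ ω) i a))

    module _ (A : OnlineAlgorithm market) where
      open OnlineAlgorithm A

      -- The level depends on the later requests but the action does not, so the slack of each
      -- action can be averaged over the future. `w` is the regret of the present request, `e` that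
      -- of the later ones.
      step-upper : ∀ n h k₀ k₂ (e w : Fin 3 → Carrier) →
        (∀ i a → valueFrom market A n ((i , a) ∷ h) + e i ≤
                 dualFrom n (bump 0F i k₀) (bump 2F i k₂) (next (stock market h) a)) →
        (∀ i a → w i ≤ 𝔼 market n (λ ω → num (slack (levelFrom (bump 0F i k₀) (bump 2F i k₂) ω) i a))) →
        valueFrom market A (suc n) h + 𝔼₁ market (λ i → e i + w i) ≤ dualFrom (suc n) k₀ k₂ (stock market h)
      step-upper n h k₀ k₂ e w ih bonus = O.trans
        (+-mono-≤ (valueFrom-upper market A n h u bound) O.refl)
        (O.reflexive (R.trans (R.sym (𝔼₁-+ market u (λ i → e i + w i)))
          (𝔼₁-cong market λ i → ring (d i ∷ e i ∷ w i ∷ []) (v0 :- (v1 :+ v2) :+ (v1 :+ v2)) v0 ≡.refl)))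
        where
        x : ℕ
        x = stock market h
        l : ∀ i → Requests n → Fin 3
        l i = levelFrom (bump 0F i k₀) (bump 2F i k₂)
        d u : Fin 3 → Carrier
        d i = 𝔼 market n (λ ω → dual (l i ω) x (i ∷ ω))
        u i = d i - (e i + w i)

        expected : ∀ i a → Allowed B x a →
          (gain market i a + dualFrom n (bump 0F i k₀) (bump 2F i k₂) (next x a))
            + 𝔼 market n (λ ω → num (slack (l i ω) i a)) ≤ d i
        expected i a ok = O.≤-respˡ-≈
          (R.trans (𝔼-+ market n _ _) (R.+-congʳ (R.trans (𝔼-+ market n _ _) (R.+-congʳ (𝔼-const market n _)))))
          (𝔼-mono market n λ ω → gain≤dual (l i ω) i a ω ok)

        bound : ∀ i a → choose h i a ≈ 0# ⊎ gain market i a + valueFrom market A n ((i , a) ∷ h) ≤ u i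
        bound i a with allowed? B x a
        ... | no ¬ok = inj₁ (choose-feasible h i a ¬ok)
        ... | yes ok = inj₂ (order
          (gain market i a ∷ valueFrom market A n ((i , a) ∷ h) ∷ d i ∷ e i ∷ w i
            ∷ dualFrom n (bump 0F i k₀) (bump 2F i k₂) (next x a)
            ∷ 𝔼 market n (λ ω → num (slack (l i ω) i a)) ∷ [])
          (v0 :+ v1) (v2 :- (v3 :+ v4))
          (hyp (v1 :+ v3) v5 (ih i a) ⊕ hyp v4 v6 (bonus i a) ⊕ hyp ((v0 :+ v5) :+ v6) v2 (expected i a ok)) ≡.refl)

      -- All slack is given up. This closes the induction after the window in which regret is
      -- collected.
      value≤dual : ∀ n h k₀ k₂ → valueFrom market A n h ≤ dualFrom n k₀ k₂ (stock market h)
      value≤dual zero h k₀ k₂ = order (num (toℕ (level k₀ k₂)) ∷ fromℕ (stock market h) ∷ [])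
        (con 0) (con 0 :+ v0 :* v1) (hyp₀ v0 (0≤num (toℕ (level k₀ k₂))) ⊗ hyp₀ v1 (0≤fromℕ (stock market h))) ≡.refl
      value≤dual (suc n) h k₀ k₂ = O.≤-respˡ-≈
        (R.trans (R.+-congˡ (R.trans (𝔼₁-cong market λ i → R.+-identityˡ 0#) (𝔼₁-const market 0#))) (R.+-identityʳ _))
        (step-upper n h k₀ k₂ (λ _ → 0#) (λ _ → 0#)
          (λ i a → O.≤-respˡ-≈ (R.sym (R.+-identityʳ _)) (value≤dual n ((i , a) ∷ h) (bump 0F i k₀) (bump 2F i k₂)))
          (λ i a → 0≤slack n (bump 0F i k₀) (bump 2F i k₂) i a))

    module Gain (s q : Carrier) (0≤s : 0# ≤ s) (s²≈T : s * s ≈ fromℕ T) (48≤s² : num 48 ≤ s * s)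
      (0≤q : 0# ≤ q) (q-inverse : q * (num 64 * num 4 * (s * s)) ≈ 1#)
      (1≤8v : 1# ≤ num 8 * (p * (1# - p))) (1≤8v′ : 1# ≤ num 8 * (p′ * (1# - p′)))
      (n₁ : ℕ) (T≤2n₁ : T ℕ.≤ n₁ ℕ.+ n₁) where

      T̂ B̂₀ θ₀ θ₂ : Carrier
      T̂  = fromℕ T
      B̂₀ = fromℕ B₀
      θ₀ = ½ * (T̂ - B̂₀)
      θ₂ = ½ * (T̂ + B̂₀)

      2θ : ∀ y → num 2 * (½ * y) ≈ y
      2θ y = R.trans (R.sym (R.*-assoc _ _ _)) (R.trans (R.*-congʳ 2*½) (R.*-identityˡ y))

      quartic≤many₂ : ∀ k → quartic s (fromℕ k - θ₂) ≤ num 4 * ((s * s) * (s * s)) * many₂ k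
      quartic≤many₂ k with T ℕ.+ B₀ ℕ.<? k ℕ.+ k
      ... | yes _ = quartic≤4s⁴ s (fromℕ k - θ₂)
      ... | no ≮ = quartic≤0 0≤s (*-cancelˡ-≤ (0<num 1) (order (fromℕ k ∷ θ₂ ∷ T̂ ∷ B̂₀ ∷ [])
        (con 2 :* (v0 :- v1)) (con 2 :* con 0)
        (hyp (v2 :+ v3) (con 2 :* v1) (O.reflexive (R.sym (2θ _))) ⊕ hyp (v0 :+ v0) (v2 :+ v3) 2k≤) ≡.refl))
        where
        2k≤ : fromℕ k + fromℕ k ≤ T̂ + B̂₀
        2k≤ = O.≤-respˡ-≈ (fromℕ-+ k k) (O.≤-respʳ-≈ (fromℕ-+ T B₀) (fromℕ-mono (ℕ.≮⇒≥ ≮)))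

      quartic≤many₀ : ∀ k → quartic s (fromℕ k - θ₀) ≤ num 4 * ((s * s) * (s * s)) * many₀ k
      quartic≤many₀ k with T ℕ.<? k ℕ.+ k ℕ.+ B₀
      ... | yes _ = quartic≤4s⁴ s (fromℕ k - θ₀)
      ... | no ≮ = quartic≤0 0≤s (*-cancelˡ-≤ (0<num 1) (order (fromℕ k ∷ θ₀ ∷ T̂ ∷ B̂₀ ∷ [])
        (con 2 :* (v0 :- v1)) (con 2 :* con 0)
        (hyp (v2 :- v3) (con 2 :* v1) (O.reflexive (R.sym (2θ _))) ⊕ hyp (v0 :+ v0 :+ v3) v2 2k≤) ≡.refl))
        where
        2k≤ : fromℕ k + fromℕ k + B̂₀ ≤ T̂
        2k≤ = O.≤-respˡ-≈ (R.trans (fromℕ-+ (k ℕ.+ k) B₀) (R.+-congʳ (fromℕ-+ k k))) (fromℕ-mono (ℕ.≮⇒≥ ≮))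

      0≤indicator : ∀ {P : Set} (d : Dec P) → 0# ≤ indicator d
      0≤indicator (yes _) = 0≤1
      0≤indicator (no _)  = O.refl

      module Tail₀ = Tail 0F s θ₀ 0≤s many₀ quartic≤many₀
      module Tail₂ = Tail 2F s θ₂ 0≤s many₂ quartic≤many₂

      z₀ z₂ : ℕ → ℕ → Carrier
      z₀ = Tail₀.centred
      z₂ = Tail₂.centred

      E₀ E₂ : ℕ → ℕ → Carrier
      E₀ n k = 𝔼 market n (λ ω → many₀ (count 0F k ω))
      E₂ n k = 𝔼 market n (λ ω → many₂ (count 2F k ω))

      -- The bound from `likely`, weakened to be symmetric in the two centred counts, so that one
      -- quantity bounds both extreme levels.
      chance : Carrier → Carrier → Carrier
      chance z z′ = q * (s * s - num 64 * num 33 * (z * z + z′ * z′))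

      private
        chance≤ : ∀ {z} z′ {E} → s * s - num 64 * num 33 * (z * z) ≤ num 64 * num 4 * (s * s) * E → chance z z′ ≤ E
        chance≤ {z} z′ {E} le = O.≤-respʳ-≈
          (R.trans (ring (q ∷ s ∷ E ∷ []) (v0 :* (con 64 :* con 4 :* (v1 :* v1) :* v2)) (v0 :* (con 64 :* con 4 :* (v1 :* v1)) :* v2) ≡.refl)
            (R.trans (R.*-congʳ q-inverse) (R.*-identityˡ E)))
          (order (q ∷ s ∷ z ∷ z′ ∷ num 64 * num 4 * (s * s) * E ∷ [])
            (v0 :* (v1 :* v1 :- con 64 :* con 33 :* (v2 :* v2 :+ v3 :* v3))) (v0 :* v4)
            (hyp₀ v0 0≤q ⊗ (hyp (v1 :* v1 :- con 64 :* con 33 :* (v2 :* v2)) v4 le ⊕ lit 64 ⊗ lit 33 ⊗ sq v3)) ≡.refl)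

        chance-comm : ∀ z z′ → chance z z′ ≈ chance z′ z
        chance-comm z z′ = R.*-congˡ (R.+-congˡ (R.-‿cong (R.*-congˡ (R.+-comm _ _))))

      -- No action is safe: buying forgoes 2 at level 0, selling forgoes 2 at level 2, and skipping
      -- forgoes 1 at either.
      slack-likely : ∀ n k₀ k₂ a → n₁ ℕ.≤ n → k₀ ℕ.+ k₂ ℕ.+ n ℕ.≤ T →
        num 2 * chance (z₂ n k₂) (z₀ n k₀) ≤ 𝔼 market n (λ ω → num (slack (levelFrom k₀ k₂ ω) 1F a))
      slack-likely n k₀ k₂ a n₁≤n inv = O.trans (combine a) (O.≤-respˡ-≈
          (R.trans (𝔼-+ market n _ _) (R.+-cong (𝔼-* market n _ _) (𝔼-* market n _ _)))
          (𝔼-mono market n λ ω → slack-indicator (count 0F k₀ ω) (count 2F k₂ ω) a (within ω)))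
        where
        c = chance (z₂ n k₂) (z₀ n k₀)
        n≤s² : fromℕ n ≤ s * s
        n≤s² = O.≤-respʳ-≈ (R.sym s²≈T) (fromℕ-mono (ℕ.≤-trans (ℕ.m≤n+m n (k₀ ℕ.+ k₂)) inv))
        s²≤2n : s * s ≤ num 2 * fromℕ n
        s²≤2n = O.≤-respˡ-≈ (R.sym s²≈T) (O.≤-respʳ-≈
          (R.trans (fromℕ-+ n n) (ring (fromℕ n ∷ []) (v0 :+ v0) (con 2 :* v0) ≡.refl))
          (fromℕ-mono (ℕ.≤-trans T≤2n₁ (ℕ.+-mono-≤ n₁≤n n₁≤n))))
        c≤E₂ : c ≤ E₂ n k₂
        c≤E₂ = chance≤ (z₀ n k₀) (Tail₂.likely 48≤s² 1≤8v (λ k → 0≤indicator (T ℕ.+ B₀ ℕ.<? k ℕ.+ k)) n k₂ n≤s² s²≤2n)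
        c≤E₀ : c ≤ E₀ n k₀
        c≤E₀ = O.≤-respˡ-≈ (chance-comm (z₀ n k₀) (z₂ n k₂))
          (chance≤ (z₂ n k₂) (Tail₀.likely 48≤s² 1≤8v′ (λ k → 0≤indicator (T ℕ.<? k ℕ.+ k ℕ.+ B₀)) n k₀ n≤s² s²≤2n))
        combine : ∀ a → num 2 * c ≤ num (slack 0F 1F a) * E₀ n k₀ + num (slack 2F 1F a) * E₂ n k₂
        combine buy  = order (c ∷ E₀ n k₀ ∷ E₂ n k₂ ∷ []) (con 2 :* v0) (con 2 :* v1 :+ con 0 :* v2)
          (lit 2 ⊗ hyp v0 v1 c≤E₀) ≡.refl
        combine sell = order (c ∷ E₀ n k₀ ∷ E₂ n k₂ ∷ []) (con 2 :* v0) (con 0 :* v1 :+ con 2 :* v2)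
          (lit 2 ⊗ hyp v0 v2 c≤E₂) ≡.refl
        combine skip = order (c ∷ E₀ n k₀ ∷ E₂ n k₂ ∷ []) (con 2 :* v0) (con 1 :* v1 :+ con 1 :* v2)
          (hyp v0 v1 c≤E₀ ⊕ hyp v0 v2 c≤E₂) ≡.refl
        within : ∀ ω → count 0F k₀ ω ℕ.+ count 2F k₂ ω ℕ.≤ T
        within ω = ℕ.≤-trans
          (ℕ.+-monoˡ-≤ (count 2F k₂ ω) (ℕ.m≤m+n (count 0F k₀ ω) (count 1F 0 ω)))
          (ℕ.≤-trans (ℕ.≤-reflexive (≡.trans (count-total k₀ 0 k₂ ω)
            (≡.cong (λ y → y ℕ.+ k₂ ℕ.+ n) (ℕ.+-identityʳ k₀)))) inv)

      -- 2 chance at each of m requests, weighted by the mass of price 1; the last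
      -- m pays for the growth of z² + z′² along the walk.
      regret : Carrier → Carrier → Carrier → Carrier
      regret m z z′ = (1# - p - p′) * (q * (m * (num 2 * (s * s) - num 64 * num 33 * num 4 * (z * z + z′ * z′ + m))))

      private
        regretₑ : ∀ {k} → (p p′ q s m z z′ : Expr k) → Expr k
        regretₑ p p′ q s m z z′ = (con 1 :- p :- p′) :* (q :* (m :* (con 2 :* (s :* s)
          :- con 64 :* con 33 :* con 4 :* (z :* z :+ z′ :* z′ :+ m))))

        w : ℕ → ℕ → ℕ → Fin 3 → Carrier
        w n k₀ k₂ 0F = 0#
        w n k₀ k₂ 1F = num 2 * chance (z₂ n k₂) (z₀ n k₀)
        w n k₀ k₂ 2F = 0#

      -- The 4 in `regret` is twice the 2 of the bonus because a request of price 1 shifts the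
      -- centred counts, by -p and -p′, before `chance` is taken: 2 Z² = 4 (Z + p)² - 2 (Z + 2 p)² +
      -- 4 p².
      regret-step : ∀ m n k₀ k₂ → regret (fromℕ (suc m)) (z₂ (suc n) k₂) (z₀ (suc n) k₀) ≤
        𝔼₁ market (λ i → regret (fromℕ m) (z₂ n (bump 2F i k₂)) (z₀ n (bump 0F i k₀)) + w n k₀ k₂ i)
      regret-step m n k₀ k₂ = order
        (p ∷ p′ ∷ q ∷ s ∷ fromℕ m ∷ fromℕ n ∷ fromℕ k₂ ∷ fromℕ k₀ ∷ θ₂ ∷ θ₀ ∷ [])
        (regretₑ v0 v1 v2 v3 (con 1 :+ v4) (v6 :+ v0 :* (con 1 :+ v5) :- v8) (v7 :+ v1 :* (con 1 :+ v5) :- v9))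
        (v1 :* (regretₑ v0 v1 v2 v3 v4 Z Z′₊ :+ con 0)
          :+ ((con 1 :- v0 :- v1) :* (regretₑ v0 v1 v2 v3 v4 Z Z′
              :+ con 2 :* (v2 :* (v3 :* v3 :- con 64 :* con 33 :* (Z :* Z :+ Z′ :* Z′))))
            :+ (v0 :* (regretₑ v0 v1 v2 v3 v4 Z₊ Z′ :+ con 0) :+ con 0)))
        (hyp₀ (con 1 :- v0 :- v1) (proj₁ 0<ε) ⊗ hyp₀ v2 0≤q ⊗ lit 64 ⊗ lit 66 ⊗
          (sq (Z :+ con 2 :* v0) ⊕ sq (Z′ :+ con 2 :* v1)
            ⊕ lit 2 ⊗ (hyp₀ (con 1 :- v0 :- v1) (proj₁ 0<ε) ⊗ (lit 1 ⊕ hyp₀ v0 (proj₁ 0<p) ⊕ hyp₀ v1 (proj₁ 0<p′))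
              ⊕ lit 2 ⊗ hyp₀ v0 (proj₁ 0<p) ⊗ hyp₀ v1 (proj₁ 0<p′))
            ⊕ lit 2 ⊗ hyp₀ v4 (0≤fromℕ m) ⊗ (hyp v0 (con 1) (weight≤1 2F) ⊕ sq v0 ⊕ hyp v1 (con 1) (weight≤1 0F) ⊕ sq v1)))
        ≡.refl
        where
        Z Z′ Z₊ Z′₊ : Expr 10
        Z   = v6 :+ v0 :* v5 :- v8
        Z′  = v7 :+ v1 :* v5 :- v9
        Z₊  = con 1 :+ v6 :+ v0 :* v5 :- v8
        Z′₊ = con 1 :+ v7 :+ v1 :* v5 :- v9

      module _ (A : OnlineAlgorithm market) where
        value-upper : ∀ m h k₀ k₂ → k₀ ℕ.+ k₂ ℕ.+ (m ℕ.+ n₁) ℕ.≤ T →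
          valueFrom market A (m ℕ.+ n₁) h + regret (fromℕ m) (z₂ (m ℕ.+ n₁) k₂) (z₀ (m ℕ.+ n₁) k₀) ≤
          dualFrom (m ℕ.+ n₁) k₀ k₂ (stock market h)
        value-upper zero h k₀ k₂ inv = O.≤-respˡ-≈
          (ring (valueFrom market A n₁ h ∷ p ∷ p′ ∷ q ∷ s ∷ z₂ n₁ k₂ ∷ z₀ n₁ k₀ ∷ [])
            v0 (v0 :+ regretₑ v1 v2 v3 v4 (con 0) v5 v6) ≡.refl)
          (value≤dual A n₁ h k₀ k₂)
        value-upper (suc m) h k₀ k₂ inv = O.trans
          (+-monoʳ-≤ _ (regret-step m n k₀ k₂))
          (step-upper A n h k₀ k₂ _ (w n k₀ k₂)
            (λ i a → value-upper m ((i , a) ∷ h) (bump 0F i k₀) (bump 2F i k₂) (invariant i))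
            bonus)
          where
          n : ℕ
          n = m ℕ.+ n₁
          inv′ : suc (k₀ ℕ.+ k₂ ℕ.+ n) ℕ.≤ T
          inv′ = ℕ.≤-trans (ℕ.≤-reflexive (≡.sym (ℕ.+-suc (k₀ ℕ.+ k₂) n))) inv
          invariant : ∀ i → bump 0F i k₀ ℕ.+ bump 2F i k₂ ℕ.+ n ℕ.≤ T
          invariant 0F = inv′
          invariant 1F = ℕ.<⇒≤ inv′
          invariant 2F = ℕ.≤-trans (ℕ.≤-reflexive (≡.cong (ℕ._+ n) (ℕ.+-suc k₀ k₂))) inv′
          bonus : ∀ i a → w n k₀ k₂ i ≤ 𝔼 market n (λ ω → num (slack (levelFrom (bump 0F i k₀) (bump 2F i k₂) ω) i a))
          bonus 0F a = 0≤slack n (bump 0F 0F k₀) (bump 2F 0F k₂) 0F a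
          bonus 1F a = slack-likely n k₀ k₂ a (ℕ.m≤n+m n₁ m) (invariant 1F)
          bonus 2F a = 0≤slack n (bump 0F 2F k₀) (bump 2F 2F k₂) 2F a

-- Parameters of the hard instance and the final estimate.

module HardInstance (ℝ : CompleteOrderedField) where
  open UpperBound ℝ public

  0<-by-multiple : ∀ {x y c} → 0# < c → 0# < y → y ≤ c * x → 0# < x
  0<-by-multiple {x} {y} {c} 0<c 0<y y≤cx =
    *-cancelˡ-≤ 0<c (O.≤-respˡ-≈ (R.sym (R.zeroʳ c)) (O.trans (proj₁ 0<y) y≤cx)) ,
    λ 0≈x → proj₂ 0<y (O.antisym (proj₁ 0<y)
      (O.≤-respʳ-≈ (R.trans (R.*-congˡ (R.sym 0≈x)) (R.zeroʳ c)) y≤cx))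

  -- 128 from the mass of price 1, 128² from a window of T / 128² requests and
  -- 256 from the probability of each extreme level.
  C : Carrier
  C = num 128 * num 128 * num 128 * num 256

  0<4C : 0# < num 4 * C
  0<4C = *-pos (0<num 3) (*-pos (*-pos (*-pos (0<num 127) (0<num 127)) (0<num 127)) (0<num 255))

  private
    Cₑ : ∀ {n} → Expr n
    Cₑ = con 128 :* con 128 :* con 128 :* con 256

    variance-high : ∀ {v} → num 7 ≤ num 10 * v → num 5 * v ≤ num 4 → 1# ≤ num 8 * (v * (1# - v))
    variance-high {v} lo hi = *-cancelˡ-≤ (0<num 49) (order (v ∷ []) (con 50 :* con 1)
      (con 50 :* (con 8 :* (v0 :* (con 1 :- v0))))
      (lit 8 ⊗ (hyp (con 7) (con 10 :* v0) lo ⊗ hyp (con 5 :* v0) (con 4) hi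
        ⊕ hyp (con 7) (con 10 :* v0) lo ⊕ lit 7 ⊗ hyp (con 5 :* v0) (con 4) hi) ⊕ lit 6) ≡.refl)

    variance-low : ∀ {v} → 1# ≤ num 5 * v → num 10 * v ≤ num 3 → 1# ≤ num 8 * (v * (1# - v))
    variance-low {v} lo hi = *-cancelˡ-≤ (0<num 49) (order (v ∷ []) (con 50 :* con 1)
      (con 50 :* (con 8 :* (v0 :* (con 1 :- v0))))
      (lit 8 ⊗ (hyp (con 1) (con 5 :* v0) lo ⊗ hyp (con 10 :* v0) (con 3) hi
        ⊕ hyp (con 10 :* v0) (con 3) hi ⊕ lit 7 ⊗ hyp (con 1) (con 5 :* v0) lo) ⊕ lit 6) ≡.refl)

  -- The mass of price 1 is ε = 1 / (128 s), so that about s / 128 such requests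
  -- arrive among T = s²: as many as the fluctuation of the other counts.
  module Regret (s ρ : Carrier) {B τ n₁ B₀ : ℕ}
    (1≤B : 1 ℕ.≤ B) (B₀≤B : B₀ ℕ.≤ B) (B₀≤T : B₀ ℕ.≤ τ ℕ.+ n₁) (B≡B₀+T : B ≡ B₀ ℕ.+ (τ ℕ.+ n₁))
    (T≤2n₁ : τ ℕ.+ n₁ ℕ.≤ n₁ ℕ.+ n₁) (T≈ : fromℕ (τ ℕ.+ n₁) ≈ num 128 * num 128 * fromℕ τ)
    (0<s : 0# < s) (s²≈T : s * s ≈ fromℕ (τ ℕ.+ n₁)) (40C≤s : num 40 * C ≤ s)
    (ρT≈B₀ : ρ * fromℕ (τ ℕ.+ n₁) ≈ fromℕ B₀) (1≤2ρ : 1# ≤ num 2 * ρ) (20ρ≤11 : num 20 * ρ ≤ num 11) where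

    private
      T : ℕ
      T = τ ℕ.+ n₁

      δ ε p p′ q : Carrier
      δ  = num 128 ⁻¹
      ε  = δ * s ⁻¹
      -- The solution of p + p′ = 1 - ε and p - p′ = ρ: the means p T and p′ T then fall short of
      -- `θ₂` and `θ₀` by the same ε T / 2.
      p  = ½ * (1# - ε + ρ)
      p′ = ½ * (1# - ε - ρ)
      q  = (num 64 * num 4 * (s * s)) ⁻¹

      128δ≈1 : num 128 * δ ≈ 1#
      128δ≈1 = inverseʳ (0<num 127)

      εs≈δ : ε * s ≈ δ
      εs≈δ = R.trans (ring (δ ∷ s ∷ s ⁻¹ ∷ []) (v0 :* v2 :* v1) (v0 :* (v1 :* v2)) ≡.refl)
        (R.trans (R.*-congˡ (inverseʳ 0<s)) (R.*-identityʳ δ))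

      0<ε : 0# < ε
      0<ε = *-pos (0<x⁻¹ (0<num 127)) (0<x⁻¹ 0<s)

      0≤s = proj₁ 0<s
      0≤ε = proj₁ 0<ε

      48≤s : num 48 ≤ s
      -- The literal is 40 C - 48.
      48≤s = order (s ∷ []) (con 48) v0 (hyp (con 40 :* Cₑ) v0 40C≤s ⊕ lit 21474836432) ≡.refl

      48≤s² : num 48 ≤ s * s
      48≤s² = order (s ∷ []) (con 48) (v0 :* v0)
        (hyp (con 48) v0 48≤s ⊗ hyp (con 48) v0 48≤s ⊕ lit 96 ⊗ hyp (con 48) v0 48≤s ⊕ lit 48 ⊗ lit 47) ≡.refl

      20ε≤1 : num 20 * ε ≤ 1#
      20ε≤1 = order (s ∷ ε ∷ δ ∷ []) (con 20 :* v1) (con 1)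
        (hyp₀ v1 0≤ε ⊗ hyp (con 48) v0 48≤s ⊕ hyp (v1 :* v0) v2 (O.reflexive εs≈δ)
          ⊕ hyp (con 128 :* v2) (con 1) (O.reflexive 128δ≈1) ⊕ lit 127 ⊗ hyp₀ v2 0≤δ ⊕ lit 28 ⊗ hyp₀ v1 0≤ε) ≡.refl
        where
        0≤δ = 0≤x⁻¹ (0<num 127)

      2p≈ : num 2 * p ≈ 1# - ε + ρ
      2p≈ = R.trans (R.sym (R.*-assoc _ _ _)) (R.trans (R.*-congʳ 2*½) (R.*-identityˡ _))

      2p′≈ : num 2 * p′ ≈ 1# - ε - ρ
      2p′≈ = R.trans (R.sym (R.*-assoc _ _ _)) (R.trans (R.*-congʳ 2*½) (R.*-identityˡ _))

      ρ₁ : Vec Carrier 4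
      ρ₁ = p ∷ p′ ∷ ε ∷ ρ ∷ []

      2p≤ = O.reflexive 2p≈
      2p≥ = O.reflexive (R.sym 2p≈)
      2p′≤ = O.reflexive 2p′≈
      2p′≥ = O.reflexive (R.sym 2p′≈)

      7≤10p : num 7 ≤ num 10 * p
      7≤10p = *-cancelˡ-≤ (0<num 3) (order ρ₁ (con 4 :* con 7) (con 4 :* (con 10 :* v0))
        (lit 20 ⊗ hyp (con 1 :- v2 :+ v3) (con 2 :* v0) 2p≥ ⊕ hyp (con 20 :* v2) (con 1) 20ε≤1
          ⊕ lit 10 ⊗ hyp (con 1) (con 2 :* v3) 1≤2ρ ⊕ lit 1) ≡.refl)

      5p≤4 : num 5 * p ≤ num 4
      5p≤4 = *-cancelˡ-≤ (0<num 7) (order ρ₁ (con 8 :* (con 5 :* v0)) (con 8 :* con 4)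
        (lit 20 ⊗ hyp (con 2 :* v0) (con 1 :- v2 :+ v3) 2p≤ ⊕ lit 20 ⊗ hyp₀ v2 0≤ε
          ⊕ hyp (con 20 :* v3) (con 11) 20ρ≤11 ⊕ lit 1) ≡.refl)

      1≤5p′ : 1# ≤ num 5 * p′
      1≤5p′ = *-cancelˡ-≤ (0<num 7) (order ρ₁ (con 8 :* con 1) (con 8 :* (con 5 :* v1))
        (lit 20 ⊗ hyp (con 1 :- v2 :- v3) (con 2 :* v1) 2p′≥ ⊕ hyp (con 20 :* v2) (con 1) 20ε≤1
          ⊕ hyp (con 20 :* v3) (con 11) 20ρ≤11) ≡.refl)

      10p′≤3 : num 10 * p′ ≤ num 3
      10p′≤3 = *-cancelˡ-≤ (0<num 3) (order ρ₁ (con 4 :* (con 10 :* v1)) (con 4 :* con 3)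
        (lit 20 ⊗ hyp (con 2 :* v1) (con 1 :- v2 :- v3) 2p′≤ ⊕ lit 20 ⊗ hyp₀ v2 0≤ε
          ⊕ lit 10 ⊗ hyp (con 1) (con 2 :* v3) 1≤2ρ ⊕ lit 2) ≡.refl)

      1-p-p′≈ε : 1# - p - p′ ≈ ε
      1-p-p′≈ε = R.trans
        (ring (½ ∷ ε ∷ ρ ∷ []) (con 1 :- v0 :* (con 1 :- v1 :+ v2) :- v0 :* (con 1 :- v1 :- v2))
          (con 1 :- (con 2 :* v0) :* (con 1 :- v1)) ≡.refl)
        (R.trans (R.+-congˡ (R.-‿cong (R.*-congʳ 2*½)))
          (ring (ε ∷ []) (con 1 :- con 1 :* (con 1 :- v0)) v0 ≡.refl))

      0<p : 0# < p
      0<p = 0<-by-multiple (0<num 9) (0<num 6) 7≤10p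

      0<p′ : 0# < p′
      0<p′ = 0<-by-multiple (0<num 4) 0<1 1≤5p′

      0<1-p-p′ : 0# < 1# - p - p′
      0<1-p-p′ = 0<x≤y⇒0<y 0<ε (O.reflexive (R.sym 1-p-p′≈ε))

      0<256s² : 0# < num 64 * num 4 * (s * s)
      0<256s² = *-pos (*-pos (0<num 63) (0<num 3)) (*-pos 0<s 0<s)

    open Online p p′ 0<p 0<p′ 0<1-p-p′ 1≤B B₀≤B B₀≤T B≡B₀+T public

    private
      open Gain s q 0≤s s²≈T 48≤s² (0≤x⁻¹ 0<256s²) (R.trans (R.*-comm _ _) (inverseʳ 0<256s²))
        (variance-high 7≤10p 5p≤4) (variance-low 1≤5p′ 10p′≤3) n₁ T≤2n₁

      εT≈δs : ε * T̂ ≈ δ * s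
      εT≈δs = R.trans (R.*-congˡ (R.sym s²≈T)) (R.trans (R.sym (R.*-assoc _ _ _)) (R.*-congʳ εs≈δ))

      -- Both centred counts start at -ε T / 2 = -s / 256, close enough to 0 on the scale s of the
      -- fluctuations.
      256z≈-s : ∀ {w θ y} → num 2 * w ≈ 1# - ε + y → num 2 * θ ≈ T̂ + y * T̂ →
                num 256 * (0# + w * T̂ - θ) ≈ - s
      256z≈-s {w} {θ} {y} 2w≈ 2θ≈ = R.trans
        (ring (w ∷ T̂ ∷ θ ∷ []) (con 256 :* (con 0 :+ v0 :* v1 :- v2)) (con 128 :* ((con 2 :* v0) :* v1 :- con 2 :* v2)) ≡.refl)
        (R.trans (R.*-congˡ (R.+-cong (R.*-congʳ 2w≈) (R.-‿cong 2θ≈)))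
          (R.trans (ring (ε ∷ y ∷ T̂ ∷ []) (con 128 :* ((con 1 :- v0 :+ v1) :* v2 :- (v2 :+ v1 :* v2))) (:- (con 128 :* (v0 :* v2))) ≡.refl)
            (R.-‿cong (R.trans (R.*-congˡ εT≈δs) (R.trans (R.sym (R.*-assoc _ _ _)) (R.trans (R.*-congʳ 128δ≈1) (R.*-identityˡ s)))))))

      square≈s² : ∀ {z} → num 256 * z ≈ - s → (num 256 * z) * (num 256 * z) ≈ s * s
      square≈s² eq = R.trans (R.*-cong eq eq) (ring (s ∷ []) ((:- v0) :* (:- v0)) (v0 :* v0) ≡.refl)

      Z₂ Z₀ τ̂ : Carrier
      Z₂ = z₂ T 0
      Z₀ = z₀ T 0
      τ̂  = fromℕ τ

      Z₂² : (num 256 * Z₂) * (num 256 * Z₂) ≈ s * s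
      Z₂² = square≈s² (256z≈-s 2p≈ (R.trans (2θ _) (R.+-congˡ (R.sym ρT≈B₀))))

      Z₀² : (num 256 * Z₀) * (num 256 * Z₀) ≈ s * s
      Z₀² = square≈s² (256z≈-s {y = - ρ} 2p′≈ (R.trans (2θ _) (R.+-congˡ (R.trans (R.-‿cong (R.sym ρT≈B₀))
        (ring (ρ ∷ T̂ ∷ []) (:- (v0 :* v1)) ((:- v0) :* v1) ≡.refl)))))

      128²τ≈s² : num 128 * num 128 * τ̂ ≈ s * s
      128²τ≈s² = R.trans (R.sym T≈) (R.sym s²≈T)

      -- After scaling by 256 the subtracted terms are 33 s² for each centred count and 132 s² for
      -- the window: 198 out of the 256 that may be spent.
      s²≤factor : s * s ≤ num 2 * (s * s) - num 64 * num 33 * num 4 * (Z₂ * Z₂ + Z₀ * Z₀ + τ̂)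
      s²≤factor = *-cancelˡ-≤ (0<num 255) (order (s ∷ Z₂ ∷ Z₀ ∷ τ̂ ∷ [])
        (con 256 :* (v0 :* v0))
        (con 256 :* (con 2 :* (v0 :* v0) :- con 64 :* con 33 :* con 4 :* (v1 :* v1 :+ v2 :* v2 :+ v3)))
        (lit 33 ⊗ (hyp ((con 256 :* v1) :* (con 256 :* v1)) (v0 :* v0) (O.reflexive Z₂²)
            ⊕ hyp ((con 256 :* v2) :* (con 256 :* v2)) (v0 :* v0) (O.reflexive Z₀²))
          ⊕ lit 132 ⊗ hyp (con 128 :* con 128 :* v3) (v0 :* v0) (O.reflexive 128²τ≈s²)
          ⊕ lit 58 ⊗ sq v0) ≡.refl)

      loss : Carrier
      loss = regret τ̂ Z₂ Z₀

      -- By `s²≤factor` the loss is at least ε q τ s², and ε = 1 / (128 s), q = 1 / (256 s²), τ = s²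
      -- / 128² make this s / C.
      s≤C*loss : s ≤ C * loss
      s≤C*loss = O.≤-respˡ-≈
        (R.trans (ring (1# - p - p′ ∷ q ∷ τ̂ ∷ s ∷ [])
            (Cₑ :* (v0 :* (v1 :* (v2 :* (v3 :* v3)))))
            (con 128 :* (con 128 :* con 128 :* v2) :* (v1 :* (con 64 :* con 4 :* (v3 :* v3))) :* v0) ≡.refl)
          (R.trans (R.*-cong (R.*-cong (R.*-congˡ 128²τ≈s²) (R.trans (R.*-comm _ _) (inverseʳ 0<256s²))) 1-p-p′≈ε)
            (R.trans (ring (s ∷ ε ∷ []) (con 128 :* (v0 :* v0) :* con 1 :* v1) (v0 :* (con 128 :* (v1 :* v0))) ≡.refl)
              (R.trans (R.*-congˡ (R.trans (R.*-congˡ εs≈δ) 128δ≈1)) (R.*-identityʳ s)))))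
        (order (1# - p - p′ ∷ q ∷ τ̂ ∷ s * s ∷ num 2 * (s * s) - num 64 * num 33 * num 4 * (Z₂ * Z₂ + Z₀ * Z₀ + τ̂) ∷ [])
          (Cₑ :* (v0 :* (v1 :* (v2 :* v3)))) (Cₑ :* (v0 :* (v1 :* (v2 :* v4))))
          (lit 128 ⊗ lit 128 ⊗ lit 128 ⊗ lit 256 ⊗ hyp₀ v0 (proj₁ 0<1-p-p′) ⊗ hyp₀ v1 (0≤x⁻¹ 0<256s²)
            ⊗ hyp₀ v2 (0≤fromℕ τ) ⊗ hyp v3 v4 s²≤factor) ≡.refl)

      dual≤OPT : dualFrom T 0 0 B₀ ≤ OPT market + num 20
      dual≤OPT = O.trans (𝔼-mono market T λ ω → dual≤offline ω (balance ω))
        (O.trans (O.reflexive (R.trans (𝔼-+ market T _ _) (R.+-congˡ (𝔼-* market T (num 2) _))))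
          (order (OPT market ∷ 𝔼 market T (λ ω → fromℕ (hoard 0 ω)) ∷ [])
            (v0 :+ con 2 :* v1) (v0 :+ con 20) (lit 2 ⊗ hyp v1 (con 10) (𝔼-hoard 7≤10p T)) ≡.refl))

      online≤ : ∀ A → expectedProfit market A + loss ≤ OPT market + num 20
      online≤ A = O.trans (value-upper A τ [] 0 0 ℕ.≤-refl) dual≤OPT

    -- For the idle algorithm the regret bound reads loss ≤ OPT + 20, and 20 is at most half of s /
    -- C.
    OPT-large : num 2 * s ≤ num 4 * C * OPT market
    OPT-large = order (s ∷ loss ∷ OPT market ∷ expectedProfit market (idle market) ∷ [])
      (con 2 :* v0) (con 4 :* Cₑ :* v2)
      (lit 4 ⊗ lit 128 ⊗ lit 128 ⊗ lit 128 ⊗ lit 256 ⊗ (hyp (v3 :+ v1) (v2 :+ con 20) (online≤ (idle market))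
          ⊕ hyp₀ v3 (0≤idle market))
        ⊕ lit 4 ⊗ hyp v0 (Cₑ :* v1) s≤C*loss ⊕ lit 2 ⊗ hyp (con 40 :* Cₑ) v0 40C≤s) ≡.refl

    OPT≤2s² : OPT market ≤ num 2 * (s * s)
    OPT≤2s² = O.≤-respʳ-≈ (R.*-congˡ (R.sym s²≈T)) (O.≤-respʳ-≈ (𝔼-const market T _)
      (𝔼-mono market T λ ω → offlineProfit-upper market ω (*-nonNeg (0≤num 2) (0≤fromℕ T)) (λ as _ → bound ω as)))
      where
      0≤price : ∀ i → 0# ≤ price i
      0≤price i = 0≤num (toℕ i)
      price≤2 : ∀ i → price i ≤ num 2
      price≤2 0F = 0≤num 2
      price≤2 1F = order [] (con 1) (con 2) (lit 1) ≡.refl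
      price≤2 2F = O.refl
      bound : ∀ {n} (ω : Requests n) as → profit market ω as ≤ num 2 * fromℕ n
      bound [] [] = O.reflexive (R.sym (R.zeroʳ (num 2)))
      bound {suc n} (i ∷ ω) (a ∷ as) = order (gain market i a ∷ profit market ω as ∷ fromℕ n ∷ [])
        (v0 :+ v1) (con 2 :* (con 1 :+ v2)) (hyp v0 (con 2) (gain≤2 a) ⊕ hyp v1 (con 2 :* v2) (bound ω as)) ≡.refl
        where
        gain≤2 : ∀ a → gain market i a ≤ num 2
        gain≤2 buy  = order (price i ∷ []) (:- v0) (con 2) (hyp₀ v0 (0≤price i) ⊕ lit 2) ≡.refl
        gain≤2 sell = price≤2 i
        gain≤2 skip = 0≤num 2

    -- After the gap of 20 a regret of s / (2 C) remains. As OPT ≤ 2 s² and s r⁻¹ ≤ 1, it is at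
    -- least OPT r⁻¹ / (4 C).
    online-bound : ∀ c r⁻¹ → c * (num 4 * C) ≈ 1# → 0# ≤ r⁻¹ → s * r⁻¹ ≤ 1# → ∀ A →
      expectedProfit market A ≤ (1# - c * r⁻¹) * OPT market
    online-bound c r⁻¹ 4Cc≈1 0≤r⁻¹ s/r≤1 A = *-cancelˡ-≤ 0<4C (O.≤-respʳ-≈ rhs
      (order (s ∷ r⁻¹ ∷ expectedProfit market A ∷ loss ∷ OPT market ∷ [])
        (con 4 :* Cₑ :* v2) (con 4 :* Cₑ :* v4 :- con 1 :* (v1 :* v4))
        (lit 4 ⊗ lit 128 ⊗ lit 128 ⊗ lit 128 ⊗ lit 256 ⊗ hyp (v2 :+ v3) (v4 :+ con 20) (online≤ A)
          ⊕ lit 4 ⊗ hyp v0 (Cₑ :* v3) s≤C*loss ⊕ lit 2 ⊗ hyp (con 40 :* Cₑ) v0 40C≤s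
          ⊕ hyp₀ v1 0≤r⁻¹ ⊗ hyp v4 (con 2 :* (v0 :* v0)) OPT≤2s²
          ⊕ lit 2 ⊗ hyp₀ v0 0≤s ⊗ hyp (v0 :* v1) (con 1) s/r≤1) ≡.refl))
      where
      rhs : num 4 * C * OPT market - 1# * (r⁻¹ * OPT market) ≈ num 4 * C * ((1# - c * r⁻¹) * OPT market)
      rhs = R.trans (R.+-congˡ (R.-‿cong (R.*-congʳ (R.sym 4Cc≈1))))
        (ring (c ∷ r⁻¹ ∷ OPT market ∷ []) (con 4 :* Cₑ :* v2 :- (v0 :* (con 4 :* Cₑ)) :* (v1 :* v2))
          (con 4 :* Cₑ :* ((con 1 :- v0 :* v1) :* v2)) ≡.refl)

  -- 24576 = 8192 + 16384 splits B into B₀ and T = 128² τ in the ratio 1 : 2. The remainder r goes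
  -- to B₀, so ρ = 1/2 + r / T, which is at most 11/20 once τ ≥ 30.
  module Parameters (X : ℕ) (30≤X : 30 ℕ.≤ X) (X≈40C : fromℕ X ≈ num 40 * C)
    {B τ r : ℕ} (B≡ : B ≡ r ℕ.+ τ ℕ.* 24576) (r<24576 : r ℕ.< 24576) (X²≤τ : X ℕ.* X ℕ.≤ τ) where

    private
      n₁ B₀ T : ℕ
      n₁ = τ ℕ.* 16383
      B₀ = τ ℕ.* 8192 ℕ.+ r
      T  = τ ℕ.+ n₁

      1≤X : 1 ℕ.≤ X
      1≤X = ℕ.≤-trans (ℕ.s≤s ℕ.z≤n) 30≤X

      30≤τ : 30 ℕ.≤ τ
      30≤τ = ℕ.≤-trans (ℕ.≤-trans 30≤X (ℕ.m≤m*n X X {{ℕ.>-nonZero 1≤X}})) X²≤τ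

      1≤τ : 1 ℕ.≤ τ
      1≤τ = ℕ.≤-trans (ℕ.s≤s ℕ.z≤n) 30≤τ

      1≤T : 1 ℕ.≤ T
      1≤T = ℕ.≤-trans 1≤τ (ℕ.m≤m+n τ n₁)

      T≡ : T ≡ τ ℕ.* 16384
      T≡ = ≡.sym (ℕ.*-suc τ 16383)

      B≡B₀+T : B ≡ B₀ ℕ.+ T
      B≡B₀+T = begin
        B                                            ≡⟨ B≡ ⟩
        r ℕ.+ τ ℕ.* 24576                            ≡⟨ ≡.cong (r ℕ.+_) (ℕ.*-distribˡ-+ τ 8192 16384) ⟩
        r ℕ.+ (τ ℕ.* 8192 ℕ.+ τ ℕ.* 16384)           ≡⟨ ℕ.+-assoc r _ _ ⟨
        r ℕ.+ τ ℕ.* 8192 ℕ.+ τ ℕ.* 16384             ≡⟨ ≡.cong₂ ℕ._+_ (ℕ.+-comm r _) (≡.sym T≡) ⟩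
        B₀ ℕ.+ T                                     ∎
        where open ≡.≡-Reasoning

      B₀≤T : B₀ ℕ.≤ T
      B₀≤T = ℕ.≤-trans
        (ℕ.+-monoʳ-≤ (τ ℕ.* 8192) (ℕ.≤-trans (ℕ.<⇒≤ r<24576) (ℕ.*-monoˡ-≤ 8192 (ℕ.≤-trans (ℕ.m≤m+n 3 27) 30≤τ))))
        (ℕ.≤-reflexive (≡.trans (≡.sym (ℕ.*-distribˡ-+ τ 8192 8192)) (≡.sym T≡)))

      1≤B₀ : 1 ℕ.≤ B₀
      1≤B₀ = ℕ.≤-trans (ℕ.≤-trans 1≤τ (ℕ.m≤m*n τ 8192)) (ℕ.m≤m+n (τ ℕ.* 8192) r)

      B₀≤B : B₀ ℕ.≤ B
      B₀≤B = ℕ.≤-trans (ℕ.m≤m+n B₀ T) (ℕ.≤-reflexive (≡.sym B≡B₀+T))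

      T≤B : T ℕ.≤ B
      T≤B = ℕ.≤-trans (ℕ.m≤n+m T B₀) (ℕ.≤-reflexive (≡.sym B≡B₀+T))

      fromℕ-product : ∀ m n → fromℕ (m ℕ.* n) ≈ num m * num n
      fromℕ-product m n = R.trans (fromℕ-* m n) (R.sym (R.*-cong (num≈fromℕ m) (num≈fromℕ n)))

      T≈ : fromℕ T ≈ num 128 * num 128 * fromℕ τ
      T≈ = R.trans (R.reflexive (≡.cong fromℕ T≡)) (R.trans (fromℕ-* τ 16384)
        (R.trans (R.*-comm _ _) (R.*-congʳ (fromℕ-product 128 128))))

      B₀≈ : fromℕ B₀ ≈ num 64 * num 128 * fromℕ τ + fromℕ r
      B₀≈ = R.trans (fromℕ-+ (τ ℕ.* 8192) r) (R.+-congʳ (R.trans (fromℕ-* τ 8192)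
        (R.trans (R.*-comm _ _) (R.*-congʳ (fromℕ-product 64 128)))))

      r≤ : fromℕ r ≤ num 192 * num 128
      r≤ = O.≤-respʳ-≈ (fromℕ-product 192 128) (fromℕ-mono (ℕ.<⇒≤ r<24576))

      30≤τ̂ : num 30 ≤ fromℕ τ
      30≤τ̂ = O.≤-respˡ-≈ (R.sym (num≈fromℕ 30)) (fromℕ-mono 30≤τ)

      s ρ : Carrier
      s = √ T
      ρ = fromℕ B₀ * fromℕ T ⁻¹

      0<T̂ : 0# < fromℕ T
      0<T̂ = 0<fromℕ 1≤T

      ρT≈B₀ : ρ * fromℕ T ≈ fromℕ B₀
      ρT≈B₀ = R.trans (ring (fromℕ B₀ ∷ fromℕ T ∷ fromℕ T ⁻¹ ∷ []) (v0 :* v2 :* v1) (v0 :* (v1 :* v2)) ≡.refl)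
        (R.trans (R.*-congˡ (inverseʳ 0<T̂)) (R.*-identityʳ _))

      ρ₁ : Vec Carrier 5
      ρ₁ = fromℕ T ∷ ρ ∷ fromℕ B₀ ∷ fromℕ τ ∷ fromℕ r ∷ []

      1≤2ρ : 1# ≤ num 2 * ρ
      1≤2ρ = *-cancelˡ-≤ 0<T̂ (order ρ₁ (v0 :* con 1) (v0 :* (con 2 :* v1))
        (lit 2 ⊗ hyp v2 (v1 :* v0) (O.reflexive (R.sym ρT≈B₀))
          ⊕ lit 2 ⊗ hyp (con 64 :* con 128 :* v3 :+ v4) v2 (O.reflexive (R.sym B₀≈))
          ⊕ hyp v0 (con 128 :* con 128 :* v3) (O.reflexive T≈)
          ⊕ lit 2 ⊗ hyp₀ v4 (0≤fromℕ r)) ≡.refl)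

      20ρ≤11 : num 20 * ρ ≤ num 11
      20ρ≤11 = *-cancelˡ-≤ 0<T̂ (order ρ₁ (v0 :* (con 20 :* v1)) (v0 :* con 11)
        (lit 20 ⊗ hyp (v1 :* v0) v2 (O.reflexive ρT≈B₀)
          ⊕ lit 20 ⊗ hyp v2 (con 64 :* con 128 :* v3 :+ v4) (O.reflexive B₀≈)
          ⊕ lit 11 ⊗ hyp (con 128 :* con 128 :* v3) v0 (O.reflexive (R.sym T≈))
          ⊕ lit 20 ⊗ hyp v4 (con 192 :* con 128) r≤
          ⊕ lit 128 ⊗ lit 128 ⊗ hyp (con 30) v3 30≤τ̂) ≡.refl)

      s²≈T : s * s ≈ fromℕ T
      s²≈T = √-square T 1≤T

      40C≤s : num 40 * C ≤ s
      40C≤s = square-cancel-≤ (proj₁ (0<√ T 1≤T)) (O.≤-respʳ-≈ (R.sym s²≈T)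
        (O.≤-respˡ-≈ (R.trans (fromℕ-* X X) (R.*-cong X≈40C X≈40C))
          (fromℕ-mono (ℕ.≤-trans X²≤τ (ℕ.m≤m+n τ n₁)))))

      0<√B : 0# < √ B
      0<√B = 0<√ B (ℕ.≤-trans 1≤T T≤B)

      s/√B≤1 : s * (√ B) ⁻¹ ≤ 1#
      s/√B≤1 = O.≤-respʳ-≈ (inverseʳ 0<√B) (order (s ∷ √ B ∷ (√ B) ⁻¹ ∷ []) (v0 :* v2) (v1 :* v2)
        (hyp v0 v1 (√-mono 1≤T T≤B) ⊗ hyp₀ v2 (0≤x⁻¹ 0<√B)) ≡.refl)

    open Regret s ρ {B} {τ} {n₁} {B₀} (ℕ.≤-trans 1≤T T≤B) B₀≤B B₀≤T B≡B₀+T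
      (ℕ.+-monoˡ-≤ n₁ (ℕ.m≤m*n τ 16383)) T≈ (0<√ T 1≤T) s²≈T 40C≤s ρT≈B₀ 1≤2ρ 20ρ≤11

    hard-instance : ∀ c → c * (num 4 * C) ≈ 1# →
      Σ[ I ∈ Instance B ] SymmetricPrices (Instance.D I) × 1 ℕ.≤ Instance.B₀ I × 0# < OPT I ×
        (∀ A → expectedProfit I A ≤ (1# - c * (√ B) ⁻¹) * OPT I)
    hard-instance c 4Cc≈1 = market , (λ _ → R.refl) , 1≤B₀ ,
      0<-by-multiple 0<4C (*-pos (0<num 1) (0<√ T 1≤T)) OPT-large ,
      online-bound c ((√ B) ⁻¹) 4Cc≈1 (0≤x⁻¹ 0<√B) s/√B≤1

  fromℕ-40C : fromℕ (40 ℕ.* (128 ℕ.* 128 ℕ.* 128 ℕ.* 256)) ≈ num 40 * C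
  fromℕ-40C = R.trans (fromℕ-* 40 (128 ℕ.* 128 ℕ.* 128 ℕ.* 256)) (R.*-cong (n≈ 40)
    (R.trans (fromℕ-* (128 ℕ.* 128 ℕ.* 128) 256) (R.*-cong
      (R.trans (fromℕ-* (128 ℕ.* 128) 128) (R.*-cong
        (R.trans (fromℕ-* 128 128) (R.*-cong (n≈ 128) (n≈ 128))) (n≈ 128))) (n≈ 256))))
    where
    n≈ : ∀ n → fromℕ n ≈ num n
    n≈ n = R.sym (num≈fromℕ n)

theorem1p5 : (ℝ : CompleteOrderedField) →
    let open CompleteOrderedField ℝ
        open RealFunctions ℝ
        open Trading ℝ
        open Instance
    in
    (Σ[ C ∈ Carrier ] 0# < C ×
      ((B : ℕ) .{{_ : NonZero B}} → 2 ℕ.≤ B →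
       (I : Instance B) → SymmetricPrices (D I) → 1 ℕ.≤ B₀ I →
       Σ[ A ∈ OnlineAlgorithm I ]
         (1# - C * (log₂ B * (√ B) ⁻¹)) * OPT I ≤ expectedProfit I A))
    ×
    (Σ[ c ∈ Carrier ] 0# < c × (Σ[ n₀ ∈ ℕ ]
      ((B : ℕ) → n₀ ℕ.≤ B →
       Σ[ I ∈ Instance B ]
         SymmetricPrices (D I) × 1 ℕ.≤ B₀ I × 0# < OPT I ×
         ((A : OnlineAlgorithm I) →
           expectedProfit I A ≤ (1# - c * (√ B) ⁻¹) * OPT I))))
theorem1p5 ℝ =
  (num 18 , 0<num 17 , λ B 2≤B I → competitive-algorithm 2≤B I) ,
  -- The bound on B makes τ = B / 24576 at least X², hence `√ T` at least X = 40 C.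
  (num 4 * C) ⁻¹ , 0<x⁻¹ 0<4C , X ℕ.* X ℕ.* 24576 , λ B large →
    Parameters.hard-instance X (ℕ.m≤m+n 30 (X ∸ 30)) fromℕ-40C (ℕ.m≡m%n+[m/n]*n B 24576) (ℕ.m%n<n B 24576)
      (ℕ.≤-trans (ℕ.≤-reflexive (≡.sym (ℕ.m*n/n≡m (X ℕ.* X) 24576))) (ℕ./-monoˡ-≤ 24576 large))
      ((num 4 * C) ⁻¹) (R.trans (R.*-comm _ _) (inverseʳ 0<4C))
  where
  open LowerBound ℝ using (competitive-algorithm)
  open HardInstance ℝ

  X : ℕ
  X = 40 ℕ.* (128 ℕ.* 128 ℕ.* 128 ℕ.* 256)
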